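{- Let $G$ be a graph that is provable in $\mathsf{GS}\cup\{\mathsf{ss}{\uparrow}\}$. Then $G$ has a proof $\tilde{\mathcal D}$ in $\mathsf{GS}\cup\{\mathsf{ss}{\uparrow}\}$ such that every connector of every graph occurring in $\tilde{\mathcal D}$ is a subconnector of $G$.
   Context: Atoms: fix a countable set $\mathcal V$ of variables and a disjoint copy $\overline{\mathcal V}$; atoms are elements of $\mathcal V\cup\overline{\mathcal V}$, with $\overline{\overline a}=a$. A graph is a finite simple undirected graph with vertices labelled by atoms, identified up to label-preserving isomorphism; $\emptyset$ is the empty graph; $a$ also denotes a one-vertex graph. $G\sqcup H$ (par) is disjoint union; $G\otimes H$ (tensor) is disjoint union plus all edges between $V_G$ and $V_H$. $\overline G$: same vertices, complementary edges, dual labels. A context is a graph $C$ with $R\subseteq V_C$; $C[M]_R$ is $C\sqcup M$ plus all edges between $V_M$ and $R$. A module of $G$ is an induced subgraph $M$ with every outside vertex adjacent to all or none of $M$. A graph $P$ is prime if $|V_P|\ge2$ and its only modules are $\emptyset$, singletons and $P$ (the two prime graphs on two vertices are the edgeless one and the one-edge one). For $G$ with vertices $v_1,\dots,v_n$, $G\langle H_1,\dots,H_n\rangle$ replaces $v_i$ by $H_i$, keeps internal edges, and joins $H_i$ to $H_j$ ($i\neq j$) iff $v_iv_j\in E_G$; $\overline G\langle\cdots\rangle$ uses the same vertex order. Modular decomposition: every nonempty graph is exactly one of: a single vertex; $A\sqcup B$ with $A,B\ne\emptyset$; $A\otimes B$ with $A,B\ne\emptyset$; $P\langle A_1,\dots,A_n\rangle$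 with $P$ prime, $n\ge4$, all $A_i\ne\emptyset$ (obtained from the maximal modules). Recursively decomposing gives the modular decomposition tree, whose internal nodes are (unlabelled) prime graphs: the edgeless two-vertex graph for $\sqcup$, the single-edge graph for $\otimes$, or the prime $P$. A prime graph is a connector of $G$ if it occurs in the modular decomposition of $G$; a subconnector of $G$ is a prime graph isomorphic (ignoring labels) to an induced subgraph of a connector of $G$. Rules (premise $\longrightarrow$ conclusion): $\mathsf{ai}{\downarrow}$: $\emptyset\longrightarrow\overline a\sqcup a$; $\mathsf{ss}{\downarrow}$: $B[A]_S\longrightarrow B\sqcup A$, $S\subseteq V_B$, $S\ne\emptyset$, $A\ne\emptyset$; $\mathsf{p}{\downarrow}$: $(M_1\sqcup N_1)\otimes\cdots\otimes(M_n\sqcup N_n)\longrightarrow\overline P\langle M_1,\dots,M_n\rangle\sqcup P\langle N_1,\dots,N_n\rangle$, $P$ prime, $n=|V_P|\ge4$, all $M_i\ne\emptyset$; $\mathsf{ss}{\uparrow}$: $B\otimes A\longrightarrow B[A]_S$, $S\subseteq V_B$, $S\ne V_B$, $A\ne\emptyset$. $\mathsf{GS}=\{\mathsf{ai}{\downarrow},\mathsf{ss}{\downarrow},\mathsf{p}{\downarrow}\}$. A derivation in a system $\mathsf S$ is a finite sequence of graphs each step of which is a label-preserving isomorphism or replaces $C[X]_R$ by $C[Y]_R$ for a context and an instance $X\longrightarrow Y$ of a rule of $\mathsf S$; a proof of $G$ is a derivation from $\emptyset$ to $G$. -}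

module Defs where

open import Data.Nat using (ℕ; zero; suc; _+_; _≤_)
open import Data.Bool using (Bool; true; false; not; _∧_; _∨_; if_then_else_)
open import Data.Fin using (Fin; zero; suc; splitAt; _≟_)
open import Data.Sum using (_⊎_; inj₁; inj₂)
open import Data.Product using (Σ; _×_; _,_; proj₁; proj₂; ∃)
open import Function using (_∘_)
open import Function.Bundles using (_↔_; Inverse)
open import Function.Definitions using (Injective)
open import Relation.Nullary using (yes; no; does)
open import Relation.Binary.PropositionalEquality using (_≡_; refl)

-- Atoms: variables are natural numbers; the Bool is the polarity
-- (true = a ∈ 𝒱, false = its dual ā ∈ 𝒱̄).

Atom : Set
Atom = ℕ × Bool

dualA : Atom → Atom
dualA (v , b) = (v , not b)

-- Finite simple undirected labelled graphs on vertex set Fin size.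
-- 'raw' is an arbitrary Bool relation; the actual (simple, undirected)
-- adjacency is its irreflexive symmetrisation 'adj'.  Graphs are
-- identified up to label-preserving isomorphism (_≅_) of 'adj'.

record Graph : Set where
  constructor mkGraph
  field
    size  : ℕ
    label : Fin size → Atom
    raw   : Fin size → Fin size → Bool
open Graph public

adj : (G : Graph) → Fin (size G) → Fin (size G) → Bool
adj G x y = not (does (x ≟ y)) ∧ (raw G x y ∨ raw G y x)

record _≅_ (G H : Graph) : Set where
  field
    bij  : Fin (size G) ↔ Fin (size H)
    lab  : ∀ x → label H (Inverse.to bij x) ≡ label G x
    edge : ∀ x y → adj H (Inverse.to bij x) (Inverse.to bij y) ≡ adj G x y

record _≃_ (G H : Graph) : Set where
  field
    bij  : Fin (size G) ↔ Fin (size H)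
    edge : ∀ x y → adj H (Inverse.to bij x) (Inverse.to bij y) ≡ adj G x y

NonEmpty : Graph → Set
NonEmpty G = 1 ≤ size G

emptyG : Graph
emptyG = mkGraph 0 (λ ()) (λ ())

single : Atom → Graph
single a = mkGraph 1 (λ _ → a) (λ _ _ → false)

juxt : (G H : Graph) → (Fin (size G) → Bool) → Graph
juxt G H cross = mkGraph (size G + size H) lab rw
  where
  lab : Fin (size G + size H) → Atom
  lab z with splitAt (size G) z
  ... | inj₁ x = label G x
  ... | inj₂ y = label H y
  rw : Fin (size G + size H) → Fin (size G + size H) → Bool
  rw z w with splitAt (size G) z | splitAt (size G) w
  ... | inj₁ x | inj₁ x' = adj G x x'
  ... | inj₂ y | inj₂ y' = adj H y y'
  ... | inj₁ x | inj₂ _  = cross x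
  ... | inj₂ _ | inj₁ x  = cross x

_⊔_ : Graph → Graph → Graph
G ⊔ H = juxt G H (λ _ → false)

_⊗_ : Graph → Graph → Graph
G ⊗ H = juxt G H (λ _ → true)

plug : (C : Graph) → (Fin (size C) → Bool) → Graph → Graph
plug C R M = juxt C M R

compl : Graph → Graph
compl G = mkGraph (size G) (dualA ∘ label G) (λ x y → not (adj G x y))

sumF : (n : ℕ) → (Fin n → ℕ) → ℕ
sumF zero    k = 0
sumF (suc n) k = k zero + sumF n (k ∘ suc)

unpair : (n : ℕ) (k : Fin n → ℕ) → Fin (sumF n k) → Σ (Fin n) (λ i → Fin (k i))
unpair (suc n) k z with splitAt (k zero) z
... | inj₁ y = zero , y
... | inj₂ w with unpair n (k ∘ suc) w
...   | i , a = suc i , a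

substAdj : (P : Graph) (Hs : Fin (size P) → Graph) (i j : Fin (size P)) →
           Fin (size (Hs i)) → Fin (size (Hs j)) → Bool
substAdj P Hs i j a b with i ≟ j
... | yes refl = adj (Hs i) a b
... | no _     = adj P i j

subst : (P : Graph) → (Fin (size P) → Graph) → Graph
subst P Hs = mkGraph N lab rw
  where
  N : ℕ
  N = sumF (size P) (size ∘ Hs)
  lab : Fin N → Atom
  lab z = label (Hs (proj₁ (unpair (size P) (size ∘ Hs) z)))
                (proj₂ (unpair (size P) (size ∘ Hs) z))
  rw : Fin N → Fin N → Bool
  rw z w = substAdj P Hs (proj₁ (unpair (size P) (size ∘ Hs) z))
                         (proj₁ (unpair (size P) (size ∘ Hs) w))
                         (proj₂ (unpair (size P) (size ∘ Hs) z))
                         (proj₂ (unpair (size P) (size ∘ Hs) w))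

-- complete graph on n vertices (labels irrelevant), used for the n-ary tensor
complete : ℕ → Graph
complete n = mkGraph n (λ _ → (0 , true)) (λ _ _ → true)

bigTensor : (n : ℕ) → (Fin n → Graph) → Graph
bigTensor n Xs = subst (complete n) Xs

IsModule : (G : Graph) → (Fin (size G) → Bool) → Set
IsModule G M = ∀ v x y → M v ≡ false → M x ≡ true → M y ≡ true →
               adj G v x ≡ adj G v y

IsEmptySet : ∀ {n} → (Fin n → Bool) → Set
IsEmptySet M = ∀ x → M x ≡ false

IsSingleton : ∀ {n} → (Fin n → Bool) → Set
IsSingleton {n} M = Σ (Fin n) λ x → ∀ y → (M y ≡ true → y ≡ x) × (y ≡ x → M y ≡ true)

IsFull : ∀ {n} → (Fin n → Bool) → Set
IsFull M = ∀ x → M x ≡ true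

Prime : Graph → Set
Prime P = 2 ≤ size P ×
  (∀ M → IsModule P M → IsEmptySet M ⊎ IsSingleton M ⊎ IsFull M)

-- Modular decomposition and connectors.
-- A node of the decomposition: G ≅ Q⟨A₁,…,Aₙ⟩ with all Aᵢ nonempty,
-- Q prime and either |V_Q| = 2 (Q is the edgeless graph: G = A ⊔ B, or
-- the one-edge graph: G = A ⊗ B) or |V_Q| ≥ 4.

DecompNode : (Q : Graph) → (Fin (size Q) → Graph) → Set
DecompNode Q As = (∀ i → NonEmpty (As i)) × Prime Q × (size Q ≡ 2 ⊎ 4 ≤ size Q)

data Connector (P : Graph) : Graph → Set where
  here  : ∀ {G} (Q : Graph) (As : Fin (size Q) → Graph) →
          DecompNode Q As → G ≅ subst Q As → P ≃ Q → Connector P G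
  below : ∀ {G} (Q : Graph) (As : Fin (size Q) → Graph) →
          DecompNode Q As → G ≅ subst Q As →
          (i : Fin (size Q)) → Connector P (As i) → Connector P G

InducedSub : Graph → Graph → Set
InducedSub Q P = Σ (Fin (size Q) → Fin (size P)) λ f →
  Injective _≡_ _≡_ f × (∀ x y → adj P (f x) (f y) ≡ adj Q x y)

Subconnector : Graph → Graph → Set
Subconnector Q G = Prime Q × Σ Graph λ P → Connector P G × InducedSub Q P

data aiDown : Graph → Graph → Set where
  ai : ∀ a → aiDown emptyG (single (dualA a) ⊔ single a)

data ssDown : Graph → Graph → Set where
  ss : ∀ B A (S : Fin (size B) → Bool) → (∃ λ x → S x ≡ true) → NonEmpty A →
       ssDown (plug B S A) (B ⊔ A)

data pDown : Graph → Graph → Set where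
  p : ∀ (P : Graph) (Ms Ns : Fin (size P) → Graph) → Prime P → 4 ≤ size P →
      (∀ i → NonEmpty (Ms i)) →
      pDown (bigTensor (size P) (λ i → Ms i ⊔ Ns i))
            (subst (compl P) Ms ⊔ subst P Ns)

data ssUp : Graph → Graph → Set where
  ss : ∀ B A (S : Fin (size B) → Bool) → (∃ λ x → S x ≡ false) → NonEmpty A →
       ssUp (B ⊗ A) (plug B S A)

data GSssUp (X Y : Graph) : Set where
  r-ai  : aiDown X Y → GSssUp X Y
  r-ss  : ssDown X Y → GSssUp X Y
  r-p   : pDown X Y → GSssUp X Y
  r-ssu : ssUp X Y → GSssUp X Y

System : Set₁
System = Graph → Graph → Set

data Step (S : System) (G H : Graph) : Set where
  iso  : G ≅ H → Step S G H
  rule : (C : Graph) (R : Fin (size C) → Bool) (X Y : Graph) →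
         S X Y → G ≅ plug C R X → H ≅ plug C R Y → Step S G H

data Derivation (S : System) : Graph → Graph → Set where
  done : ∀ G → Derivation S G G
  step : ∀ {G H K} → Step S G H → Derivation S H K → Derivation S G K

AllOccurring : ∀ {S G H} → (Graph → Set) → Derivation S G H → Set
AllOccurring Q (done G) = Q G
AllOccurring Q (step {G = G} s d) = Q G × AllOccurring Q d

Proof : System → Graph → Set
Proof S G = Derivation S emptyG G

{-# OPTIONS --safe #-}

-- Provability is first characterised by a shallow calculus on vertex sets of a fixed graph.
-- Besides the axiom a ⊔ ā it has two rules: from G ⊔ D and W infer G ⊔ W[D]_R, and, for P prime,
-- from all Oᵢ ⊔ Mᵢ ⊔ Nᵢ infer (⨆ Oᵢ) ⊔ P⟨M⟩ ⊔ P̄⟨N⟩.  Each rule X ⟶ Y of the system, in any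
-- context, makes the disjoint union of the dual of C[X]_R with C[Y]_R provable in the calculus, so
-- cut elimination for the calculus shows that it proves everything the system proves.
-- Conversely a proof in the calculus unfolds into a derivation with ai↓, ss↓ and p↓ in which ss↓
-- is only used to take a module out of a larger one.  A prime induced subgraph meets a module in
-- at most one vertex or lies inside it, so all prime induced subgraphs of all graphs that occur
-- are already induced subgraphs of G; and a prime induced subgraph of G is one of a connector of G.
-- Cut elimination goes by induction on the cut graph A.  If A or its dual is disconnected, the
-- other one is connected and principal; otherwise both are, and two modules split off A are
-- disjoint, nested or overlapping, while a module of P⟨M⟩ other than the whole lies in some Mᵢ.
module Submission where

open import Defs
open import Data.Bool using (Bool; true; false; not; _∧_; _∨_)
import Data.Bool.Properties as Bool
open import Data.Empty using (⊥; ⊥-elim)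
open import Data.Fin using (Fin; zero; suc; splitAt; _↑ˡ_; _↑ʳ_)
import Data.Fin.Properties as Fin
open import Data.List using (List; []; _∷_; allFin)
open import Data.List.Membership.Propositional using (_∈_)
import Data.List.Membership.Propositional.Properties as List
open import Data.List.Relation.Unary.Any using (here; there)
open import Data.Nat using (ℕ; zero; suc; _+_; _≤_; _<_; z≤n; s≤s)
import Data.Nat.Properties as Nat
open import Data.Product using (Σ; _×_; _,_; proj₁; proj₂; ∃; ∃₂)
import Data.Product.Properties as Product
open import Data.Sum using (_⊎_; inj₁; inj₂; [_,_])
import Data.Sum.Properties as Sum
open import Data.Unit using (⊤; tt)
open import Function using (_∘_; id; case_of_)
open import Function.Bundles using (Inverse; mk↔ₛ′)
import Function.Properties.Inverse as Inverses
open import Relation.Binary.Definitions using (DecidableEquality)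
open import Relation.Binary.PropositionalEquality using (_≡_; _≢_; refl; sym; trans; cong; cong₂)
  renaming (subst to ≡-subst)
open import Relation.Nullary using (¬_; Dec; yes; no; does)
open import Relation.Nullary.Decidable using (_×-dec_; _⊎-dec_; ¬?; _→-dec_; map′; dec-true; dec-false; decidable-stable)

-- Working with predicates on one ambient vertex type, rather than with graphs up to isomorphism,
-- makes it possible to compare the modules of two proofs as sets and to keep the cut graph and its
-- dual side by side; isomorphisms are needed only at the two ends. The parts Oᵢ are what lets a cut
-- pass above the prime rule: a component cut inside one premise is exchanged for an arbitrary
-- context, and this context must be able to stay in that premise. The bound 4 on prime graphs
-- enters mostly as the existence of a vertex different from two given ones, since several
-- contradictions come from two modules that would together cover everything. The obstacle is the
-- case of overlapping modules: the context of one of the cuts would still contain vertices of the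
-- cut graph, possibly adjacent to those being cut. They are moved into a second, disjoint copy, and
-- for this reason cut elimination is stated for all vertex types at once.

data Role : Set where
  M N O : Role

swapRole : Role → Role
swapRole M = N
swapRole N = M
swapRole O = O

_≟R_ : DecidableEquality Role
M ≟R M = yes refl
M ≟R N = no λ ()
M ≟R O = no λ ()
N ≟R M = no λ ()
N ≟R N = yes refl
N ≟R O = no λ ()
O ≟R M = no λ ()
O ≟R N = no λ ()
O ≟R O = yes refl

roleEdge : Role → Role → Bool → Bool
roleEdge M M b = b
roleEdge N N b = not b
roleEdge _ _ _ = false

true≢false : ∀ {b} → b ≡ true → b ≡ false → ⊥
true≢false refl ()

-- Vertex sets and the shallow calculus

module Sets {V : Set} where
  infixr 6 _∪_ _∩_
  infix 4 _⊆_ _≐_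

  _∪_ _∩_ : (V → Set) → (V → Set) → V → Set
  (X ∪ Y) v = X v ⊎ Y v
  (X ∩ Y) v = X v × Y v

  _∖_ : (V → Set) → (V → Set) → V → Set
  (X ∖ Y) v = X v × ¬ Y v

  _⊆_ _≐_ : (V → Set) → (V → Set) → Set
  X ⊆ Y = ∀ {v} → X v → Y v
  X ≐ Y = X ⊆ Y × Y ⊆ X

  Decidable : (V → Set) → Set
  Decidable X = ∀ v → Dec (X v)

open Sets public

module Calculus {V : Set} (E : V → V → Bool) (lab : V → Atom) where

  Sep : (V → Set) → (V → Set) → Set
  Sep X Y = ∀ {x y} → X x → Y y → x ≢ y × E x y ≡ false

  -- F i M and F i N are the blocks substituted for vertex i in P and in its
  -- complement; F i O is the part of the i-th premise that is not principal.
  record Layout {I : Set} (P : I → I → Bool) (F : I → Role → V → Set) : Set where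
    field
      unique : ∀ {i j ρ σ x} → F i ρ x → F j σ x → i ≡ j × ρ ≡ σ
      same   : ∀ {i ρ σ x y} → F i ρ x → F i σ y → ρ ≢ σ → E x y ≡ false
      diff   : ∀ {i j ρ σ x y} → i ≢ j → F i ρ x → F j σ y → E x y ≡ roleEdge ρ σ (P i j)

  -- The premises of every rule are induced subgraphs of its conclusion.  In plg they are
  -- G ⊔ D and W, and the conclusion is G ⊔ W[D]_R with R the neighbours of D in W.
  data ⊢ (U : V → Set) : Set₁ where
    ε    : (∀ {x} → ¬ U x) → ⊢ U
    ax   : ∀ x y → U x → U y → (∀ {z} → U z → z ≡ x ⊎ z ≡ y) →
           E x y ≡ false → lab x ≡ dualA (lab y) → ⊢ U
    plg  : ∀ G D W → U ≐ (G ∪ D) ∪ W → Sep G D → Sep G W →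
           (∀ {x y} → D x → W y → x ≢ y) →
           (∀ {x x′ y} → D x → D x′ → W y → E x y ≡ E x′ y) →
           ⊢ (G ∪ D) → ⊢ W → ⊢ U
    prm  : ∀ (Q : Graph) (F : Fin (size Q) → Role → V → Set) → Prime Q → 4 ≤ size Q →
           Layout (adj Q) F →
           (∀ i → ∃ (F i M)) → (∀ i → ∃ (F i N)) →
           U ≐ (λ x → ∃₂ λ i ρ → F i ρ x) →
           (∀ i → ⊢ (λ x → ∃ λ ρ → F i ρ x)) → ⊢ U

  resp : ∀ {U W} → U ≐ W → ⊢ U → ⊢ W
  resp (f , g) (ε e) = ε (e ∘ g)
  resp (f , g) (ax x y ux uy uz e l) = ax x y (f ux) (f uy) (uz ∘ g) e l
  resp (f , g) (plg G D W (h , k) a b c d h₁ h₂) = plg G D W (h ∘ g , f ∘ k) a b c d h₁ h₂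
  resp (f , g) (prm Q F a b c d e (h , k) ps) = prm Q F a b c d e (h ∘ g , f ∘ k) ps

  -- Mix is the instance of `plg` in which `D` is empty.
  Sep-mix : ∀ {X Y} → Sep X Y → ⊢ X → ⊢ Y → ⊢ (X ∪ Y)
  Sep-mix {X} {Y} s h₁ h₂ = plg X (λ _ → ⊥) Y
    ( [ inj₁ ∘ inj₁ , inj₂ ] , [ [ inj₁ , ⊥-elim ] , inj₂ ] )
    (λ _ ()) s (λ ()) (λ ()) (resp (inj₁ , [ id , ⊥-elim ]) h₁) h₂

  -- Every vertex of `U` occurs in an axiom leaf, so a proof makes `U` finite and searchable. This
  -- is the source of decisions about sets of which only a proof is at hand.
  search : ∀ {U} → ⊢ U → ∀ {A : V → Set} → Decidable A → Dec (∃ λ x → U x × A x)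
  search (ε e) A? = no λ (x , u , _) → e u
  search (ax x y ux uy uz _ _) A? with A? x | A? y
  ... | yes a | _ = yes (x , ux , a)
  ... | no _ | yes a = yes (y , uy , a)
  ... | no a | no b = no λ (z , u , c) → case uz u of λ { (inj₁ refl) → a c ; (inj₂ refl) → b c }
  search (plg G D W (f , g) _ _ _ _ h₁ h₂) A? with search h₁ A? | search h₂ A?
  ... | yes (x , u , a) | _ = yes (x , g (inj₁ u) , a)
  ... | no _ | yes (x , u , a) = yes (x , g (inj₂ u) , a)
  ... | no a | no b = no λ (x , u , c) → case f u of λ { (inj₁ w) → a (x , w , c) ; (inj₂ w) → b (x , w , c) }
  search (prm Q F _ _ _ _ _ (f , g) ps) A? with Fin.any? (λ i → search (ps i) A?)
  ... | yes (i , x , (ρ , u) , a) = yes (x , g (i , ρ , u) , a)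
  ... | no a = no λ (x , u , c) → let (i , w) = f u in a (i , x , w , c)

  module _ (_≟V_ : DecidableEquality V) where
    mem? : ∀ {U} → ⊢ U → Decidable U
    mem? h v = map′ (λ { (x , u , refl) → u }) (λ u → v , u , refl) (search h (_≟V v))

module Transfer {V V′ : Set} (E : V → V → Bool) (lab : V → Atom) (E′ : V′ → V′ → Bool) (lab′ : V′ → Atom)
  (R : V → V′ → Set)
  (Rinj : ∀ {v w w′} → R v w → R v w′ → w ≡ w′)
  (Rfun : ∀ {v v′ w} → R v w → R v′ w → v ≡ v′)
  (RE : ∀ {v v′ w w′} → R v w → R v′ w′ → E v v′ ≡ E′ w w′)
  (Rlab : ∀ {v w} → R v w → lab v ≡ lab′ w) where

  private
    module A = Calculus E lab
    module B = Calculus E′ lab′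

    image : (V → Set) → V′ → Set
    image X w = ∃ λ v → X v × R v w

  -- `R` is the graph of a partial injection that preserves edges and labels. A relation suits maps
  -- defined on `U` only, such as leaving an enlarged vertex type again, or moving just some of the
  -- vertices. Edges are compared on the diagonal as well, because `E` may have loops.
  transfer : ∀ {U} → (∀ {x} → U x → ∃ (R x)) → A.⊢ U → B.⊢ (image U)
  transfer t (A.ε e) = B.ε λ (_ , u , _) → e u
  transfer t (A.ax x y ux uy uz e l) with t ux | t uy
  ... | x′ , rx | y′ , ry = B.ax x′ y′ (x , ux , rx) (y , uy , ry)
    (λ { (z , u , r) → case uz u of λ { (inj₁ refl) → inj₁ (Rinj r rx) ; (inj₂ refl) → inj₂ (Rinj r ry) } })
    (trans (sym (RE rx ry)) e) (trans (sym (Rlab rx)) (trans l (cong dualA (Rlab ry))))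
  transfer t (A.plg G D W (f , g) s₁ s₂ dj md h₁ h₂) = B.plg (image G) (image D) (image W)
    ( (λ { (v , u , r) → case f u of λ { (inj₁ (inj₁ z)) → inj₁ (inj₁ (v , z , r))
                                       ; (inj₁ (inj₂ z)) → inj₁ (inj₂ (v , z , r))
                                       ; (inj₂ z) → inj₂ (v , z , r) } })
    , (λ { (inj₁ (inj₁ (v , z , r))) → v , g (inj₁ (inj₁ z)) , r
         ; (inj₁ (inj₂ (v , z , r))) → v , g (inj₁ (inj₂ z)) , r
         ; (inj₂ (v , z , r)) → v , g (inj₂ z) , r }) )
    (sep s₁) (sep s₂)
    (λ { (v , z , r) (v′ , z′ , r′) refl → dj z z′ (Rfun r r′) })
    (λ { (_ , z , r) (_ , z′ , r′) (_ , w , q) → trans (sym (RE r q)) (trans (md z z′ w) (RE r′ q)) })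
    (B.resp ( (λ { (v , inj₁ z , r) → inj₁ (v , z , r) ; (v , inj₂ z , r) → inj₂ (v , z , r) })
            , (λ { (inj₁ (v , z , r)) → v , inj₁ z , r ; (inj₂ (v , z , r)) → v , inj₂ z , r }) )
            (transfer (t ∘ g ∘ inj₁) h₁))
    (transfer (t ∘ g ∘ inj₂) h₂)
    where
    sep : ∀ {X Y} → A.Sep X Y → B.Sep (image X) (image Y)
    sep s (_ , x , r) (_ , y , r′) = (λ { refl → proj₁ (s x y) (Rfun r r′) }) , trans (sym (RE r r′)) (proj₂ (s x y))
  transfer t (A.prm Q F pr sz lay m n (f , g) ps) = B.prm Q (λ i ρ → image (F i ρ)) pr sz
    (record
      { unique = λ { (v , x , r) (v′ , y , r′) → case Rfun r r′ of λ { refl → A.Layout.unique lay x y } }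
      ; same = λ { (v , x , r) (v′ , y , r′) ne → trans (sym (RE r r′)) (A.Layout.same lay x y ne) }
      ; diff = λ { ne (v , x , r) (v′ , y , r′) → trans (sym (RE r r′)) (A.Layout.diff lay ne x y) } })
    (λ i → im i M (m i)) (λ i → im i N (n i))
    ( (λ { (v , u , r) → let (i , ρ , w) = f u in i , ρ , v , w , r })
    , (λ { (i , ρ , v , w , r) → v , g (i , ρ , w) , r }) )
    (λ i → B.resp ( (λ { (v , (ρ , w) , r) → ρ , v , w , r }) , (λ { (ρ , v , w , r) → v , (ρ , w) , r }) )
                  (transfer (λ { (ρ , u) → t (g (i , ρ , u)) }) (ps i)))
    where
    im : ∀ i ρ → ∃ (F i ρ) → ∃ (image (F i ρ))
    im i ρ (x , u) = let (y , r) = t (g (i , ρ , u)) in y , x , u , r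

-- Duality, adjacency and prime graphs

dualA-invol : ∀ a → dualA (dualA a) ≡ a
dualA-invol (v , true)  = refl
dualA-invol (v , false) = refl

dualA-≢ : ∀ a → a ≢ dualA a
dualA-≢ (v , true) ()
dualA-≢ (v , false) ()

dual-sym : ∀ {a b} → a ≡ dualA b → b ≡ dualA a
dual-sym {b = b} refl = sym (dualA-invol b)

does-true : ∀ {A : Set} (d : Dec A) → does d ≡ true → A
does-true (yes a) _ = a

does-false : ∀ {A : Set} (d : Dec A) → does d ≡ false → ¬ A
does-false (no a) _ = a

≢true⇒false : ∀ {b} → b ≢ true → b ≡ false
≢true⇒false {true} n = ⊥-elim (n refl)
≢true⇒false {false} n = refl

adj-sym : ∀ G x y → adj G x y ≡ adj G y x
adj-sym G x y with x Fin.≟ y | y Fin.≟ x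
... | yes _ | yes _ = refl
... | yes e | no n = ⊥-elim (n (sym e))
... | no n | yes e = ⊥-elim (n (sym e))
... | no _ | no _ = Bool.∨-comm (raw G x y) (raw G y x)

adj-irrefl : ∀ G x → adj G x x ≡ false
adj-irrefl G x with x Fin.≟ x
... | yes _ = refl
... | no n = ⊥-elim (n refl)

adj-compl : ∀ G {x y} → x ≢ y → adj (compl G) x y ≡ not (adj G x y)
adj-compl G {x} {y} ne with x Fin.≟ y
... | yes e = ⊥-elim (ne e)
... | no _ with y Fin.≟ x
...   | yes e = ⊥-elim (ne (sym e))
...   | no _ with raw G x y | raw G y x
...     | true | true = refl
...     | true | false = refl
...     | false | true = refl
...     | false | false = refl

compl-prime : ∀ {G} → Prime G → Prime (compl G)
compl-prime {G} (s , h) = s , λ X md → h X λ v x y nv mx my →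
  let nx : v ≢ x
      nx = λ { refl → true≢false mx nv }
      ny : v ≢ y
      ny = λ { refl → true≢false my nv }
  in Bool.not-injective (trans (sym (adj-compl G nx)) (trans (md v x y nv mx my) (adj-compl G ny)))

avoid₂ : ∀ {n} → 3 ≤ n → (i j : Fin n) → ∃ λ k → k ≢ i × k ≢ j
avoid₂ (s≤s (s≤s (s≤s _))) zero zero = suc zero , (λ ()) , (λ ())
avoid₂ (s≤s (s≤s (s≤s _))) zero (suc zero) = suc (suc zero) , (λ ()) , (λ ())
avoid₂ (s≤s (s≤s (s≤s _))) zero (suc (suc j)) = suc zero , (λ ()) , (λ ())
avoid₂ (s≤s (s≤s (s≤s _))) (suc zero) zero = suc (suc zero) , (λ ()) , (λ ())
avoid₂ (s≤s (s≤s (s≤s _))) (suc (suc i)) zero = suc zero , (λ ()) , (λ ())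
avoid₂ (s≤s (s≤s (s≤s _))) (suc i) (suc j) = zero , (λ ()) , (λ ())

3≤⇐4≤ : ∀ {n} → 4 ≤ n → 3 ≤ n
3≤⇐4≤ (s≤s (s≤s (s≤s (s≤s _)))) = s≤s (s≤s (s≤s z≤n))

-- The vertices other than `k` would form a proper module with at least two elements.
no-uniform-vertex : ∀ {Q} → Prime Q → 3 ≤ size Q → ∀ k →
  ¬ (∀ {x y} → x ≢ k → y ≢ k → adj Q k x ≡ adj Q k y)
no-uniform-vertex {Q} (_ , triv) sz k uniform = absurd (triv others others-module)
  where
  others : Fin (size Q) → Bool
  others i = not (does (i Fin.≟ k))
  others-in : ∀ {i} → i ≢ k → others i ≡ true
  others-in {i} ne = cong not (dec-false (i Fin.≟ k) ne)
  others-out : ∀ {i} → others i ≡ false → i ≡ k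
  others-out {i} o with i Fin.≟ k
  ... | yes e = e
  others-≢ : ∀ {i} → others i ≡ true → i ≢ k
  others-≢ {i} o refl = true≢false o (cong not (dec-true (i Fin.≟ k) refl))
  others-module : IsModule Q others
  others-module v x y nv ox oy with others-out {v} nv
  ... | refl = uniform (others-≢ ox) (others-≢ oy)
  absurd : ¬ (IsEmptySet others ⊎ IsSingleton others ⊎ IsFull others)
  absurd (inj₁ em) with avoid₂ sz k k
  ... | j , ne , _ = true≢false (others-in ne) (em j)
  absurd (inj₂ (inj₁ (i , sg))) with avoid₂ sz k i
  ... | j , ne , ne′ = ne′ (proj₁ (sg j) (others-in ne))
  absurd (inj₂ (inj₂ fl)) = others-≢ {k} (fl k) refl

-- Among the three pairs of a three-vertex graph two have the same value, and these two share a
-- vertex, which is then uniform.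
prime-size : ∀ {Q} → Prime Q → size Q ≡ 2 ⊎ 4 ≤ size Q
prime-size {mkGraph 1 _ _} (s≤s () , _)
prime-size {mkGraph 2 _ _} pr = inj₁ refl
prime-size {Q@(mkGraph 3 _ _)} pr = ⊥-elim (three-vertices (adj Q a b Bool.≟ adj Q a c) (adj Q a c Bool.≟ adj Q b c))
  where
  a b c : Fin 3
  a = zero
  b = suc zero
  c = suc (suc zero)
  uniform : ∀ k → (∀ x y → x ≢ k → y ≢ k → adj Q k x ≡ adj Q k y) → ⊥
  uniform k u = no-uniform-vertex {Q} pr (s≤s (s≤s (s≤s z≤n))) k (u _ _)
  case-a : adj Q a b ≡ adj Q a c → ∀ x y → x ≢ a → y ≢ a → adj Q a x ≡ adj Q a y
  case-a e zero y n _ = ⊥-elim (n refl)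
  case-a e (suc x) zero _ n = ⊥-elim (n refl)
  case-a e (suc zero) (suc zero) _ _ = refl
  case-a e (suc zero) (suc (suc zero)) _ _ = e
  case-a e (suc (suc zero)) (suc zero) _ _ = sym e
  case-a e (suc (suc zero)) (suc (suc zero)) _ _ = refl
  case-b : adj Q b a ≡ adj Q b c → ∀ x y → x ≢ b → y ≢ b → adj Q b x ≡ adj Q b y
  case-b e (suc zero) y n _ = ⊥-elim (n refl)
  case-b e x (suc zero) _ n = ⊥-elim (n refl)
  case-b e zero zero _ _ = refl
  case-b e zero (suc (suc zero)) _ _ = e
  case-b e (suc (suc zero)) zero _ _ = sym e
  case-b e (suc (suc zero)) (suc (suc zero)) _ _ = refl
  case-c : adj Q c a ≡ adj Q c b → ∀ x y → x ≢ c → y ≢ c → adj Q c x ≡ adj Q c y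
  case-c e (suc (suc zero)) y n _ = ⊥-elim (n refl)
  case-c e x (suc (suc zero)) _ n = ⊥-elim (n refl)
  case-c e zero zero _ _ = refl
  case-c e zero (suc zero) _ _ = e
  case-c e (suc zero) zero _ _ = sym e
  case-c e (suc zero) (suc zero) _ _ = refl
  Bool-two : ∀ x y z → x ≢ y → y ≢ z → x ≡ z
  Bool-two true true z n _ = ⊥-elim (n refl)
  Bool-two false false z n _ = ⊥-elim (n refl)
  Bool-two true false true _ _ = refl
  Bool-two true false false _ n = ⊥-elim (n refl)
  Bool-two false true true _ n = ⊥-elim (n refl)
  Bool-two false true false _ _ = refl
  three-vertices : Dec (adj Q a b ≡ adj Q a c) → Dec (adj Q a c ≡ adj Q b c) → ⊥
  three-vertices (yes e) _ = uniform a (case-a e)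
  three-vertices (no _) (yes e) = uniform c (case-c (trans (adj-sym Q c a) (trans e (adj-sym Q b c))))
  three-vertices (no n) (no n′) = uniform b (case-b (trans (adj-sym Q b a) (Bool-two _ _ _ n n′)))
prime-size {mkGraph (suc (suc (suc (suc _)))) _ _} pr = inj₂ (s≤s (s≤s (s≤s (s≤s z≤n))))

unswap : ∀ {I V : Set} (F : I → Role → V → Set) {i} ρ {x} → F i ρ x → ∃ λ ρ → F i (swapRole ρ) x
unswap F M a = N , a
unswap F N a = M , a
unswap F O a = O , a

-- Modules and connectedness of substitutions into a prime graph

module Blocks {V : Set} (E : V → V → Bool) (Esym : ∀ x y → E x y ≡ E y x)
  (Q : Graph) (Q-prime : Prime Q) (Q-size : 4 ≤ size Q)
  (X : Fin (size Q) → V → Set) (X-inhabited : ∀ i → ∃ (X i))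
  (X-search : ∀ i {A : V → Set} → Decidable A → Dec (∃ λ x → X i x × A x))
  (X-edge : ∀ {i j x y} → i ≢ j → X i x → X j y → E x y ≡ adj Q i j) where

  -- The indices of the blocks met by `T` form a module of `Q`, since a block that is not met lies
  -- outside `T` entirely. This module is not full: the vertex `x₀` outside `T` sees all of `T`
  -- alike, so its index `i₀` would be uniform in `Q`. Only a single index remains.
  module-in-block : (T : V → Set) → Decidable T →
    (∀ {i j j′ x y y′} → X i x → ¬ T x → X j y → T y → X j′ y′ → T y′ → E x y ≡ E x y′) →
    (∃₂ λ i x → X i x × T x) → (∃₂ λ i x → X i x × ¬ T x) →
    ∃ λ i → ∀ {j x} → X j x → T x → j ≡ i
  module-in-block T T? md (i₁ , x₁ , u₁ , t₁) (i₀ , x₀ , u₀ , t₀) = answer (proj₂ Q-prime hit hit-module)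
    where
    hit? : ∀ i → Dec (∃ λ x → X i x × T x)
    hit? i = X-search i T?
    hit : Fin (size Q) → Bool
    hit i = does (hit? i)
    hit-module : IsModule Q hit
    hit-module v x y nv hx hy with X-inhabited v | does-true (hit? x) hx | does-true (hit? y) hy
    ... | w , uw | a , ua , ta | b , ub , tb =
      trans (sym (X-edge v≢x uw ua)) (trans (md uw ¬tw ua ta ub tb) (X-edge v≢y uw ub))
      where
      ¬tw : ¬ T w
      ¬tw t = does-false (hit? v) nv (w , uw , t)
      v≢x : v ≢ x
      v≢x refl = true≢false hx nv
      v≢y : v ≢ y
      v≢y refl = true≢false hy nv
    answer : _ → _
    answer (inj₁ em) = ⊥-elim (true≢false (dec-true (hit? i₁) (x₁ , u₁ , t₁)) (em i₁))
    answer (inj₂ (inj₁ (i , sg))) = i , λ {j} {x} u t → proj₁ (sg j) (dec-true (hit? j) (x , u , t))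
    answer (inj₂ (inj₂ full)) = ⊥-elim (no-uniform-vertex {Q} Q-prime (3≤⇐4≤ Q-size) i₀ λ {x} {y} nx ny →
      let (a , ua , ta) = does-true (hit? x) (full x)
          (b , ub , tb) = does-true (hit? y) (full y)
      in trans (sym (X-edge (nx ∘ sym) u₀ ua)) (trans (md u₀ t₀ ua ta ub tb) (X-edge (ny ∘ sym) u₀ ub)))

  -- Without edges between them, `T` and its complement are both modules. If both were inhabited,
  -- each would lie in one block, but `Q` has a third vertex.
  blocks-connected : (T : V → Set) → Decidable T →
    (∀ {i j x y} → X i x → ¬ T x → X j y → T y → E x y ≡ false) →
    (∃₂ λ i x → X i x × T x) → ∀ {i x} → X i x → T x
  blocks-connected T T? cl t {i} {x} u with T? x
  ... | yes tx = tx
  ... | no ¬tx with module-in-block T T? (λ a b c d e f → trans (cl a b c d) (sym (cl a b e f))) t (i , x , u , ¬tx)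
                  | module-in-block (λ v → ¬ T v) (λ v → ¬? (T? v))
                      (λ {i} {j} {j′} {x} {y} {y′} a b c d e f →
                         let tx = decidable-stable (T? x) b in
                         trans (trans (Esym x y) (cl c d a tx)) (sym (trans (Esym x y′) (cl e f a tx))))
                      (i , x , u , ¬tx) (let (j , y , w , ty) = t in j , y , w , λ n → n ty)
  ... | k , in-k | l , in-l with avoid₂ (3≤⇐4≤ Q-size) k l
  ...   | m , m≢k , m≢l with X-inhabited m
  ...     | y , uy with T? y
  ...       | yes ty = ⊥-elim (m≢k (in-k uy ty))
  ...       | no ¬ty = ⊥-elim (m≢l (in-l uy ¬ty))

-- Moving a cut upwards until it is principal

module Reduction {V : Set} (_≟V_ : DecidableEquality V) (E : V → V → Bool) (Esym : ∀ x y → E x y ≡ E y x)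
  (lab : V → Atom) where
  open Calculus E lab public

  Sep-sym : ∀ {X Y} → Sep X Y → Sep Y X
  Sep-sym s y x = let (n , e) = s x y in (n ∘ sym) , trans (Esym _ _) e

  -- The rule `prm` is symmetric in M and N up to complementing `Q`, so arguments about N-parts
  -- reduce to those about M-parts.
  swapLayout : ∀ (Q : Graph) {F : Fin (size Q) → Role → V → Set} → Layout (adj Q) F →
               Layout (adj (compl Q)) (λ i ρ → F i (swapRole ρ))
  swapLayout Q L = record
    { unique = λ u w → let (e , f) = Layout.unique L u w in e , swap-inj f
    ; same = λ u w ne → Layout.same L u w (λ e → ne (swap-inj e))
    ; diff = λ {i} {j} {ρ} {σ} ne u w → trans (Layout.diff L ne u w) (edge ρ σ ne) }
    where
    swap-inj : ∀ {ρ σ} → swapRole ρ ≡ swapRole σ → ρ ≡ σ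
    swap-inj {M} {M} _ = refl
    swap-inj {N} {N} _ = refl
    swap-inj {O} {O} _ = refl
    edge : ∀ ρ σ {i j} → i ≢ j → roleEdge (swapRole ρ) (swapRole σ) (adj Q i j) ≡ roleEdge ρ σ (adj (compl Q) i j)
    edge M M ne = sym (adj-compl Q ne)
    edge M N ne = refl
    edge M O ne = refl
    edge N M ne = refl
    edge N N ne = trans (sym (Bool.not-involutive _)) (cong not (sym (adj-compl Q ne)))
    edge N O ne = refl
    edge O M ne = refl
    edge O N ne = refl
    edge O O ne = refl

  role? : ∀ {I : Set} {P : I → I → Bool} {F : I → Role → V → Set} → Layout P F →
          ∀ i → ⊢ (λ x → ∃ λ ρ → F i ρ x) → ∀ ρ → Decidable (F i ρ)
  role? L i h ρ v with mem? _≟V_ h v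
  ... | no n = no λ u → n (ρ , u)
  ... | yes (σ , u) with σ ≟R ρ
  ...   | yes refl = yes u
  ...   | no ne = no λ w → ne (proj₂ (Layout.unique L u w))

  role-search : ∀ {I : Set} {P : I → I → Bool} {F : I → Role → V → Set} → Layout P F →
          ∀ i → ⊢ (λ x → ∃ λ ρ → F i ρ x) → ∀ ρ → {A : V → Set} → Decidable A → Dec (∃ λ x → F i ρ x × A x)
  role-search L i h ρ A? = map′ (λ { (x , _ , u , a) → x , u , a }) (λ { (x , u , a) → x , (ρ , u) , u , a })
    (search h (λ v → role? L i h ρ v ×-dec A? v))

  -- A cut inside block `i₀` takes `S` away and leaves the context `Γ` in the same premise as a part
  -- that is not principal.
  replace : ∀ {I : Set} → (I → Role → V → Set) → I → (V → Set) → (V → Set) → I → Role → V → Set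
  replace F i₀ S Γ i ρ x = (F i ρ x × ¬ S x) ⊎ (i ≡ i₀ × ρ ≡ O × Γ x)

  replaceLayout : ∀ {I : Set} {P : I → I → Bool} {F : I → Role → V → Set} {i₀ S Γ} → Layout P F →
    (∀ {i ρ x y} → Γ x → F i ρ y → ¬ S y → x ≢ y × E x y ≡ false) → Layout P (replace F i₀ S Γ)
  replaceLayout L ΓF = record
    { unique = λ { (inj₁ (u , _)) (inj₁ (w , _)) → Layout.unique L u w
                 ; (inj₁ (u , ns)) (inj₂ (_ , _ , x)) → ⊥-elim (proj₁ (ΓF x u ns) refl)
                 ; (inj₂ (_ , _ , x)) (inj₁ (u , ns)) → ⊥-elim (proj₁ (ΓF x u ns) refl)
                 ; (inj₂ (refl , refl , _)) (inj₂ (refl , refl , _)) → refl , refl }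
    ; same = λ { (inj₁ (u , _)) (inj₁ (w , _)) ne → Layout.same L u w ne
               ; (inj₁ (u , ns)) (inj₂ (_ , _ , x)) ne → trans (Esym _ _) (proj₂ (ΓF x u ns))
               ; (inj₂ (_ , _ , x)) (inj₁ (u , ns)) ne → proj₂ (ΓF x u ns)
               ; (inj₂ (refl , refl , _)) (inj₂ (refl , refl , _)) ne → ⊥-elim (ne refl) }
    ; diff = λ { ne (inj₁ (u , _)) (inj₁ (w , _)) → Layout.diff L ne u w
               ; {ρ = ρ} {σ} ne (inj₁ (u , ns)) (inj₂ (_ , e , x)) → O-edge ρ σ (inj₂ e) (trans (Esym _ _) (proj₂ (ΓF x u ns)))
               ; {ρ = ρ} {σ} ne (inj₂ (_ , e , x)) (inj₁ (u , ns)) → O-edge ρ σ (inj₁ e) (proj₂ (ΓF x u ns))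
               ; ne (inj₂ (refl , refl , _)) (inj₂ (refl , refl , _)) → ⊥-elim (ne refl) } }
    where
    O-edge : ∀ ρ σ {b c} → ρ ≡ O ⊎ σ ≡ O → c ≡ false → c ≡ roleEdge ρ σ b
    O-edge _ _ (inj₁ refl) e = e
    O-edge M σ (inj₂ refl) e = e
    O-edge N σ (inj₂ refl) e = e
    O-edge O σ (inj₂ refl) e = e

  -- Only decidable sets `T` are tested, and the crossing edge is part of the conclusion: it shows
  -- where a rule splits `S`.
  Conn : (V → Set) → Set₁
  Conn S = ∀ (T : V → Set) → Decidable T → ∃ (S ∩ T) → ∃ (S ∖ T) →
           ∃₂ λ x y → (S ∩ T) x × (S ∖ T) y × E x y ≡ true

  -- The ways in which a last rule can act on a connected `S`. Both `D` and `F` in `p-plg` are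
  -- inhabited, which makes the cuts on either of them smaller than the cut on `S`.
  data Principal (Δ S : V → Set) : Set₁ where
    p-ax  : ∀ x y → S ≐ (_≡ x) → Δ ≐ (_≡ y) → E x y ≡ false → lab y ≡ dualA (lab x) → Principal Δ S
    p-plg : ∀ Δ₁ Δ₂ D F → S ≐ D ∪ F → Δ ≐ Δ₁ ∪ Δ₂ → Sep Δ₁ Δ₂ → (∀ {x} → D x → ¬ F x) →
            (∀ {x x′ y} → D x → D x′ → F y → E x y ≡ E x′ y) → ∃ D → ∃ F →
            ⊢ (Δ₁ ∪ D) → ⊢ (Δ₂ ∪ F) → Principal Δ S
    p-prm : ∀ (Q : Graph) (F : Fin (size Q) → Role → V → Set) → Prime Q → 4 ≤ size Q →
            Layout (adj Q) F → (∀ i → ∃ (F i M)) → (∀ i → ∃ (F i N)) →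
            S ≐ (λ x → ∃ λ i → F i M x) → Δ ≐ (λ x → ∃ λ i → F i N x ⊎ F i O x) →
            (∀ i → ⊢ (λ x → ∃ λ ρ → F i ρ x)) → Principal Δ S

  module _ (Γ B S : V → Set) (S? : Decidable S) (S-conn : Conn S) (S-inhabited : ∃ S)
    (ΓB : Sep Γ B) (SB : Sep S B) (main : ∀ Δ → Principal Δ S → Δ ⊆ B → ⊢ (Γ ∪ Δ)) where

    private
      cases : ∀ {A : Set} v → (S v → A) → (¬ S v → A) → A
      cases v f g with S? v
      ... | yes s = f s
      ... | no n = g n

      reduce-ax : ∀ {U} x y → S x → U y → (∀ {z} → U z → z ≡ x ⊎ z ≡ y) →
        E x y ≡ false → lab y ≡ dualA (lab x) → S ⊆ U → (U ∖ S) ⊆ B → ⊢ (Γ ∪ (U ∖ S))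
      reduce-ax {U} x y sx uy uz e l sub b with S? y
      -- With `y` also in `S`, connectedness would demand an edge between the two vertices of an
      -- axiom; they differ because their labels are dual.
      ... | yes sy with S-conn (_≡ x) (_≟V x) (x , sx , refl) (y , sy , λ { refl → dualA-≢ _ l })
      ...   | .x , b , (_ , refl) , (sb , b≢x) , e′ with uz (sub sb)
      ...     | inj₁ b≡x = ⊥-elim (b≢x b≡x)
      ...     | inj₂ refl = ⊥-elim (true≢false e′ e)
      reduce-ax {U} x y sx uy uz e l sub b | no ¬sy =
        main (U ∖ S) (p-ax x y S≐x
           ((λ { (u , n) → case uz u of λ { (inj₁ refl) → ⊥-elim (n sx) ; (inj₂ q) → q } }) , λ { refl → uy , ¬sy })
           e l) b
        where
        S≐x : S ≐ (_≡ x)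
        S≐x = (λ sz → case uz (sub sz) of λ { (inj₁ q) → q ; (inj₂ refl) → ⊥-elim (¬sy sz) }) , λ { refl → sx }

      -- The M-part is connected by `blocks-connected`, and no edge leads from `S` to the rest of
      -- `U`, which lies in `B`. So `S` contains the M-part as soon as it meets it.
      reduce-M : ∀ {U} (Q : Graph) (F : Fin (size Q) → Role → V → Set) → Prime Q → 4 ≤ size Q →
        (L : Layout (adj Q) F) → (∀ i → ∃ (F i M)) →
        U ≐ (λ x → ∃₂ λ i ρ → F i ρ x) → (∀ i → ⊢ (λ x → ∃ λ ρ → F i ρ x)) →
        (U ∖ S) ⊆ B → ∀ {i x} → F i M x → S x → ∀ {j y} → F j M y → S y
      reduce-M Q F pr sz L m (f , g) ps b {i} {x} u sx =
        Blocks.blocks-connected E Esym Q pr sz (λ i → F i M) m (λ i → role-search L i (ps i) M)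
          (λ ne u w → Layout.diff L ne u w) S S?
          (λ {i} {j} u ns w sy → trans (Esym _ _) (proj₂ (SB sy (b (g (i , M , u) , ns)))))
          (i , x , u , sx)

    -- Here `S` is a connected component of `U`. If the last rule keeps `S` within one premise,
    -- recursion puts `Γ` there in its place, and the rule still applies because `Γ` has no edges to
    -- what remains. If the rule splits `S`, an edge of `S` crossing between the premises forces `S`
    -- to be principal.
    reduce : ∀ {U} → ⊢ U → S ⊆ U → (U ∖ S) ⊆ B → ⊢ (Γ ∪ (U ∖ S))
    reduce (ε e) sub b = ⊥-elim (e (sub (proj₂ S-inhabited)))
    reduce (ax x y ux uy uz e l) sub b = case S-inhabited of λ (z , sz) → case uz (sub sz) of λ
      { (inj₁ refl) → reduce-ax x y sz uy uz e (dual-sym l) sub b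
      ; (inj₂ refl) → reduce-ax y x sz ux ([ inj₂ , inj₁ ] ∘ uz) (trans (Esym y x) e) l sub b }
    reduce {U} (plg G D W (f , g) s₁ s₂ dj md h₁ h₂) sub b with search h₁ S? | search h₂ S?
    ... | no n | no n′ = ⊥-elim (let (z , sz) = S-inhabited in
                           case f (sub sz) of λ { (inj₁ w) → n (z , w , sz) ; (inj₂ w) → n′ (z , w , sz) })
    ... | yes _ | no n′ = plg (Γ ∪ (G ∖ S)) (D ∖ S) W
      ( (λ { (inj₁ x) → inj₁ (inj₁ (inj₁ x))
           ; (inj₂ (u , n)) → case f u of λ { (inj₁ (inj₁ x)) → inj₁ (inj₁ (inj₂ (x , n)))
                                           ; (inj₁ (inj₂ x)) → inj₁ (inj₂ (x , n))
                                           ; (inj₂ x) → inj₂ x } })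
      , (λ { (inj₁ (inj₁ (inj₁ x))) → inj₁ x
           ; (inj₁ (inj₁ (inj₂ (x , n)))) → inj₂ (g (inj₁ (inj₁ x)) , n)
           ; (inj₁ (inj₂ (x , n))) → inj₂ (g (inj₁ (inj₂ x)) , n)
           ; (inj₂ x) → inj₂ (g (inj₂ x) , W∉S x) }) )
      (λ { (inj₁ x) (y , n) → ΓB x (b (g (inj₁ (inj₂ y)) , n)) ; (inj₂ (x , _)) (y , _) → s₁ x y })
      (λ { (inj₁ x) y → ΓB x (b (g (inj₂ y) , W∉S y)) ; (inj₂ (x , _)) y → s₂ x y })
      (λ x y → dj (proj₁ x) y) (λ x x′ y → md (proj₁ x) (proj₁ x′) y)
      (resp ( (λ { (inj₁ x) → inj₁ (inj₁ x) ; (inj₂ (inj₁ x , n)) → inj₁ (inj₂ (x , n)) ; (inj₂ (inj₂ x , n)) → inj₂ (x , n) })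
            , (λ { (inj₁ (inj₁ x)) → inj₁ x ; (inj₁ (inj₂ (x , n))) → inj₂ (inj₁ x , n) ; (inj₂ (x , n)) → inj₂ (inj₂ x , n) }) )
            (reduce h₁ S⊆ (λ (u , n) → b (g (inj₁ u) , n))))
      h₂
      where
      W∉S : ∀ {x} → W x → ¬ S x
      W∉S w sx = n′ (_ , w , sx)
      S⊆ : S ⊆ (G ∪ D)
      S⊆ sx with f (sub sx)
      ... | inj₁ u = u
      ... | inj₂ w = ⊥-elim (W∉S w sx)
    -- In the second premise `Γ` does not disturb that `D` is a module, as no vertex of `Γ` has an
    -- edge to `D`.
    ... | no n | yes _ = plg G D (Γ ∪ (W ∖ S))
      ( (λ { (inj₁ x) → inj₂ (inj₁ x)
           ; (inj₂ (u , ns)) → case f u of λ { (inj₁ x) → inj₁ x ; (inj₂ x) → inj₂ (inj₂ (x , ns)) } })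
      , (λ { (inj₁ x) → inj₂ (g (inj₁ x) , GD∉S x)
           ; (inj₂ (inj₁ x)) → inj₁ x
           ; (inj₂ (inj₂ (x , ns))) → inj₂ (g (inj₂ x) , ns) }) )
      s₁
      (λ { x (inj₁ y) → Sep-sym ΓB (b (g (inj₁ (inj₁ x)) , GD∉S (inj₁ x))) y ; x (inj₂ (y , _)) → s₂ x y })
      (λ { x (inj₁ y) → proj₁ (Sep-sym ΓB (b (DU x)) y) ; x (inj₂ (y , _)) → dj x y })
      (λ { x x′ (inj₁ y) → trans (proj₂ (Sep-sym ΓB (b (DU x)) y)) (sym (proj₂ (Sep-sym ΓB (b (DU x′)) y)))
         ; x x′ (inj₂ (y , _)) → md x x′ y })
      h₁
      (reduce h₂ S⊆ (λ (u , n) → b (g (inj₂ u) , n)))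
      where
      GD∉S : ∀ {x} → (G ∪ D) x → ¬ S x
      GD∉S w sx = n (_ , w , sx)
      DU : ∀ {x} → D x → (U ∖ S) x
      DU x = g (inj₁ (inj₂ x)) , GD∉S (inj₂ x)
      S⊆ : S ⊆ W
      S⊆ sx with f (sub sx)
      ... | inj₁ u = ⊥-elim (GD∉S u sx)
      ... | inj₂ w = w
    ... | yes (x₁ , u₁ , t₁) | yes (x₂ , u₂ , t₂)
      with S-conn (G ∪ D) (mem? _≟V_ h₁) (x₁ , t₁ , u₁) (x₂ , t₂ , disj u₂)
      where
      disj : ∀ {x} → W x → ¬ (G ∪ D) x
      disj w (inj₁ u) = proj₁ (s₂ u w) refl
      disj w (inj₂ u) = dj u w refl
    ...   | x , y , (sx , inj₁ gx) , (sy , y∉) , e = ⊥-elim (case f (sub sy) of λ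
              { (inj₁ u) → y∉ u ; (inj₂ w) → true≢false e (proj₂ (s₂ gx w)) })
    -- The crossing edge starts in `D`, since `G` has no edges to `W`. Its end `y` sees all of `D`,
    -- so no vertex of `D` can be outside `S`; and as no edge leaves `G`, connectedness keeps `S`
    -- out of `G`.
    ...   | x , y , (sx , inj₂ dx) , (sy , y∉) , e =
      main (U ∖ S) (p-plg G (W ∖ S) D (S ∩ W)
        ( (λ {z} sz → case f (sub sz) of λ { (inj₁ (inj₁ gz)) → ⊥-elim (G∉S gz sz) ; (inj₁ (inj₂ dz)) → inj₁ dz ; (inj₂ w) → inj₂ (sz , w) })
        , [ D⊆S , proj₁ ] )
        ( (λ { (u , n) → case f u of λ { (inj₁ (inj₁ gz)) → inj₁ gz ; (inj₁ (inj₂ dz)) → ⊥-elim (n (D⊆S dz)) ; (inj₂ w) → inj₂ (w , n) } })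
        , (λ { (inj₁ gz) → g (inj₁ (inj₁ gz)) , G∉S gz ; (inj₂ (w , n)) → g (inj₂ w) , n }) )
        (λ gz (w , _) → s₂ gz w)
        (λ { d (_ , w) → dj d w refl })
        (λ d d′ (_ , w) → md d d′ w)
        (x , dx) (x₂ , t₂ , u₂)
        h₁
        (resp ( (λ {z} w → cases z (λ sz → inj₂ (sz , w)) (λ ns → inj₁ (w , ns))) , [ proj₁ , proj₂ ] ) h₂))
        b
      where
      Wy : W y
      Wy = case f (sub sy) of λ { (inj₁ u) → ⊥-elim (y∉ u) ; (inj₂ w) → w }
      D⊆S : D ⊆ S
      D⊆S {x′} d′ with S? x′
      ... | yes t = t
      ... | no n = ⊥-elim (true≢false (trans (md d′ dx Wy) e)
                    (trans (Esym _ _) (proj₂ (SB sy (b (g (inj₁ (inj₂ d′)) , n))))))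
      G? : Decidable G
      G? v with mem? _≟V_ h₁ v
      ... | yes (inj₁ u) = yes u
      ... | yes (inj₂ d) = no λ gv → proj₁ (s₁ gv d) refl
      ... | no n = no λ gv → n (inj₁ gv)
      G∉S : ∀ {z} → G z → ¬ S z
      G∉S gz sz with S-conn G G? (_ , sz , gz) (x , sx , λ gx → proj₁ (s₁ gx dx) refl)
      ... | a , b , (_ , ga) , (sb , b∉) , e′ = case f (sub sb) of λ
        { (inj₁ (inj₁ gb)) → b∉ gb
        ; (inj₁ (inj₂ db)) → true≢false e′ (proj₂ (s₁ ga db))
        ; (inj₂ wb) → true≢false e′ (proj₂ (s₂ ga wb)) }
    reduce {U} h@(prm Q F pr sz L m n (f , g) ps) sub b with f (sub (proj₂ S-inhabited))
    ...   | i₀ , ρ₀ , u₀ with search h (λ v → S? v ×-dec ¬? (mem? _≟V_ (ps i₀) v))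
    -- `S` lies in the O-part of block `i₀`: meeting the M- or the N-part it would contain all of
    -- it, and both reach into every block. The rule therefore survives the replacement.
    ...     | no one-block = prm Q F′ pr sz L′ (λ i → in-M i (m i)) (λ i → in-N i (n i))
      ( (λ { (inj₁ x) → i₀ , O , inj₂ (refl , refl , x)
           ; (inj₂ (u , ns)) → let (i , ρ , w) = f u in i , ρ , inj₁ (w , ns) })
      , (λ { (i , ρ , inj₁ (w , ns)) → inj₂ (g (i , ρ , w) , ns) ; (i , ρ , inj₂ (_ , _ , x)) → inj₁ x }) )
      blocks
      where
      S-block : ∀ {x} → S x → ∃ λ ρ → F i₀ ρ x
      S-block {x} sx with mem? _≟V_ (ps i₀) x
      ... | yes b = b
      ... | no b = ⊥-elim (one-block (x , sub sx , sx , b))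
      F′ : Fin (size Q) → Role → V → Set
      F′ = replace F i₀ S Γ
      other : ∃ λ j → j ≢ i₀
      other = let (j , ne , _) = avoid₂ (3≤⇐4≤ sz) i₀ i₀ in j , ne
      M∉S : ∀ {i x} → F i M x → ¬ S x
      M∉S u sx = let (j , ne) = other ; (y , w) = m j
                     (σ , w′) = S-block (reduce-M Q F pr sz L m (f , g) ps b u sx w)
                 in ne (proj₁ (Layout.unique L w w′))
      N∉S : ∀ {i x} → F i N x → ¬ S x
      N∉S u sx = let (j , ne) = other ; (y , w) = n j
                     (σ , w′) = S-block (reduce-M (compl Q) (λ i ρ → F i (swapRole ρ)) (compl-prime {Q} pr) sz (swapLayout Q L) n
                        ( (λ v → let (i , ρ , a) = f v in i , unswap F ρ a)
                        , (λ { (i , ρ , a) → g (i , swapRole ρ , a) }) )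
                        (λ i → resp ((λ { (ρ , a) → unswap F ρ a })
                                    , (λ { (ρ , a) → swapRole ρ , a })) (ps i)) b u sx w)
                 in ne (proj₁ (Layout.unique L w w′))
      in-M : ∀ i → ∃ (F i M) → ∃ (F′ i M)
      in-M i (x , u) = x , inj₁ (u , M∉S u)
      in-N : ∀ i → ∃ (F i N) → ∃ (F′ i N)
      in-N i (x , u) = x , inj₁ (u , N∉S u)
      ΓF : ∀ {i ρ x y} → Γ x → F i ρ y → ¬ S y → x ≢ y × E x y ≡ false
      ΓF {i} {ρ} x u ns = ΓB x (b (g (i , ρ , u) , ns))
      L′ : Layout (adj Q) F′
      L′ = replaceLayout L ΓF
      blocks : ∀ i → ⊢ (λ x → ∃ λ ρ → F′ i ρ x)
      blocks i with i Fin.≟ i₀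
      ... | yes refl = resp
        ( (λ { (inj₁ x) → O , inj₂ (refl , refl , x) ; (inj₂ ((ρ , u) , ns)) → ρ , inj₁ (u , ns) })
        , (λ { (ρ , inj₁ (u , ns)) → inj₂ ((ρ , u) , ns) ; (ρ , inj₂ (_ , _ , x)) → inj₁ x }) )
        (reduce (ps i) S-block (λ { ((ρ , u) , ns) → b (g (i , ρ , u) , ns) }))
      ... | no ne = resp
        ( (λ { (ρ , u) → ρ , inj₁ (u , λ sx → ne (proj₁ (Layout.unique L u (proj₂ (S-block sx))))) })
        , (λ { (ρ , inj₁ (u , _)) → ρ , u ; (ρ , inj₂ (e , _)) → ⊥-elim (ne e) }) ) (ps i)
    ...     | yes (x₁ , ux₁ , sx₁ , x₁∉) with S-conn (λ x → ∃ λ ρ → F i₀ ρ x) (mem? _≟V_ (ps i₀)) (proj₁ S-inhabited , proj₂ S-inhabited , ρ₀ , u₀) (x₁ , sx₁ , x₁∉)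
    ...       | x , y , (sx , ρ , ux) , (sy , y∉) , e with f (sub sy)
    -- An edge between different blocks joins two M-vertices or two N-vertices; the second case is
    -- the first one for the complement of `Q`.
    ...         | j , σ , uy = result ρ σ ux uy (trans (sym (Layout.diff L (λ { refl → y∉ (σ , uy) }) ux uy)) e) sx
      where
      principal : (Q : Graph) (F : Fin (size Q) → Role → V → Set) → Prime Q → 4 ≤ size Q →
        Layout (adj Q) F → (∀ i → ∃ (F i M)) → (∀ i → ∃ (F i N)) →
        U ≐ (λ x → ∃₂ λ i ρ → F i ρ x) → (∀ i → ⊢ (λ x → ∃ λ ρ → F i ρ x)) →
        ∀ {i x} → F i M x → S x → ⊢ (Γ ∪ (U ∖ S))
      principal Q F pr sz L m n (f , g) ps {i} {x} ux sx = main (U ∖ S)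
        (p-prm Q F pr sz L m n (S⊆M , λ { (j , u) → M⊆S u })
          ( (λ { (u , ns) → case f u of λ { (j , M , w) → ⊥-elim (ns (M⊆S w)) ; (j , N , w) → j , inj₁ w ; (j , O , w) → j , inj₂ w } })
          , (λ { (j , inj₁ w) → g (j , N , w) , (λ t → case Layout.unique L w (proj₂ (S⊆M t)) of λ ())
               ; (j , inj₂ w) → g (j , O , w) , (λ t → case Layout.unique L w (proj₂ (S⊆M t)) of λ ()) }) )
          ps) b
        where
        M⊆S : ∀ {j y} → F j M y → S y
        M⊆S = reduce-M Q F pr sz L m (f , g) ps b ux sx
        inM? : Decidable (λ x → ∃ λ i → F i M x)
        inM? v = Fin.any? (λ i → role? L i (ps i) M v)
        M-closed : ∀ {i j x y ρ} → F i M x → F j ρ y → ρ ≢ M → E x y ≡ false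
        M-closed {i} {j} {ρ = ρ} u w ne with i Fin.≟ j
        ... | yes refl = Layout.same L u w (ne ∘ sym)
        ... | no i≢j with ρ
        ...   | M = ⊥-elim (ne refl)
        ...   | N = Layout.diff L i≢j u w
        ...   | O = Layout.diff L i≢j u w
        S⊆M : ∀ {y} → S y → ∃ λ i → F i M y
        S⊆M {y} sy with inM? y
        ... | yes a = a
        ... | no a with S-conn _ inM? (x , sx , i , ux) (y , sy , a)
        ...   | a₁ , b₁ , (_ , i₁ , w₁) , (sb , b∉) , e′ with f (sub sb)
        ...     | i₂ , ρ₂ , w₂ = ⊥-elim (true≢false e′ (M-closed w₁ w₂ λ { refl → b∉ (i₂ , w₂) }))
      result : ∀ ρ σ {i j x y} → F i ρ x → F j σ y → roleEdge ρ σ (adj Q i j) ≡ true → S x → ⊢ (Γ ∪ (U ∖ S))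
      result M M ux uy e sx = principal Q F pr sz L m n (f , g) ps ux sx
      result N N ux uy e sx = principal (compl Q) (λ i ρ → F i (swapRole ρ)) (compl-prime {Q} pr) sz (swapLayout Q L) n m
        ( (λ v → let (i , ρ , a) = f v in i , unswap F ρ a) , (λ { (i , ρ , a) → g (i , swapRole ρ , a) }) )
        (λ i → resp ((λ { (ρ , a) → unswap F ρ a }) , (λ { (ρ , a) → swapRole ρ , a })) (ps i)) ux sx

-- Finite Boolean sets and induced prime graphs

card : ∀ {n} → (Fin n → Bool) → ℕ
card {zero} A = 0
card {suc n} A with A zero
... | true = suc (card (A ∘ suc))
... | false = card (A ∘ suc)

card-mono : ∀ {n} {A B : Fin n → Bool} → (∀ i → A i ≡ true → B i ≡ true) → card A ≤ card B
card-mono {zero} h = z≤n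
card-mono {suc n} {A} {B} h with A zero in a | B zero in b
... | true | true = s≤s (card-mono (h ∘ suc))
... | true | false = ⊥-elim (true≢false (h zero a) b)
... | false | true = Nat.m≤n⇒m≤1+n (card-mono (h ∘ suc))
... | false | false = card-mono (h ∘ suc)

card-strict : ∀ {n} {A B : Fin n → Bool} → (∀ i → A i ≡ true → B i ≡ true) →
              ∀ i → A i ≡ false → B i ≡ true → card A < card B
card-strict {suc n} {A} {B} h i ¬a b′ with A zero in a | B zero in b
card-strict {suc n} {A} {B} h zero ¬a b′ | true | _ = ⊥-elim (true≢false a ¬a)
card-strict {suc n} {A} {B} h zero ¬a b′ | false | true = s≤s (card-mono (h ∘ suc))
card-strict {suc n} {A} {B} h zero ¬a b′ | false | false = ⊥-elim (true≢false b′ b)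
card-strict {suc n} {A} {B} h (suc i) ¬a b′ | true | true = s≤s (card-strict (h ∘ suc) i ¬a b′)
card-strict {suc n} {A} {B} h (suc i) ¬a b′ | true | false = ⊥-elim (true≢false (h zero a) b)
card-strict {suc n} {A} {B} h (suc i) ¬a b′ | false | true = Nat.m≤n⇒m≤1+n (card-strict (h ∘ suc) i ¬a b′)
card-strict {suc n} {A} {B} h (suc i) ¬a b′ | false | false = card-strict (h ∘ suc) i ¬a b′

card-empty : ∀ {n} {A : Fin n → Bool} → card A ≤ 0 → ∀ {i} → A i ≢ true
card-empty {suc n} {A} c {i} t with A zero in a
card-empty {suc n} {A} c {zero} t | false = true≢false t a
card-empty {suc n} {A} c {suc i} t | false = card-empty {n} {A ∘ suc} c t

without : ∀ {n} → (Fin n → Bool) → Fin n → Fin n → Bool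
without J i j = J j ∧ not (does (j Fin.≟ i))

without-⊆ : ∀ {n} (J : Fin n → Bool) i j → without J i j ≡ true → J j ≡ true
without-⊆ J i j t with J j
... | true = refl

without-self : ∀ {n} (J : Fin n → Bool) i → without J i i ≡ false
without-self J i = trans (cong (λ b → J i ∧ not b) (dec-true (i Fin.≟ i) refl)) (Bool.∧-zeroʳ (J i))

without-in : ∀ {n} {J : Fin n → Bool} {i j} → J j ≡ true → j ≢ i → without J i j ≡ true
without-in {J = J} {i} {j} t ne = trans (cong (λ b → J j ∧ not b) (dec-false (j Fin.≟ i) ne)) (trans (Bool.∧-identityʳ _) t)

record Enumeration {n} (A : Fin n → Bool) : Set where
  field
    count   : ℕ
    at      : Fin count → Fin n
    at-inj  : ∀ {i j} → at i ≡ at j → i ≡ j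
    at-in   : ∀ i → A (at i) ≡ true
    at-onto : ∀ {j} → A j ≡ true → ∃ λ i → at i ≡ j

enumerate : ∀ {n} (A : Fin n → Bool) → Enumeration A
enumerate {zero} A = record { count = 0 ; at = λ () ; at-inj = λ {} ; at-in = λ () ; at-onto = λ {} }
enumerate {suc n} A with A zero in a | enumerate (A ∘ suc)
... | false | r = record
  { count = count ; at = suc ∘ at ; at-inj = at-inj ∘ Fin.suc-injective ; at-in = at-in ; at-onto = onto }
  where
  open Enumeration r
  onto : ∀ {j} → A j ≡ true → ∃ λ i → suc (at i) ≡ j
  onto {zero} t = ⊥-elim (true≢false t a)
  onto {suc j} t = let (i , e) = at-onto t in i , cong suc e
... | true | r = record
  { count = suc count ; at = at′ ; at-inj = inj ; at-in = λ { zero → a ; (suc i) → at-in i } ; at-onto = onto }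
  where
  open Enumeration r
  at′ : Fin (suc count) → Fin (suc n)
  at′ zero = zero
  at′ (suc i) = suc (at i)
  inj : ∀ {i j} → at′ i ≡ at′ j → i ≡ j
  inj {zero} {zero} e = refl
  inj {suc i} {suc j} e = cong suc (at-inj (Fin.suc-injective e))
  onto : ∀ {j} → A j ≡ true → ∃ λ i → at′ i ≡ j
  onto {zero} t = zero , refl
  onto {suc j} t = let (i , e) = at-onto t in suc i , cong suc e

three-distinct : ∀ {c} {i j k : Fin c} → i ≢ j → k ≢ i → k ≢ j → 3 ≤ c
three-distinct {suc (suc (suc c))} _ _ _ = s≤s (s≤s (s≤s z≤n))
three-distinct {1} {zero} {zero} n _ _ = ⊥-elim (n refl)
three-distinct {2} {zero} {zero} n _ _ = ⊥-elim (n refl)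
three-distinct {2} {suc zero} {suc zero} n _ _ = ⊥-elim (n refl)
three-distinct {2} {zero} {suc zero} {zero} _ n _ = ⊥-elim (n refl)
three-distinct {2} {zero} {suc zero} {suc zero} _ _ n = ⊥-elim (n refl)
three-distinct {2} {suc zero} {zero} {zero} _ _ n = ⊥-elim (n refl)
three-distinct {2} {suc zero} {zero} {suc zero} _ n _ = ⊥-elim (n refl)

consBool : ∀ {n} → Bool → (Fin n → Bool) → Fin (suc n) → Bool
consBool b f zero = b
consBool b f (suc i) = f i

-- Exhaustive search through Boolean functions. `Q` has to respect pointwise equality because the
-- functions tried are rebuilt from their values.
any-subset? : ∀ {n} {Q : (Fin n → Bool) → Set} → (∀ {f g} → (∀ i → f i ≡ g i) → Q f → Q g) →
              (∀ f → Dec (Q f)) → Dec (∃ Q)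
any-subset? {zero} r Q? = map′ (λ q → _ , q) (λ (f , q) → r (λ ()) q) (Q? (λ ()))
any-subset? {suc n} r Q? = map′
  (λ { (inj₁ (f , q)) → _ , q ; (inj₂ (f , q)) → _ , q })
  (λ (f , q) → cons-case f q (f zero) refl)
  (sub true ⊎-dec sub false)
  where
  sub : ∀ b → Dec (∃ λ f → _)
  sub b = any-subset? {n} (λ e → r λ { zero → refl ; (suc i) → e i }) (λ f → Q? (consBool b f))
  cons-case : ∀ f → _ → ∀ b → f zero ≡ b → _
  cons-case f q true e = inj₁ (f ∘ suc , r (λ { zero → e ; (suc i) → refl }) q)
  cons-case f q false e = inj₂ (f ∘ suc , r (λ { zero → e ; (suc i) → refl }) q)

record NontrivialModule {n} (P : Fin n → Fin n → Bool) (J S : Fin n → Bool) : Set where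
  field
    inside : ∀ i → S i ≡ true → J i ≡ true
    two    : ∃₂ λ i j → S i ≡ true × S j ≡ true × i ≢ j
    proper : ∃ λ k → J k ≡ true × S k ≡ false
    module-of : ∀ v x y → J v ≡ true → S v ≡ false → S x ≡ true → S y ≡ true → P v x ≡ P v y

nontrivial-module? : ∀ {n} (P : Fin n → Fin n → Bool) (J : Fin n → Bool) → Dec (∃ (NontrivialModule P J))
nontrivial-module? P J = any-subset?
  (λ {f} {g} e m → let open NontrivialModule m ; e′ = λ i → sym (e i) in record
    { inside = λ i t → inside i (trans (e i) t)
    ; two = let (i , j , a , b , ne) = two in i , j , trans (e′ i) a , trans (e′ j) b , ne
    ; proper = let (k , a , b) = proper in k , a , trans (e′ k) b
    ; module-of = λ v x y j n a b → module-of v x y j (trans (e v) n) (trans (e x) a) (trans (e y) b) })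
  (λ S → map′ (λ (a , b , c , d) → record { inside = a ; two = b ; proper = c ; module-of = d })
              (λ m → let open NontrivialModule m in inside , two , proper , module-of)
    ( Fin.all? (λ i → (S i Bool.≟ true) →-dec (J i Bool.≟ true))
    ×-dec Fin.any? (λ i → Fin.any? λ j → (S i Bool.≟ true) ×-dec (S j Bool.≟ true) ×-dec ¬? (i Fin.≟ j))
    ×-dec Fin.any? (λ k → (J k Bool.≟ true) ×-dec (S k Bool.≟ false))
    ×-dec Fin.all? (λ v → Fin.all? λ x → Fin.all? λ y →
            (J v Bool.≟ true) →-dec ((S v Bool.≟ false) →-dec ((S x Bool.≟ true) →-dec
            ((S y Bool.≟ true) →-dec (P v x Bool.≟ P v y)))))))

induced : ∀ {n} (P : Fin n → Fin n → Bool) (J : Fin n → Bool) → Graph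
induced P J = mkGraph (Enumeration.count e) (λ _ → 0 , true) (λ x y → P (Enumeration.at e x) (Enumeration.at e y))
  where e = enumerate J

induced-adj : ∀ {n} {P : Fin n → Fin n → Bool} → (∀ i j → P i j ≡ P j i) → (J : Fin n → Bool) →
  ∀ {x y} → x ≢ y → adj (induced P J) x y ≡ P (Enumeration.at (enumerate J) x) (Enumeration.at (enumerate J) y)
induced-adj {P = P} Psym J {x} {y} ne with x Fin.≟ y
... | yes e = ⊥-elim (ne e)
... | no _ = trans (cong (P _ _ ∨_) (Psym _ _)) (Bool.∨-idem _)

-- The enumeration carries a nontrivial module of the induced graph to one inside `J`.
induced-prime : ∀ {n} {P : Fin n → Fin n → Bool} → (∀ i j → P i j ≡ P j i) → (J : Fin n → Bool) →
  ¬ ∃ (NontrivialModule P J) → 2 ≤ Enumeration.count (enumerate J) → Prime (induced P J)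
induced-prime {n} {P} Psym J no-module two = two , trivial
  where
  open Enumeration (enumerate J)
  trivial : ∀ X → IsModule (induced P J) X → IsEmptySet X ⊎ IsSingleton X ⊎ IsFull X
  trivial X md with Fin.any? (λ x → X x Bool.≟ true)
  ... | no em = inj₁ λ x → ≢true⇒false (λ t → em (x , t))
  ... | yes (x , tx) with Fin.any? (λ y → (X y Bool.≟ true) ×-dec ¬? (y Fin.≟ x))
  ...   | no sg = inj₂ (inj₁ (x , λ y → unique y , λ { refl → tx }))
    where
    unique : ∀ y → X y ≡ true → y ≡ x
    unique y t with y Fin.≟ x
    ... | yes e = e
    ... | no ne = ⊥-elim (sg (y , t , ne))
  ...   | yes (y , ty , y≢x) with Fin.any? (λ z → X z Bool.≟ false)
  ...     | no full = inj₂ (inj₂ λ z → Bool.not-injective (≢true⇒false λ e → full (z , Bool.not-injective e)))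
  ...     | yes (z , fz) = ⊥-elim (no-module (S , record
      { inside = λ i t → let (k , e , _) = S-out t in trans (cong J (sym e)) (at-in k)
      ; two = at x , at y , S-in tx , S-in ty , λ e → y≢x (at-inj (sym e))
      ; proper = at z , at-in z , S-not fz
      ; module-of = λ v a b jv nv sa sb →
          let (w , ew) = at-onto jv
              (c , ec , xc) = S-out sa
              (d , ed , xd) = S-out sb
          in mod-at w c d ew ec ed nv xc xd }))
    where
    S? : ∀ i → Dec (∃ λ k → at k ≡ i × X k ≡ true)
    S? i = Fin.any? (λ k → (at k Fin.≟ i) ×-dec (X k Bool.≟ true))
    S : Fin n → Bool
    S i = does (S? i)
    S-out : ∀ {i} → S i ≡ true → ∃ λ k → at k ≡ i × X k ≡ true
    S-out {i} = does-true (S? i)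
    S-in : ∀ {k} → X k ≡ true → S (at k) ≡ true
    S-in {k} t = dec-true (S? (at k)) (k , refl , t)
    S-not : ∀ {k} → X k ≡ false → S (at k) ≡ false
    S-not {k} f = dec-false (S? (at k)) λ (l , e , t) → true≢false (trans (cong X (sym (at-inj e))) t) f
    mod-at : ∀ w c d {v a b} → at w ≡ v → at c ≡ a → at d ≡ b → S v ≡ false → X c ≡ true → X d ≡ true → P v a ≡ P v b
    mod-at w c d refl refl refl nv xc xd =
      trans (sym (induced-adj Psym J (w≢ xc))) (trans (md w c d w∉ xc xd) (induced-adj Psym J (w≢ xd)))
      where
      w∉ : X w ≡ false
      w∉ = ≢true⇒false λ t → true≢false (S-in t) nv
      w≢ : ∀ {k} → X k ≡ true → w ≢ k
      w≢ t refl = true≢false t w∉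

-- Substitution into arbitrary graphs

module Substitution {V : Set} (_≟V_ : DecidableEquality V) (E : V → V → Bool) (Esym : ∀ x y → E x y ≡ E y x)
  (lab : V → Atom) where
  open Reduction _≟V_ E Esym lab public

  roleEdge-≢ : ∀ {ρ σ} b → ρ ≢ σ → roleEdge ρ σ b ≡ false
  roleEdge-≢ {M} {M} b ne = ⊥-elim (ne refl)
  roleEdge-≢ {M} {N} b ne = refl
  roleEdge-≢ {M} {O} b ne = refl
  roleEdge-≢ {N} {M} b ne = refl
  roleEdge-≢ {N} {N} b ne = ⊥-elim (ne refl)
  roleEdge-≢ {N} {O} b ne = refl
  roleEdge-≢ {O} {σ} b ne = refl

  module _ {n : ℕ} (P : Fin n → Fin n → Bool) (Psym : ∀ i j → P i j ≡ P j i) where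

    -- Merging nontrivial modules of P and splitting off blocks with an empty M- or N-part
    -- reduces this to the rule prm.
    substitution : ∀ m (J : Fin n → Bool) → card J ≤ m → (F : Fin n → Role → V → Set) → Layout P F →
      (∀ {i ρ x} → F i ρ x → J i ≡ true) → (∀ i → ⊢ (λ x → ∃ λ ρ → F i ρ x)) → ⊢ (λ x → ∃₂ λ i ρ → F i ρ x)
    substitution zero J cJ F L inJ ps = ε λ (i , ρ , u) → card-empty {A = J} cJ (inJ u)
    substitution (suc m) J cJ F L inJ ps with nontrivial-module? P J
    ... | yes (S , md) = resp
      ( (λ { (i , ρ , j , _ , u) → j , ρ , u }) , (λ { (j , ρ , u) → collapse j , ρ , j , refl , u }) )
      (substitution m J′ (Nat.≤-pred (Nat.≤-trans J′<J cJ)) F′ L′ inJ′ blocks)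
      where
      open NontrivialModule md
      s₀ s₁ : Fin n
      s₀ = proj₁ two
      s₁ = proj₁ (proj₂ two)
      s₀∈ : S s₀ ≡ true
      s₀∈ = proj₁ (proj₂ (proj₂ two))
      s₁∈ : S s₁ ≡ true
      s₁∈ = proj₁ (proj₂ (proj₂ (proj₂ two)))
      s₁≢s₀ : s₁ ≢ s₀
      s₁≢s₀ e = proj₂ (proj₂ (proj₂ (proj₂ two))) (sym e)
      J′ : Fin n → Bool
      J′ i = J i ∧ not (S i ∧ not (does (i Fin.≟ s₀)))
      J′<J : card J′ < card J
      J′<J = card-strict (λ i t → J′⊆J i t) s₁ out (inside s₁ s₁∈)
        where
        J′⊆J : ∀ i → J′ i ≡ true → J i ≡ true
        J′⊆J i t with J i
        ... | true = refl
        out : J′ s₁ ≡ false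
        out with s₁ Fin.≟ s₀
        ... | yes e = ⊥-elim (s₁≢s₀ e)
        ... | no _ rewrite s₁∈ = Bool.∧-zeroʳ (J s₁)
      collapse : Fin n → Fin n
      collapse i with S i
      ... | true = s₀
      ... | false = i
      F′ : Fin n → Role → V → Set
      F′ i ρ x = ∃ λ j → collapse j ≡ i × F j ρ x
      P-collapse : ∀ i j → J i ≡ true → J j ≡ true → collapse i ≢ collapse j → P i j ≡ P (collapse i) (collapse j)
      P-collapse i j ji jj ne with S i in si | S j in sj
      ... | true | true = ⊥-elim (ne refl)
      ... | true | false = trans (Psym i j) (trans (module-of j i s₀ jj sj si s₀∈) (Psym j s₀))
      ... | false | true = module-of i j s₀ ji si sj s₀∈
      ... | false | false = refl
      L′ : Layout P F′
      L′ = record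
        { unique = λ { (j , e , u) (j′ , e′ , u′) → case Layout.unique L u u′ of λ { (refl , f) → trans (sym e) e′ , f } }
        ; same = λ { {ρ = ρ} {σ} (j , e , u) (j′ , e′ , u′) ne → same′ j j′ u u′ ne }
        ; diff = λ { {ρ = ρ} {σ} ne (j , refl , u) (j′ , refl , u′) →
            trans (Layout.diff L (λ { refl → ne refl }) u u′) (cong (roleEdge ρ σ) (P-collapse j j′ (inJ u) (inJ u′) ne)) } }
        where
        same′ : ∀ j j′ {ρ σ x y} → F j ρ x → F j′ σ y → ρ ≢ σ → E x y ≡ false
        same′ j j′ u u′ ne with j Fin.≟ j′
        ... | yes refl = Layout.same L u u′ ne
        ... | no d = trans (Layout.diff L d u u′) (roleEdge-≢ _ ne)
      inJ′ : ∀ {i ρ x} → F′ i ρ x → J′ i ≡ true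
      inJ′ (j , refl , u) with S j in sj
      ... | true rewrite inside s₀ s₀∈ | dec-true (s₀ Fin.≟ s₀) refl | s₀∈ = refl
      ... | false rewrite inJ u | sj = refl
      -- The indices in `S` collapse to `s₀`, whose new block is the substitution over `S`; that one
      -- is smaller because `S` omits an element of `J`.
      inner : ⊢ (λ x → ∃₂ λ i ρ → F i ρ x × S i ≡ true)
      inner = substitution m S
        (Nat.≤-pred (Nat.≤-trans (let (k , jk , sk) = proper in card-strict inside k sk jk) cJ))
        (λ i ρ x → F i ρ x × S i ≡ true)
        (record { unique = λ (u , _) (w , _) → Layout.unique L u w
                ; same = λ (u , _) (w , _) → Layout.same L u w
                ; diff = λ ne (u , _) (w , _) → Layout.diff L ne u w })
        proj₂ inner-block
        where
        inner-block : ∀ i → ⊢ (λ x → ∃ λ ρ → F i ρ x × S i ≡ true)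
        inner-block i with S i
        ... | true = resp ((λ (ρ , u) → ρ , u , refl) , (λ (ρ , u , _) → ρ , u)) (ps i)
        ... | false = ε λ { (_ , _ , ()) }
      collapse-in : ∀ {j} → S j ≡ true → collapse j ≡ s₀
      collapse-in e rewrite e = refl
      collapse-out : ∀ {j} → S j ≡ false → collapse j ≡ j
      collapse-out e rewrite e = refl
      collapse⁻ : ∀ {j i} → collapse j ≡ i → S j ≡ true × i ≡ s₀ ⊎ S j ≡ false × j ≡ i
      collapse⁻ {j} e with S j
      ... | true = inj₁ (refl , sym e)
      ... | false = inj₂ (refl , e)
      blocks : ∀ i → ⊢ (λ x → ∃ λ ρ → F′ i ρ x)
      blocks i with S i in si
      ... | false = resp
        ( (λ (ρ , u) → ρ , i , collapse-out si , u)
        , (λ { (ρ , j , e , u) → case collapse⁻ {j} e of λ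
               { (inj₁ (_ , refl)) → ⊥-elim (true≢false s₀∈ si) ; (inj₂ (_ , refl)) → ρ , u } }) ) (ps i)
      ... | true with i Fin.≟ s₀
      ...   | yes refl = resp
        ( (λ (j , ρ , u , sj) → ρ , j , collapse-in sj , u)
        , (λ { (ρ , j , e , u) → case collapse⁻ {j} e of λ
               { (inj₁ (sj , _)) → j , ρ , u , sj ; (inj₂ (sj , refl)) → ⊥-elim (true≢false si sj) } }) ) inner
      ...   | no i≢s₀ = ε λ { (ρ , j , e , u) → case collapse⁻ {j} e of λ
               { (inj₁ (_ , e′)) → i≢s₀ e′ ; (inj₂ (sj , refl)) → true≢false si sj } }
    ... | no no-module with Fin.any? (λ i → J i Bool.≟ true)
    ...   | no em = ε λ (i , ρ , u) → em (i , inJ u)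
    ...   | yes (i₁ , j₁) = by-size (Fin.any? (λ j → (J j Bool.≟ true) ×-dec ¬? (j Fin.≟ i₁)))
      where
      -- If only the τ-part of block `i` has edges to the other blocks, it can serve as the module
      -- `D` of a plugging, with the other parts of the block as `G` and the other blocks as `W`.
      detach : ∀ i τ → J i ≡ true →
        (∀ {j σ σ′ x y} → σ ≢ τ → j ≢ i → F i σ x → F j σ′ y → roleEdge σ σ′ (P i j) ≡ false) →
        ⊢ (λ x → ∃₂ λ i ρ → F i ρ x)
      detach i τ ji h = plg
        (λ x → ∃ λ σ → F i σ x × σ ≢ τ) (F i τ) (λ x → ∃₂ λ j σ → F j σ x × j ≢ i)
        ( (λ { (j , σ , u) → sort j σ u })
        , (λ { (inj₁ (inj₁ (σ , u , _))) → i , σ , u ; (inj₁ (inj₂ u)) → i , τ , u ; (inj₂ (j , σ , u , _)) → j , σ , u }) )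
        (λ (σ , u , ne) w → (λ { refl → ne (proj₂ (Layout.unique L u w)) }) , Layout.same L u w ne)
        (λ { (σ , u , ne) (j , σ′ , w , j≢i) → (λ { refl → j≢i (sym (proj₁ (Layout.unique L u w))) })
             , trans (Layout.diff L (j≢i ∘ sym) u w) (h ne j≢i u w) })
        (λ { u (j , σ , w , j≢i) refl → j≢i (sym (proj₁ (Layout.unique L u w))) })
        (λ { u u′ (j , σ , w , j≢i) → trans (Layout.diff L (j≢i ∘ sym) u w) (sym (Layout.diff L (j≢i ∘ sym) u′ w)) })
        (resp ( (λ { (σ , u) → sortRole σ u }) , (λ { (inj₁ (σ , u , _)) → σ , u ; (inj₂ u) → τ , u }) ) (ps i))
        (substitution m (without J i)
          (Nat.≤-pred (Nat.≤-trans (card-strict (without-⊆ J i) i (without-self J i) ji) cJ))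
          (λ j σ x → F j σ x × j ≢ i)
          (record { unique = λ (u , _) (w , _) → Layout.unique L u w
                  ; same = λ (u , _) (w , _) → Layout.same L u w
                  ; diff = λ ne (u , _) (w , _) → Layout.diff L ne u w })
          (λ (u , ne) → without-in {J = J} (inJ u) ne) rest)
        where
        sortRole : ∀ σ {x} → F i σ x → (∃ λ σ → F i σ x × σ ≢ τ) ⊎ F i τ x
        sortRole σ u with σ ≟R τ
        ... | yes refl = inj₂ u
        ... | no ne = inj₁ (σ , u , ne)
        sort : ∀ j σ {x} → F j σ x → ((∃ λ σ → F i σ x × σ ≢ τ) ⊎ F i τ x) ⊎ (∃₂ λ j σ → F j σ x × j ≢ i)
        sort j σ u with j Fin.≟ i
        ... | yes refl = inj₁ (sortRole σ u)
        ... | no ne = inj₂ (j , σ , u , ne)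
        rest : ∀ j → ⊢ (λ x → ∃ λ σ → F j σ x × j ≢ i)
        rest j with j Fin.≟ i
        ... | yes refl = ε λ (_ , _ , ne) → ne refl
        ... | no ne = resp ((λ (σ , u) → σ , u , ne) , (λ (σ , u , _) → σ , u)) (ps j)

      missing? : ∀ τ → Dec (∃ λ i → J i ≡ true × ¬ ∃ (F i τ))
      missing? τ = Fin.any? (λ i → (J i Bool.≟ true) ×-dec
        ¬? (map′ (λ (x , u , _) → x , u) (λ (x , u) → x , u , u) (role-search L i (ps i) τ (role? L i (ps i) τ))))

      present : ∀ {τ} → ¬ (∃ λ i → J i ≡ true × ¬ ∃ (F i τ)) → ∀ i → J i ≡ true → ∃ (F i τ)
      present {τ} n i ji with role-search L i (ps i) τ (role? L i (ps i) τ)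
      ... | yes (x , u , _) = x , u
      ... | no e = ⊥-elim (n (i , ji , λ (x , u) → e (x , u , u)))

      by-prime : ∀ {i j k} → J i ≡ true → J j ≡ true → J k ≡ true → j ≢ i → k ≢ i → k ≢ j →
        (∀ i → J i ≡ true → ∃ (F i M)) → (∀ i → J i ≡ true → ∃ (F i N)) → ⊢ (λ x → ∃₂ λ i ρ → F i ρ x)
      by-prime {i} {j} {k} ji jj jk j≢i k≢i k≢j inM inN =
        prm Q (F ∘ at) Q-prime big
          (record { unique = λ u w → let (e , f) = Layout.unique L u w in at-inj e , f
                  ; same = Layout.same L
                  ; diff = λ {i} {j} {ρ} {σ} ne u w →
                      trans (Layout.diff L (ne ∘ at-inj) u w) (cong (roleEdge ρ σ) (sym (induced-adj Psym J ne))) })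
          (λ i → inM (at i) (at-in i)) (λ i → inN (at i) (at-in i))
          ( (λ { (i , ρ , u) → case at-onto (inJ u) of λ { (i′ , refl) → i′ , ρ , u } }) , (λ (i , ρ , u) → at i , ρ , u) )
          (ps ∘ at)
        where
        open Enumeration (enumerate J)
        Q : Graph
        Q = induced P J
        three : 3 ≤ count
        three = let (a , ea) = at-onto ji ; (b , eb) = at-onto jj ; (c , ec) = at-onto jk in
          three-distinct {i = a} {b} {c} (λ e → j≢i (trans (sym eb) (trans (cong at (sym e)) ea)))
            (λ e → k≢i (trans (sym ec) (trans (cong at e) ea)))
            (λ e → k≢j (trans (sym ec) (trans (cong at e) eb)))
        Q-prime : Prime Q
        Q-prime = induced-prime Psym J no-module (Nat.≤-trans (s≤s (s≤s z≤n)) three)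
        -- No prime graph has exactly three vertices, so three distinct indices already give the
        -- bound required by `prm`.
        big : 4 ≤ count
        big with prime-size {Q} Q-prime
        ... | inj₂ b = b
        ... | inj₁ e = ⊥-elim (Nat.<⇒≱ three (Nat.≤-reflexive e))

      by-size : Dec (∃ λ j → J j ≡ true × j ≢ i₁) → ⊢ (λ x → ∃₂ λ i ρ → F i ρ x)
      by-size (no one) = detach i₁ M j₁ λ {j} _ ne _ u → ⊥-elim (one (j , inJ u , ne))
      by-size (yes (i₂ , j₂ , i₂≢i₁)) with Fin.any? (λ k → (J k Bool.≟ true) ×-dec (¬? (k Fin.≟ i₁) ×-dec ¬? (k Fin.≟ i₂)))
      ... | no two = both (P i₁ i₂) refl
        where
        only : ∀ {j σ y} → F j σ y → j ≢ i₁ → j ≡ i₂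
        only {j} u ne with j Fin.≟ i₂
        ... | yes e = e
        ... | no ne′ = ⊥-elim (two (j , inJ u , ne , ne′))
        off-M : ∀ σ σ′ → σ ≢ M → roleEdge σ σ′ true ≡ false
        off-M M σ′ ne = ⊥-elim (ne refl)
        off-M N M _ = refl
        off-M N N _ = refl
        off-M N O _ = refl
        off-M O σ′ _ = refl
        off-N : ∀ σ σ′ → σ ≢ N → roleEdge σ σ′ false ≡ false
        off-N N σ′ ne = ⊥-elim (ne refl)
        off-N M M _ = refl
        off-N M N _ = refl
        off-N M O _ = refl
        off-N O σ′ _ = refl
        both : ∀ b → P i₁ i₂ ≡ b → ⊢ (λ x → ∃₂ λ i ρ → F i ρ x)
        -- Adjacent indices have no edges between their N-parts, non-adjacent ones none between
        -- their M-parts; the remaining role is the one to detach.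
        both true e = detach i₁ M j₁ λ {j} {σ} {σ′} ne j≢ u w → case only w j≢ of λ { refl → trans (cong (roleEdge σ σ′) e) (off-M σ σ′ ne) }
        both false e = detach i₁ N j₁ λ {j} {σ} {σ′} ne j≢ u w → case only w j≢ of λ { refl → trans (cong (roleEdge σ σ′) e) (off-N σ σ′ ne) }
      ... | yes (i₃ , j₃ , i₃≢i₁ , i₃≢i₂) with missing? M | missing? N
      ...   | no m | no n = by-prime j₁ j₂ j₃ i₂≢i₁ i₃≢i₁ i₃≢i₂ (present m) (present n)
      -- A block without M-vertices is attached to the other blocks by its N-vertices alone.
      ...   | yes (i , ji , em) | _ = detach i N ji λ
                { {σ = M} ne j≢ u w → ⊥-elim (em (_ , u)) ; {σ = N} ne j≢ u w → ⊥-elim (ne refl) ; {σ = O} ne j≢ u w → refl }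
      ...   | no _ | yes (i , ji , em) = detach i M ji λ
                { {σ = N} ne j≢ u w → ⊥-elim (em (_ , u)) ; {σ = M} ne j≢ u w → ⊥-elim (ne refl) ; {σ = O} ne j≢ u w → refl }

    substituted : (F : Fin n → Role → V → Set) → Layout P F → (∀ i → ⊢ (λ x → ∃ λ ρ → F i ρ x)) → ⊢ (λ x → ∃₂ λ i ρ → F i ρ x)
    substituted F L = substitution _ (λ _ → true) Nat.≤-refl F L (λ _ → refl)

-- Cut elimination

module _ {k : ℕ} where
  -- Bounding a Boolean superset makes sense before `S` is known to be decidable, and is inherited
  -- by subsets.
  _≲_ : (Fin k → Set) → ℕ → Set
  S ≲ m = ∃ λ A → (∀ {i} → S i → A i ≡ true) × card A ≤ m

  shrink : ∀ {S D : Fin k → Set} {m} → S ≲ suc m → D ⊆ S → ∀ {e} → S e → ¬ D e → D ≲ m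
  shrink {S} {D} (A , sub , c) D⊆S {e} se ¬de = without A e
    , (λ {i} d → without-in {J = A} (sub (D⊆S d)) λ { refl → ¬de d })
    , Nat.≤-pred (Nat.≤-trans (card-strict (without-⊆ A e) e (without-self A e) (sub se)) c)

module Cuts {V : Set} (_≟V_ : DecidableEquality V) (E : V → V → Bool) (Esym : ∀ x y → E x y ≡ E y x)
  (lab : V → Atom) (k : ℕ) where
  open Substitution _≟V_ E Esym lab public

  emb : (Fin k → V) → (Fin k → Set) → V → Set
  emb κ S v = ∃ λ i → S i × v ≡ κ i

  record Dual (κ κ′ : Fin k → V) : Set where
    field
      inj   : ∀ {i j} → κ i ≡ κ j → i ≡ j
      inj′  : ∀ {i j} → κ′ i ≡ κ′ j → i ≡ j
      apart : ∀ {i j} → κ i ≢ κ′ j × E (κ i) (κ′ j) ≡ false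
      flip  : ∀ {i j} → i ≢ j → E (κ i) (κ j) ≡ not (E (κ′ i) (κ′ j))
      labels : ∀ i → lab (κ′ i) ≡ dualA (lab (κ i))

  dual-swap : ∀ {κ κ′} → Dual κ κ′ → Dual κ′ κ
  dual-swap d = record
    { inj = inj′ ; inj′ = inj
    ; apart = proj₁ apart ∘ sym , trans (Esym _ _) (proj₂ apart)
    ; flip = λ ne → trans (sym (Bool.not-involutive _)) (cong not (sym (flip ne)))
    ; labels = λ i → dual-sym (labels i) }
    where open Dual d

-- The vertex type is quantified inside, because the induction step enlarges it by fresh copies of
-- the cut graph and applies the hypothesis there.
CutAt : ℕ → Set₁
CutAt m = ∀ {V : Set} (_≟V_ : DecidableEquality V) (E : V → V → Bool) (Esym : ∀ x y → E x y ≡ E y x) (lab : V → Atom) {k} →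
  let open Cuts _≟V_ E Esym lab k in
  ∀ {κ κ′} → Dual κ κ′ → ∀ S → S ≲ m → ∀ Γ Δ → Sep Γ Δ → Sep Γ (emb κ S) → Sep Δ (emb κ′ S) →
  ⊢ (Γ ∪ emb κ S) → ⊢ (Δ ∪ emb κ′ S) → ⊢ (Γ ∪ Δ)

module CutStep (m : ℕ) (ih : CutAt m)
  {V : Set} (_≟V_ : DecidableEquality V) (E : V → V → Bool) (Esym : ∀ x y → E x y ≡ E y x)
  (lab : V → Atom) (k : ℕ) where
  open Cuts _≟V_ E Esym lab k

  K : Set
  K = Fin k

  cut : ∀ {κ κ′} → Dual κ κ′ → ∀ S → S ≲ m → ∀ Γ Δ → Sep Γ Δ → Sep Γ (emb κ S) → Sep Δ (emb κ′ S) →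
        ⊢ (Γ ∪ emb κ S) → ⊢ (Δ ∪ emb κ′ S) → ⊢ (Γ ∪ Δ)
  cut = ih _≟V_ E Esym lab

  emb-⊆ : ∀ {κ S T} → S ⊆ T → emb κ S ⊆ emb κ T
  emb-⊆ f (i , s , e) = i , f s , e

  sep-∪ˡ : ∀ {X Y Z} → Sep X Z → Sep Y Z → Sep (X ∪ Y) Z
  sep-∪ˡ a b = λ { (inj₁ x) z → a x z ; (inj₂ y) z → b y z }

  sep-∪ʳ : ∀ {X Y Z} → Sep X Y → Sep X Z → Sep X (Y ∪ Z)
  sep-∪ʳ a b = λ { x (inj₁ y) → a x y ; x (inj₂ z) → b x z }

  sep-⊆ʳ : ∀ {X Y Z} → Z ⊆ Y → Sep X Y → Sep X Z
  sep-⊆ʳ f s x z = s x (f z)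

  sep-⊆ˡ : ∀ {X Y Z} → Z ⊆ X → Sep X Y → Sep Z Y
  sep-⊆ˡ f s z y = s (f z) y

  sep-dual : ∀ {κ κ′} → Dual κ κ′ → ∀ {S T} → Sep (emb κ S) (emb κ′ T)
  sep-dual d (i , _ , refl) (j , _ , refl) = Dual.apart d

  emb-dec : ∀ {κ} → (∀ {i j} → κ i ≡ κ j → i ≡ j) → ∀ {X S} → ⊢ (X ∪ emb κ S) → Sep X (emb κ S) → Decidable S
  emb-dec {κ} inj h s i with mem? _≟V_ h (κ i)
  ... | no n = no λ si → n (inj₂ (i , si , refl))
  ... | yes (inj₁ x) = no λ si → proj₁ (s x (i , si , refl)) refl
  ... | yes (inj₂ (j , sj , e)) with inj e
  ...   | refl = yes sj

  module-flip : ∀ {κ κ′} → Dual κ κ′ → ∀ {D F : K → Set} → (∀ {i} → D i → ¬ F i) →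
    (∀ {i i′ j} → D i → D i′ → F j → E (κ i) (κ j) ≡ E (κ i′) (κ j)) →
    (∀ {i i′ j} → D i → D i′ → F j → E (κ′ i) (κ′ j) ≡ E (κ′ i′) (κ′ j))
  module-flip d dj md a a′ b = Bool.not-injective
    (trans (sym (Dual.flip d λ { refl → dj a b })) (trans (md a a′ b) (Dual.flip d λ { refl → dj a′ b })))

  -- The i-th block is the axiom on `κ i` and `κ′ i`. These blocks are substituted into the cut
  -- graph itself, with `κ` in role M and `κ′` in role N.
  identity : ∀ {κ κ′} → Dual κ κ′ → ∀ {S} → Decidable S → ⊢ (emb κ S ∪ emb κ′ S)
  identity {κ} {κ′} d {S} S? = resp
    ( (λ { (i , M , s , e) → inj₁ (i , s , e) ; (i , N , s , e) → inj₂ (i , s , e) })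
    , (λ { (inj₁ (i , s , e)) → i , M , s , e ; (inj₂ (i , s , e)) → i , N , s , e }) )
    (substituted (λ i j → E (κ i) (κ j)) (λ i j → Esym _ _) F L block)
    where
    open Dual d
    F : K → Role → V → Set
    F i M v = S i × v ≡ κ i
    F i N v = S i × v ≡ κ′ i
    F i O v = ⊥
    L : Layout (λ i j → E (κ i) (κ j)) F
    L = record
      { unique = λ { {ρ = M} {M} (_ , refl) (_ , e) → inj e , refl
                   ; {ρ = M} {N} (_ , refl) (_ , e) → ⊥-elim (proj₁ apart e)
                   ; {ρ = N} {M} (_ , refl) (_ , e) → ⊥-elim (proj₁ apart (sym e))
                   ; {ρ = N} {N} (_ , refl) (_ , e) → inj′ e , refl }
      ; same = λ { {ρ = M} {M} _ _ ne → ⊥-elim (ne refl)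
                 ; {ρ = M} {N} (_ , refl) (_ , refl) _ → proj₂ apart
                 ; {ρ = N} {M} (_ , refl) (_ , refl) _ → trans (Esym _ _) (proj₂ apart)
                 ; {ρ = N} {N} _ _ ne → ⊥-elim (ne refl) }
      ; diff = λ { {ρ = M} {M} ne (_ , refl) (_ , refl) → refl
                 ; {ρ = M} {N} ne (_ , refl) (_ , refl) → proj₂ apart
                 ; {ρ = N} {M} ne (_ , refl) (_ , refl) → trans (Esym _ _) (proj₂ apart)
                 ; {ρ = N} {N} ne (_ , refl) (_ , refl) → Dual.flip (dual-swap d) ne } }
    block : ∀ i → ⊢ (λ x → ∃ λ ρ → F i ρ x)
    block i with S? i
    ... | no n = ε λ { (M , s , _) → n s ; (N , s , _) → n s }
    ... | yes s = ax (κ i) (κ′ i) (M , s , refl) (N , s , refl)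
      (λ { (M , _ , e) → inj₁ e ; (N , _ , e) → inj₂ e }) (proj₂ apart) (dual-sym (labels i))

  plug-emb : ∀ {κ} → (∀ {i j} → κ i ≡ κ j → i ≡ j) → ∀ {A B} {X Y : K → Set} →
    Sep A B → Sep A (emb κ X) → Sep A (emb κ Y) → Sep B (emb κ X) → (∀ {i} → X i → ¬ Y i) →
    (∀ {i i′ j} → X i → X i′ → Y j → E (κ i) (κ j) ≡ E (κ i′) (κ j)) →
    ⊢ (A ∪ emb κ X) → ⊢ (B ∪ emb κ Y) → ⊢ ((A ∪ B) ∪ emb κ (X ∪ Y))
  plug-emb {κ} inj {A} {B} {X} {Y} sAB sAX sAY sBX dj md hA hB = plg A (emb κ X) (B ∪ emb κ Y)
    ( (λ { (inj₁ (inj₁ a)) → inj₁ (inj₁ a) ; (inj₁ (inj₂ b)) → inj₂ (inj₁ b)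
         ; (inj₂ (i , inj₁ x , e)) → inj₁ (inj₂ (i , x , e)) ; (inj₂ (i , inj₂ y , e)) → inj₂ (inj₂ (i , y , e)) })
    , (λ { (inj₁ (inj₁ a)) → inj₁ (inj₁ a) ; (inj₂ (inj₁ b)) → inj₁ (inj₂ b)
         ; (inj₁ (inj₂ (i , x , e))) → inj₂ (i , inj₁ x , e) ; (inj₂ (inj₂ (i , y , e))) → inj₂ (i , inj₂ y , e) }) )
    sAX (sep-∪ʳ sAB sAY)
    (λ { x (inj₁ b) e → proj₁ (sBX b x) (sym e)
       ; (i , x , refl) (inj₂ (j , y , refl)) e → case inj e of λ { refl → dj x y } })
    (λ { x x′ (inj₁ b) → trans (proj₂ (Sep-sym sBX x b)) (sym (proj₂ (Sep-sym sBX x′ b)))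
       ; (_ , x , refl) (_ , x′ , refl) (inj₂ (_ , y , refl)) → md x x′ y })
    hA hB

  -- κ′ X is first completed to κ′ S by an identity on S ∖ X.
  deep-cut : ∀ {κ κ′} → Dual κ κ′ → ∀ {S X} → S ≲ m → X ⊆ S → Decidable S → Decidable X →
    (∀ {i i′ j} → X i → X i′ → (S ∖ X) j → E (κ i) (κ j) ≡ E (κ i′) (κ j)) →
    ∀ {Γ Δ} → Sep Γ Δ → Sep Γ (emb κ S) → Sep Δ (emb κ′ S) → Sep Δ (emb κ S) →
    ⊢ (Γ ∪ emb κ S) → ⊢ (Δ ∪ emb κ′ X) → ⊢ (Γ ∪ (Δ ∪ emb κ (S ∖ X)))
  deep-cut {κ} {κ′} d {S} {X} small X⊆S S? X? md {Γ} {Δ} sΓΔ sΓ sΔ′ sΔ hΓ hΔ =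
    cut d S small Γ (Δ ∪ emb κ (S ∖ X))
      (sep-∪ʳ sΓΔ (sep-⊆ʳ (emb-⊆ proj₁) sΓ)) sΓ (sep-∪ˡ sΔ′ (sep-dual d)) hΓ
      (resp ( (λ { (inj₁ x) → inj₁ x ; (inj₂ (i , inj₁ x , e)) → inj₂ (i , X⊆S x , e) ; (inj₂ (i , inj₂ (s , _) , e)) → inj₂ (i , s , e) })
            , (λ { (inj₁ x) → inj₁ x ; (inj₂ (i , s , e)) → inj₂ (i , side i s , e) }) )
        (plug-emb (Dual.inj′ d) (sep-⊆ʳ (emb-⊆ proj₁) sΔ) (sep-⊆ʳ (emb-⊆ X⊆S) sΔ′) (sep-⊆ʳ (emb-⊆ proj₁) sΔ′) (sep-dual d)
          (λ x (_ , n) → n x) (module-flip d (λ x (_ , n) → n x) md) hΔ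
          (identity d (λ i → S? i ×-dec ¬? (X? i)))))
    where
    side : ∀ i → S i → (X ∪ (S ∖ X)) i
    side i s with X? i
    ... | yes x = inj₁ x
    ... | no n = inj₂ (s , n)

  -- Cuts between two pluggings

  record Plugged (κ : K → V) (S : K → Set) (Γ : V → Set) : Set₁ where
    field
      Γ₁ Γ₂ : V → Set
      D F   : K → Set
      S≐    : S ≐ D ∪ F
      Γ≐    : Γ ≐ Γ₁ ∪ Γ₂
      sep   : Sep Γ₁ Γ₂
      disj  : ∀ {i} → D i → ¬ F i
      modul : ∀ {i i′ j} → D i → D i′ → F j → E (κ i) (κ j) ≡ E (κ i′) (κ j)
      someD : ∃ D
      someF : ∃ F
      left  : ⊢ (Γ₁ ∪ emb κ D)
      right : ⊢ (Γ₂ ∪ emb κ F)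

  range : (K → V) → V → Set
  range κ v = ∃ λ i → v ≡ κ i

  emb-range : ∀ {κ S} → emb κ S ⊆ range κ
  emb-range (i , _ , e) = i , e

  -- κ and μ are copies of one graph, κ′ and μ′ copies of its dual; the second copies serve to
  -- keep a part of one premise away from the cut vertices of the other.
  record Copies (κ κ′ μ μ′ : K → V) : Set where
    field
      κκ′ : Dual κ κ′
      μκ′ : Dual μ κ′
      κμ′ : Dual κ μ′
      κμ  : ∀ {i j} → κ i ≢ μ j × E (κ i) (μ j) ≡ false
      κ′μ′ : ∀ {i j} → κ′ i ≢ μ′ j × E (κ′ i) (μ′ j) ≡ false
      loop : ∀ i → E (κ i) (κ i) ≡ E (μ i) (μ i)
      loop′ : ∀ i → E (κ′ i) (κ′ i) ≡ E (μ′ i) (μ′ i)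

  copies-swap : ∀ {κ κ′ μ μ′} → Copies κ κ′ μ μ′ → Copies κ′ κ μ′ μ
  copies-swap c = record { κκ′ = dual-swap κκ′ ; μκ′ = dual-swap κμ′ ; κμ′ = dual-swap μκ′ ; κμ = κ′μ′ ; κ′μ′ = κμ ; loop = loop′ ; loop′ = loop }
    where open Copies c

  record Free (κ κ′ μ μ′ : K → V) (X : V → Set) : Set where
    field
      fκ  : Sep X (range κ)
      fκ′ : Sep X (range κ′)
      fμ  : Sep X (range μ)
      fμ′ : Sep X (range μ′)

  free-swap : ∀ {κ κ′ μ μ′ X} → Free κ κ′ μ μ′ X → Free κ′ κ μ′ μ X
  free-swap f = record { fκ = fκ′ ; fκ′ = fκ ; fμ = fμ′ ; fμ′ = fμ }
    where open Free f

  free-⊆ : ∀ {κ κ′ μ μ′ X Y} → Y ⊆ X → Free κ κ′ μ μ′ X → Free κ κ′ μ μ′ Y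
  free-⊆ g f = record { fκ = sep-⊆ˡ g fκ ; fκ′ = sep-⊆ˡ g fκ′ ; fμ = sep-⊆ˡ g fμ ; fμ′ = sep-⊆ˡ g fμ′ }
    where open Free f

  swap-∪ : ∀ {X Y : V → Set} → X ∪ Y ≐ Y ∪ X
  swap-∪ = [ inj₂ , inj₁ ] , [ inj₂ , inj₁ ]

  free : ∀ {X Y ν} {S : K → Set} → X ⊆ Y → Sep Y (range ν) → Sep X (emb ν S)
  free sub s x e = s (sub x) (emb-range e)

  module PlugCut {κ κ′ : K → V} (κκ′ : Dual κ κ′) {S : K → Set} (small : S ≲ suc m)
    {Γ Δ : V → Set} (ΓΔ : Sep Γ Δ) (Γκ : Sep Γ (range κ)) (Γκ′ : Sep Γ (range κ′)) (Δκ′ : Sep Δ (range κ′))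
    (P : Plugged κ S Γ) where
    open Plugged P

    Γ₁⊆ : Γ₁ ⊆ Γ
    Γ₁⊆ = proj₂ Γ≐ ∘ inj₁
    Γ₂⊆ : Γ₂ ⊆ Γ
    Γ₂⊆ = proj₂ Γ≐ ∘ inj₂

    D? : Decidable D
    D? = emb-dec (Dual.inj κκ′) left (free Γ₁⊆ Γκ)
    F? : Decidable F
    F? = emb-dec (Dual.inj κκ′) right (free Γ₂⊆ Γκ)

    smallD : D ≲ m
    smallD = let (e , f) = someF in shrink small (proj₂ S≐ ∘ inj₁) (proj₂ S≐ (inj₂ f)) λ d → disj d f
    smallF : F ≲ m
    smallF = let (e , d) = someD in shrink small (proj₂ S≐ ∘ inj₂) (proj₂ S≐ (inj₁ d)) (disj d)

    F-of : ∀ {i} → S i → ¬ D i → F i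
    F-of s n = case proj₁ S≐ s of λ { (inj₁ d) → ⊥-elim (n d) ; (inj₂ f) → f }
    D⊆S : D ⊆ S
    D⊆S = proj₂ S≐ ∘ inj₁
    F⊆S : F ⊆ S
    F⊆S = proj₂ S≐ ∘ inj₂

    module-κ′ : ∀ {i i′ j} → D i → D i′ → F j → E (κ′ i) (κ′ j) ≡ E (κ′ i′) (κ′ j)
    module-κ′ = module-flip κκ′ disj modul

    -- The second premise of the plugging is spent here: it cuts away `F` at the very end, so that
    -- only `κ′ F` beside `Γ₁` and `Δ` remains to be produced, from the first premise and the other
    -- side.
    conclude : ∀ {X T} → X ≐ Γ₁ ∪ Δ → T ≐ F → ⊢ (X ∪ emb κ′ T) → ⊢ (Γ ∪ Δ)
    conclude {X} {T} X≐ T≐ h = resp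
      ( (λ { (inj₁ x) → inj₁ (Γ₂⊆ x) ; (inj₂ (inj₁ x)) → inj₁ (Γ₁⊆ x) ; (inj₂ (inj₂ y)) → inj₂ y })
      , (λ { (inj₁ x) → case proj₁ Γ≐ x of λ { (inj₁ a) → inj₂ (inj₁ a) ; (inj₂ a) → inj₁ a } ; (inj₂ y) → inj₂ (inj₂ y) }) )
      (cut κκ′ F smallF Γ₂ (Γ₁ ∪ Δ) (sep-∪ʳ (Sep-sym sep) (sep-⊆ˡ Γ₂⊆ ΓΔ)) (free Γ₂⊆ Γκ)
        (sep-∪ˡ (free Γ₁⊆ Γκ′) (free id Δκ′))
        right
        (resp ( (λ { (inj₁ x) → inj₁ (proj₁ X≐ x) ; (inj₂ y) → inj₂ (emb-⊆ (proj₁ T≐) y) })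
              , (λ { (inj₁ x) → inj₁ (proj₂ X≐ x) ; (inj₂ y) → inj₂ (emb-⊆ (proj₂ T≐) y) }) ) h))

  module PlugPlug {κ κ′ μ μ′ : K → V} (copies : Copies κ κ′ μ μ′) {S : K → Set} (small : S ≲ suc m)
    {Γ Δ : V → Set} (ΓΔ : Sep Γ Δ) (freeΓ : Free κ κ′ μ μ′ Γ) (freeΔ : Free κ κ′ μ μ′ Δ)
    (P : Plugged κ S Γ) (P′ : Plugged κ′ S Δ) where
    open Copies copies
    open Plugged P
    open Plugged P′ renaming (Γ₁ to Δ₁; Γ₂ to Δ₂; D to D′; F to F′; S≐ to S≐′; Γ≐ to Δ≐; sep to sep′; disj to disj′;
      modul to modul′; someD to someD′; someF to someF′; left to left′; right to right′)
    open PlugCut κκ′ small ΓΔ (Free.fκ freeΓ) (Free.fκ′ freeΓ) (Free.fκ′ freeΔ) P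
    open PlugCut (dual-swap κκ′) small (Sep-sym ΓΔ) (Free.fκ′ freeΔ) (Free.fκ freeΔ) (Free.fκ freeΓ) P′ using ()
      renaming (Γ₁⊆ to Δ₁⊆; Γ₂⊆ to Δ₂⊆; D? to D′?; F? to F′?; smallD to smallD′; smallF to smallF′; F-of to F′-of;
        D⊆S to D′⊆S; F⊆S to F′⊆S; module-κ′ to module′-κ)

    Δ₁Γ₁ : Sep Δ₁ Γ₁
    Δ₁Γ₁ = Sep-sym (sep-⊆ˡ Γ₁⊆ (sep-⊆ʳ Δ₁⊆ ΓΔ))
    Δ₂Γ₁ : Sep Δ₂ Γ₁
    Δ₂Γ₁ = Sep-sym (sep-⊆ˡ Γ₁⊆ (sep-⊆ʳ Δ₂⊆ ΓΔ))

    -- `D` lies in `F′`, so `left` is cut into `right′`. Plugging in `left′` afterwards gives `D′`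
    -- together with `F′ ∖ D`, and this is `F`.
    disjoint : (∀ {i} → D i → ¬ D′ i) → ⊢ (Γ ∪ Δ)
    disjoint dis = conclude
      ( (λ { (inj₁ x) → inj₂ (Δ₁⊆ x) ; (inj₂ (inj₁ x)) → inj₂ (Δ₂⊆ x) ; (inj₂ (inj₂ x)) → inj₁ x })
      , (λ { (inj₁ x) → inj₂ (inj₂ x) ; (inj₂ y) → case proj₁ Δ≐ y of λ { (inj₁ a) → inj₁ a ; (inj₂ a) → inj₂ (inj₁ a) } }) )
      ( (λ { (inj₁ d′) → F-of (D′⊆S d′) (λ d → dis d d′) ; (inj₂ (f′ , n)) → F-of (F′⊆S f′) n })
      , (λ {i} f → case proj₁ S≐′ (F⊆S f) of λ { (inj₁ d′) → inj₁ d′ ; (inj₂ f′) → inj₂ (f′ , λ d → disj d f) }) )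
      (plug-emb (Dual.inj′ κκ′) (sep-∪ʳ sep′ Δ₁Γ₁) (free Δ₁⊆ (Free.fκ′ freeΔ)) (free Δ₁⊆ (Free.fκ′ freeΔ))
        (sep-∪ˡ (free Δ₂⊆ (Free.fκ′ freeΔ)) (free Γ₁⊆ (Free.fκ′ freeΓ)))
        (λ d′ (f′ , _) → disj′ d′ f′) (λ d d′ (f , _) → modul′ d d′ f)
        left′
        (resp ( [ inj₁ ∘ inj₁ , [ inj₁ ∘ inj₂ , inj₂ ] ] , [ [ inj₁ , inj₂ ∘ inj₁ ] , inj₂ ∘ inj₂ ] )
          (deep-cut (dual-swap κκ′) smallF′ (λ d → F′-of (D⊆S d) (dis d)) F′? D?
            (λ d d′ (f′ , n) → module-κ′ d d′ (F-of (F′⊆S f′) n))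
            Δ₂Γ₁ (free Δ₂⊆ (Free.fκ′ freeΔ)) (free Γ₁⊆ (Free.fκ freeΓ)) (free Γ₁⊆ (Free.fκ′ freeΓ)) right′ left)))

    -- `left` is cut into `left′` instead; `D′ ∖ D` together with `F′` is again `F`.
    nested : D ⊆ D′ → ⊢ (Γ ∪ Δ)
    nested sub = conclude
      ( (λ { (inj₁ (inj₁ x)) → inj₂ (Δ₁⊆ x) ; (inj₁ (inj₂ x)) → inj₁ x ; (inj₂ x) → inj₂ (Δ₂⊆ x) })
      , (λ { (inj₁ x) → inj₁ (inj₂ x) ; (inj₂ y) → case proj₁ Δ≐ y of λ { (inj₁ a) → inj₁ (inj₁ a) ; (inj₂ a) → inj₂ a } }) )
      ( (λ { (inj₁ (d′ , n)) → F-of (D′⊆S d′) n ; (inj₂ f′) → F-of (F′⊆S f′) (λ d → disj′ (sub d) f′) })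
      , (λ {i} f → case proj₁ S≐′ (F⊆S f) of λ { (inj₁ d′) → inj₁ (d′ , λ d → disj d f) ; (inj₂ f′) → inj₂ f′ }) )
      (plug-emb (Dual.inj′ κκ′) (sep-∪ˡ sep′ (Sep-sym Δ₂Γ₁))
        (sep-∪ˡ (free Δ₁⊆ (Free.fκ′ freeΔ)) (free Γ₁⊆ (Free.fκ′ freeΓ)))
        (sep-∪ˡ (free Δ₁⊆ (Free.fκ′ freeΔ)) (free Γ₁⊆ (Free.fκ′ freeΓ)))
        (free Δ₂⊆ (Free.fκ′ freeΔ))
        (λ (d′ , _) f′ → disj′ d′ f′) (λ (d , _) (d′ , _) f → modul′ d d′ f)
        (resp ( [ inj₁ ∘ inj₁ , [ inj₁ ∘ inj₂ , inj₂ ] ] , [ [ inj₁ , inj₂ ∘ inj₁ ] , inj₂ ∘ inj₂ ] )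
          (deep-cut (dual-swap κκ′) smallD′ sub D′? D?
            (λ d d′ (f′ , n) → module-κ′ d d′ (F-of (D′⊆S f′) n))
            Δ₁Γ₁ (free Δ₁⊆ (Free.fκ′ freeΔ)) (free Γ₁⊆ (Free.fκ freeΓ)) (free Γ₁⊆ (Free.fκ′ freeΓ)) left′ left))
        right′)

    -- D and D′ overlap in X and meet nowhere adjacently in κ.  The cut on Y yields X against
    -- W = S ∖ (D ∪ D′); plugging an identity on Z into W turns X into D′ = X ∪ Z.
    overlapping : ∀ {x₀ y₀ z₀} → D x₀ → D′ x₀ → D y₀ → ¬ D′ y₀ → D′ z₀ → ¬ D z₀ → E (κ x₀) (κ y₀) ≡ false → ⊢ (Γ ∪ Δ)
    overlapping {x₀} {y₀} {z₀} dx dx′ dy ny dz nz e₀ = conclude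
      ( (λ { (inj₁ x) → inj₂ (Δ₁⊆ x) ; (inj₂ (inj₁ x)) → inj₂ (Δ₂⊆ x) ; (inj₂ (inj₂ x)) → inj₁ x })
      , (λ { (inj₁ x) → inj₂ (inj₂ x) ; (inj₂ y) → case proj₁ Δ≐ y of λ { (inj₁ a) → inj₁ a ; (inj₂ a) → inj₂ (inj₁ a) } }) )
      ( (λ { (inj₁ (d′ , n)) → F-of (D′⊆S d′) n ; (inj₂ (f′ , n)) → F-of (F′⊆S f′) (λ d → n (d , λ d′ → disj′ d′ f′)) })
      , (λ {i} f → case proj₁ S≐′ (F⊆S f) of λ { (inj₁ d′) → inj₁ (d′ , λ d → disj d f) ; (inj₂ f′) → inj₂ (f′ , λ (d , _) → disj d f) }) )
      (resp
        ( (λ { (inj₁ x) → inj₁ (inj₁ x) ; (inj₂ (inj₁ (inj₁ x))) → inj₁ (inj₂ (inj₁ x)) ; (inj₂ (inj₁ (inj₂ x))) → inj₁ (inj₂ (inj₂ x)) ; (inj₂ (inj₂ x)) → inj₂ x })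
        , (λ { (inj₁ (inj₁ x)) → inj₁ x ; (inj₁ (inj₂ (inj₁ x))) → inj₂ (inj₁ (inj₁ x)) ; (inj₁ (inj₂ (inj₂ x))) → inj₂ (inj₁ (inj₂ x)) ; (inj₂ x) → inj₂ (inj₂ x) }) )
        (cut (dual-swap μκ′) D′ smallD′ Δ₁ ((Δ₂ ∪ Γ₁) ∪ emb κ′ (Z ∪ W))
          (sep-∪ʳ (sep-∪ʳ sep′ Δ₁Γ₁) (free Δ₁⊆ (Free.fκ′ freeΔ))) (free Δ₁⊆ (Free.fκ′ freeΔ))
          (sep-∪ˡ (sep-∪ˡ (free Δ₂⊆ (Free.fμ freeΔ)) (free Γ₁⊆ (Free.fμ freeΓ))) (sep-dual (dual-swap μκ′)))
          left′
          (resp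
            ( (λ { (inj₁ (inj₁ (i , z , e))) → inj₂ (i , proj₁ z , e)
                 ; (inj₁ (inj₂ (inj₁ (i , x , e)))) → inj₂ (i , proj₂ x , e)
                 ; (inj₁ (inj₂ (inj₂ x))) → inj₁ (inj₁ x)
                 ; (inj₂ x) → inj₁ (inj₂ x) })
            , (λ { (inj₁ (inj₁ x)) → inj₁ (inj₂ (inj₂ x))
                 ; (inj₁ (inj₂ x)) → inj₂ x
                 ; (inj₂ (i , d′ , e)) → case D? i of λ { (yes d) → inj₁ (inj₂ (inj₁ (i , (d , d′) , e))) ; (no n) → inj₁ (inj₁ (i , (d′ , n) , e)) } }) )
            (plug-emb (Dual.inj′ κκ′)
              (sep-∪ʳ Zμ-Xμ (Sep-sym (sep-∪ˡ (free Δ₂⊆ (Free.fμ freeΔ)) (free Γ₁⊆ (Free.fμ freeΓ)))))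
              (sep-dual μκ′) (sep-dual μκ′)
              (sep-∪ˡ (sep-dual μκ′) (sep-∪ˡ (free Δ₂⊆ (Free.fκ′ freeΔ)) (free Γ₁⊆ (Free.fκ′ freeΓ))))
              (λ (d′ , _) (f′ , _) → disj′ d′ f′) (λ (d , _) (d′ , _) (f , _) → modul′ d d′ f)
              (identity μκ′ (λ i → D′? i ×-dec ¬? (D? i)))
              released))))
      where
      X Y Z W : K → Set
      X = D ∩ D′
      Y = D ∖ D′
      Z = D′ ∖ D
      W = F′ ∖ Y
      -- Both `D` and `D′` are modules, so an edge value can be moved along either of them: by way
      -- of `z₀` the pair `x`, `y` gets the value of `x₀`, `y₀`.
      XY : ∀ {x y} → X x → Y y → E (κ x) (κ y) ≡ false
      XY {x} {y} (d , d′) (dy′ , ny′) =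
        trans (module′-κ d′ dz (F′-of (D⊆S dy′) ny′))
        (trans (Esym _ _) (trans (modul dy′ dy (F-of (D′⊆S dz) nz))
        (trans (Esym _ _) (trans (module′-κ dz dx′ (F′-of (D⊆S dy) ny)) e₀))))
      ZX : ∀ {z x} → Z z → X x → E (κ z) (κ x) ≡ false
      ZX {z} {x} (d′ , n) (d , _) =
        trans (Esym _ _) (trans (modul d dy (F-of (D′⊆S d′) n))
        (trans (Esym _ _) (trans (module′-κ d′ dx′ (F′-of (D⊆S dy) ny)) e₀)))
      Zμ-Xμ : Sep (emb μ Z) (emb μ X)
      Zμ-Xμ (i , z , refl) (j , x , refl) =
        (λ e → case Dual.inj μκ′ e of λ { refl → proj₂ z (proj₁ x) })
        , trans (Dual.flip μκ′ (λ { refl → proj₂ z (proj₁ x) })) (trans (sym (Dual.flip κκ′ (λ { refl → proj₂ z (proj₁ x) }))) (ZX z x))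
      -- `κ X` moves to the copy `μ`, which preserves edges because `X` has none to `Y` and `Γ₁` is
      -- separated from both copies. The move is needed since the cut on `κ Y` demands a context
      -- without edges to `κ F′`, while `κ X` may have some to `κ W`.
      R : V → V → Set
      R v w = ((Γ₁ ∪ emb κ Y) v × v ≡ w) ⊎ (∃ λ i → X i × v ≡ κ i × w ≡ μ i)
      X≢Y : ∀ {i j} → X i → Y j → i ≢ j
      X≢Y (_ , d′) (_ , n) refl = n d′
      out : ∀ {v i} → (Γ₁ ∪ emb κ Y) v → X i → v ≢ κ i × v ≢ μ i × E v (κ i) ≡ false × E v (μ i) ≡ false
      out (inj₁ g) x = proj₁ (Free.fκ freeΓ (Γ₁⊆ g) (_ , refl)) , proj₁ (Free.fμ freeΓ (Γ₁⊆ g) (_ , refl))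
                     , proj₂ (Free.fκ freeΓ (Γ₁⊆ g) (_ , refl)) , proj₂ (Free.fμ freeΓ (Γ₁⊆ g) (_ , refl))
      out (inj₂ (j , y , refl)) x = (λ e → X≢Y x y (sym (Dual.inj κκ′ e))) , proj₁ κμ , trans (Esym _ _) (XY x y) , proj₂ κμ
      Rinj : ∀ {v w w′} → R v w → R v w′ → w ≡ w′
      Rinj (inj₁ (_ , refl)) (inj₁ (_ , refl)) = refl
      Rinj (inj₁ (u , refl)) (inj₂ (i , x , refl , _)) = ⊥-elim (proj₁ (out u x) refl)
      Rinj (inj₂ (i , x , refl , _)) (inj₁ (u , refl)) = ⊥-elim (proj₁ (out u x) refl)
      Rinj (inj₂ (i , x , refl , refl)) (inj₂ (j , x′ , e , refl)) = cong μ (Dual.inj κκ′ e)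
      Rfun : ∀ {v v′ w} → R v w → R v′ w → v ≡ v′
      Rfun (inj₁ (_ , refl)) (inj₁ (_ , refl)) = refl
      Rfun (inj₁ (u , refl)) (inj₂ (i , x , _ , refl)) = ⊥-elim (proj₁ (proj₂ (out u x)) refl)
      Rfun (inj₂ (i , x , _ , refl)) (inj₁ (u , refl)) = ⊥-elim (proj₁ (proj₂ (out u x)) refl)
      Rfun (inj₂ (i , x , refl , refl)) (inj₂ (j , x′ , refl , e)) = cong κ (Dual.inj μκ′ e)
      copy-edge : ∀ i j → E (κ i) (κ j) ≡ E (μ i) (μ j)
      copy-edge i j with i Fin.≟ j
      ... | no ne = trans (Dual.flip κκ′ ne) (sym (Dual.flip μκ′ ne))
      -- `Dual` says nothing about the diagonal, where `E` may have loops.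
      ... | yes refl = loop i
      RE : ∀ {v v′ w w′} → R v w → R v′ w′ → E v v′ ≡ E w w′
      RE (inj₁ (_ , refl)) (inj₁ (_ , refl)) = refl
      RE (inj₁ (u , refl)) (inj₂ (i , x , refl , refl)) = let (_ , _ , a , b) = out u x in trans a (sym b)
      RE (inj₂ (i , x , refl , refl)) (inj₁ (u , refl)) = let (_ , _ , a , b) = out u x in trans (Esym _ _) (trans (trans a (sym b)) (Esym _ _))
      RE (inj₂ (i , x , refl , refl)) (inj₂ (j , x′ , refl , refl)) = copy-edge i j
      Rlab : ∀ {v w} → R v w → lab v ≡ lab w
      Rlab (inj₁ (_ , refl)) = refl
      Rlab (inj₂ (i , _ , refl , refl)) = trans (dual-sym (Dual.labels κκ′ i)) (sym (dual-sym (Dual.labels μκ′ i)))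
      moved : ⊢ ((emb μ X ∪ Γ₁) ∪ emb κ Y)
      moved = resp
        ( (λ { (v , inj₁ g , inj₁ (_ , refl)) → inj₁ (inj₂ g)
             ; (v , inj₁ g , inj₂ (i , x , refl , _)) → ⊥-elim (proj₁ (out (inj₁ g) x) refl)
             ; (v , inj₂ (i , d , refl) , inj₁ (inj₁ g , refl)) → ⊥-elim (proj₁ (Free.fκ freeΓ (Γ₁⊆ g) (i , refl)) refl)
             ; (v , inj₂ (i , d , refl) , inj₁ (inj₂ y , refl)) → inj₂ y
             ; (v , inj₂ (i , d , refl) , inj₂ (j , x , _ , refl)) → inj₁ (inj₁ (j , x , refl)) })
        , (λ { (inj₁ (inj₁ (i , x , refl))) → κ i , inj₂ (i , proj₁ x , refl) , inj₂ (i , x , refl , refl)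
             ; (inj₁ (inj₂ g)) → _ , inj₁ g , inj₁ (inj₁ g , refl)
             ; (inj₂ y@(i , yi , refl)) → κ i , inj₂ (i , proj₁ yi , refl) , inj₁ (inj₂ y , refl) }) )
        (Transfer.transfer E lab E lab R Rinj Rfun RE Rlab
          (λ { (inj₁ g) → _ , inj₁ (inj₁ g , refl)
             ; (inj₂ (i , d , refl)) → case D′? i of λ { (yes d′) → μ i , inj₂ (i , (d , d′) , refl , refl) ; (no n) → κ i , inj₁ (inj₂ (i , (d , n) , refl) , refl) } })
          left)
      released : ⊢ ((emb μ X ∪ (Δ₂ ∪ Γ₁)) ∪ emb κ′ W)
      released = resp
        ( [ inj₁ ∘ inj₂ ∘ inj₁ , [ [ inj₁ ∘ inj₁ , inj₁ ∘ inj₂ ∘ inj₂ ] , inj₂ ] ]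
        , [ [ inj₂ ∘ inj₁ ∘ inj₁ , [ inj₁ , inj₂ ∘ inj₁ ∘ inj₂ ] ] , inj₂ ∘ inj₂ ] )
        (deep-cut (dual-swap κκ′) smallF′ (λ (d , n) → F′-of (D⊆S d) n) F′? (λ i → D? i ×-dec ¬? (D′? i))
          (λ (d , _) (d′ , _) (f′ , n) → module-κ′ d d′ (F-of (F′⊆S f′) λ d″ → n (d″ , λ d‴ → disj′ d‴ f′)))
          (sep-∪ʳ (free Δ₂⊆ (Free.fμ freeΔ)) Δ₂Γ₁)
          (free Δ₂⊆ (Free.fκ′ freeΔ))
          (sep-∪ˡ {X = emb μ X} (λ { (i , _ , refl) (j , _ , refl) → proj₁ κμ ∘ sym , trans (Esym _ _) (proj₂ κμ) }) (free Γ₁⊆ (Free.fκ freeΓ)))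
          (sep-∪ˡ (sep-dual μκ′) (free Γ₁⊆ (Free.fκ′ freeΓ)))
          right′ moved)

-- Principal cuts involving the prime rule

module CutPrime (m : ℕ) (ih : CutAt m)
  {V : Set} (_≟V_ : DecidableEquality V) (E : V → V → Bool) (Esym : ∀ x y → E x y ≡ E y x)
  (lab : V → Atom) (k : ℕ) where
  open Cuts _≟V_ E Esym lab k
  open CutStep m ih _≟V_ E Esym lab k

  emb? : ∀ {κ S} → Decidable S → Decidable (emb κ S)
  emb? {κ} S? v = Fin.any? (λ i → S? i ×-dec (v ≟V κ i))

  record Primed (κ : K → V) (S : K → Set) (Γ : V → Set) : Set₁ where
    field
      Q       : Graph
      family  : Fin (size Q) → Role → V → Set
      Q-prime : Prime Q
      Q-size  : 4 ≤ size Q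
      layout  : Layout (adj Q) family
      someM   : ∀ i → ∃ (family i M)
      someN   : ∀ i → ∃ (family i N)
      S≐      : emb κ S ≐ (λ x → ∃ λ i → family i M x)
      Γ≐      : Γ ≐ (λ x → ∃ λ i → family i N x ⊎ family i O x)
      blocks  : ∀ i → ⊢ (λ x → ∃ λ ρ → family i ρ x)

    part : ∀ {i ρ x} → family i ρ x → (Γ ∪ emb κ S) x
    part {i} {M} u = inj₂ (proj₂ S≐ (i , u))
    part {i} {N} u = inj₁ (proj₂ Γ≐ (i , inj₁ u))
    part {i} {O} u = inj₁ (proj₂ Γ≐ (i , inj₂ u))

    block : Fin (size Q) → K → Set
    block i a = family i M (κ a)

    rest : Fin (size Q) → V → Set
    rest i v = family i N v ⊎ family i O v

    rest⊆ : ∀ {i} → rest i ⊆ Γ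
    rest⊆ {i} u = proj₂ Γ≐ (i , u)

    open Blocks E Esym Q Q-prime Q-size (λ i → family i M) someM
      (λ i → role-search layout i (blocks i) M) (λ ne u w → Layout.diff layout ne u w) public

    module _ (inj : ∀ {i j} → κ i ≡ κ j → i ≡ j) where
      block⊆ : ∀ {i} → block i ⊆ S
      block⊆ {i} u with proj₂ S≐ (i , u)
      ... | a , s , e with inj e
      ...   | refl = s

      block-of : ∀ {a} → S a → ∃ λ i → block i a
      block-of s = proj₁ S≐ (_ , s , refl)

      block-unique : ∀ {i j a} → block i a → block j a → i ≡ j
      block-unique u w = proj₁ (Layout.unique layout u w)

      block? : ∀ i → Decidable (block i)
      block? i a = role? layout i (blocks i) M (κ a)

      block-elem : ∀ i → ∃ (block i)
      block-elem i with someM i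
      ... | v , u with proj₂ S≐ (i , u)
      ...   | a , s , refl = a , u

      block-small : ∀ i → S ≲ suc m → block i ≲ m
      block-small i small = let (j , ne , _) = avoid₂ (3≤⇐4≤ Q-size) i i ; (a , u) = block-elem j in
        shrink small block⊆ (block⊆ u) λ w → ne (block-unique u w)

      premise : ∀ i → ⊢ (rest i ∪ emb κ (block i))
      premise i = resp
        ( (λ { (M , u) → inj₂ (let (a , s , e) = proj₂ S≐ (i , u) in a , ≡-subst (family i M) e u , e)
             ; (N , u) → inj₁ (inj₁ u) ; (O , u) → inj₁ (inj₂ u) })
        , (λ { (inj₁ (inj₁ u)) → N , u ; (inj₁ (inj₂ u)) → O , u ; (inj₂ (a , u , refl)) → M , u }) ) (blocks i)

  module PlugPrime {κ κ′ μ μ′ : K → V} (copies : Copies κ κ′ μ μ′) {S : K → Set} (small : S ≲ suc m)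
    {Γ Δ : V → Set} (ΓΔ : Sep Γ Δ) (freeΓ : Free κ κ′ μ μ′ Γ) (freeΔ : Free κ κ′ μ μ′ Δ)
    (P : Plugged κ S Γ) (P′ : Primed κ′ S Δ) where
    open Copies copies
    open Plugged P
    open Primed P′ renaming (Γ≐ to Δ≐; S≐ to S≐′)
    open PlugCut κκ′ small ΓΔ (Free.fκ freeΓ) (Free.fκ′ freeΓ) (Free.fκ′ freeΔ) P
    -- `D` is a module of the cut graph, hence of its dual, and misses the vertices of `F`; so it
    -- lies inside one block of the prime rule.
    in-block : ∃ λ i → ∀ {j x} → family j M x → emb κ′ D x → j ≡ i
    in-block = module-in-block (emb κ′ D) (emb? D?)
      (λ { u n _ (b , d , refl) _ (b′ , d′ , refl) → case proj₂ S≐′ (_ , u) of λ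
           { (a , s , refl) → trans (Esym _ _) (trans (module-κ′ d d′ (F-of s (λ d → n (a , d , refl)))) (Esym _ _)) } })
      (let (d , dd) = someD ; (i , u) = block-of (Dual.inj′ κκ′) (D⊆S dd) in i , κ′ d , u , (d , dd , refl))
      (let (f , ff) = someF ; (i , u) = block-of (Dual.inj′ κκ′) (F⊆S ff) in
         i , κ′ f , u , λ (b , d , e) → case Dual.inj′ κκ′ e of λ { refl → disj d ff })

    module At (i₀ : Fin (size Q)) (in-i₀ : ∀ {j x} → family j M x → emb κ′ D x → j ≡ i₀) where
      D⊆block : D ⊆ block i₀
      D⊆block d with block-of (Dual.inj′ κκ′) (D⊆S d)
      ... | j , u with in-i₀ u (_ , d , refl)
      ...   | refl = u
      away : ∀ {i ρ x y} → Γ₁ x → family i ρ y → ¬ emb κ′ D y → x ≢ y × E x y ≡ false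
      away x u _ = sep-∪ʳ (sep-⊆ˡ Γ₁⊆ ΓΔ) (free Γ₁⊆ (Free.fκ′ freeΓ)) x (part u)
      block′ : ∀ i → ⊢ (λ x → ∃ λ ρ → replace family i₀ (emb κ′ D) Γ₁ i ρ x)
      block′ i with i Fin.≟ i₀
      ... | yes refl = resp
        ( (λ { (inj₁ (inj₁ u)) → N , inj₁ (u , outD (inj₁ u))
             ; (inj₁ (inj₂ u)) → O , inj₁ (u , outD (inj₂ u))
             ; (inj₂ (inj₁ x)) → O , inj₂ (refl , refl , x)
             ; (inj₂ (inj₂ (a , (u , n) , refl))) → M , inj₁ (u , λ (b , d , e) → case Dual.inj′ κκ′ e of λ { refl → n d }) })
        , (λ { (M , inj₁ (u , n)) → let (a , s , e) = proj₂ S≐′ (i , u) in inj₂ (inj₂ (a , (≡-subst (family i M) e u , λ d → n (a , d , e)) , e))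
             ; (N , inj₁ (u , n)) → inj₁ (inj₁ u)
             ; (O , inj₁ (u , n)) → inj₁ (inj₂ u)
             ; (ρ , inj₂ (_ , _ , x)) → inj₂ (inj₁ x) }) )
        (deep-cut (dual-swap κκ′) (block-small (Dual.inj′ κκ′) i small) D⊆block (block? (Dual.inj′ κκ′) i) D?
          (λ d d′ (u , n) → module-κ′ d d′ (F-of (block⊆ (Dual.inj′ κκ′) u) n))
          (Sep-sym (sep-⊆ˡ Γ₁⊆ (sep-⊆ʳ rest⊆ ΓΔ))) (free rest⊆ (Free.fκ′ freeΔ))
          (free Γ₁⊆ (Free.fκ freeΓ)) (free Γ₁⊆ (Free.fκ′ freeΓ)) (premise (Dual.inj′ κκ′) i) left)
        where
        outD : ∀ {x} → rest i x → ¬ emb κ′ D x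
        outD u t = proj₁ (Free.fκ′ freeΔ (rest⊆ u) (emb-range t)) refl
      ... | no ne = resp
        ( (λ { (ρ , u) → ρ , inj₁ (u , λ { (a , d , refl) → ne (proj₁ (Layout.unique layout u (D⊆block d))) }) })
        , (λ { (ρ , inj₁ (u , _)) → ρ , u ; (ρ , inj₂ (e , _)) → ⊥-elim (ne e) }) ) (blocks i)

      -- Only premise `i₀` changes, where `Γ₁` replaces `D`. The premises are reassembled by
      -- `substituted` and not by `prm`, because `D` may have been the whole block, in which case
      -- the M-part of `i₀` is now empty.
      result : ⊢ (Γ ∪ Δ)
      result =
        conclude {Γ₁ ∪ Δ} {F} (id , id) (id , id)
          (resp
            ( (λ { (i , ρ , inj₁ (u , n)) → case part u of λ
                     { (inj₁ d) → inj₁ (inj₂ d)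
                     ; (inj₂ (a , s , e)) → inj₂ (a , F-of s (λ d → n (a , d , e)) , e) }
                 ; (i , ρ , inj₂ (_ , _ , x)) → inj₁ (inj₁ x) })
            , (λ { (inj₁ (inj₁ x)) → i₀ , O , inj₂ (refl , refl , x)
                 ; (inj₁ (inj₂ d)) → let out = λ (t : emb κ′ D _) → proj₁ (Free.fκ′ freeΔ d (emb-range t)) refl in
                     case proj₁ Δ≐ d of λ { (i , inj₁ u) → i , N , inj₁ (u , out) ; (i , inj₂ u) → i , O , inj₁ (u , out) }
                 ; (inj₂ (a , f , refl)) → let (i , u) = block-of (Dual.inj′ κκ′) (F⊆S f) in
                     i , M , inj₁ (u , λ (b , d , e) → case Dual.inj′ κκ′ e of λ { refl → disj d f }) }) )
            (substituted (adj Q) (adj-sym Q) (replace family i₀ (emb κ′ D) Γ₁) (replaceLayout layout away) block′))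

  plug-prime : ∀ {κ κ′ μ μ′} → Copies κ κ′ μ μ′ → ∀ {S} → S ≲ suc m → ∀ {Γ Δ} → Sep Γ Δ →
    Free κ κ′ μ μ′ Γ → Free κ κ′ μ μ′ Δ → Plugged κ S Γ → Primed κ′ S Δ → ⊢ (Γ ∪ Δ)
  plug-prime copies small ΓΔ freeΓ freeΔ P P′ = At.result (proj₁ in-block) (proj₂ in-block)
    where open PlugPrime copies small ΓΔ freeΓ freeΔ P P′

  -- A block is a module different from the whole, so it lies within a block of the other proof.
  -- Applied in both directions, this makes the two partitions into blocks coincide.
  block-into : ∀ {κ κ′} → Dual κ κ′ → ∀ {S Γ Δ} (P : Primed κ S Γ) (P′ : Primed κ′ S Δ) →
    ∀ i → ∃ λ j → Primed.block P i ⊆ Primed.block P′ j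
  block-into {κ} {κ′} d P P′ i = proj₁ within , λ {a} u → into (proj₁ within) (proj₂ within) a u
    where
    module A = Primed P
    module B = Primed P′
    inj = Dual.inj d
    inj′ = Dual.inj′ d
    agree : ∀ {l a b b′} → A.block l a → l ≢ i → A.block i b → A.block i b′ → E (κ′ a) (κ′ b) ≡ E (κ′ a) (κ′ b′)
    agree {l} {a} ua l≢i ub ub′ = Bool.not-injective (trans (sym (Dual.flip d (a≢ ub)))
      (trans (Layout.diff A.layout l≢i ua ub) (trans (sym (Layout.diff A.layout l≢i ua ub′)) (Dual.flip d (a≢ ub′)))))
      where
      a≢ : ∀ {b} → A.block i b → a ≢ b
      a≢ w refl = l≢i (A.block-unique inj ua w)
    within : ∃ λ j → ∀ {l x} → B.family l M x → emb κ′ (A.block i) x → l ≡ j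
    within = B.module-in-block (emb κ′ (A.block i)) (emb? (A.block? inj i))
      (λ { u n _ (b , ub , refl) _ (b′ , ub′ , refl) → case proj₂ B.S≐ (_ , u) of λ
           { (a , s , refl) → let (l , ua) = A.block-of inj s in agree ua (λ { refl → n (a , ua , refl) }) ub ub′ } })
      (let (a , u) = A.block-elem inj i ; (l , w) = B.block-of inj′ (A.block⊆ inj u) in l , κ′ a , w , (a , u , refl))
      (let (j , ne , _) = avoid₂ (3≤⇐4≤ A.Q-size) i i ; (a , u) = A.block-elem inj j
           (l , w) = B.block-of inj′ (A.block⊆ inj u)
       in l , κ′ a , w , λ (b , v , e) → case inj′ e of λ { refl → ne (A.block-unique inj u v) })
    into : ∀ j → (∀ {l x} → B.family l M x → emb κ′ (A.block i) x → l ≡ j) → ∀ a → A.block i a → B.block j a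
    into j in-j a u with B.block-of inj′ (A.block⊆ inj u)
    ... | l , w with in-j w (a , u , refl)
    ...   | refl = w

  module PrimePrime {κ κ′ : K → V} (d : Dual κ κ′) {S : K → Set} (small : S ≲ suc m) {Γ Δ : V → Set} (ΓΔ : Sep Γ Δ)
    (Γκ : Sep Γ (range κ)) (Δκ′ : Sep Δ (range κ′)) (P : Primed κ S Γ) (P′ : Primed κ′ S Δ)
    (σ : Fin (size (Primed.Q P)) → Fin (size (Primed.Q P′))) (τ : Fin (size (Primed.Q P′)) → Fin (size (Primed.Q P)))
    (fwd : ∀ i → Primed.block P i ⊆ Primed.block P′ (σ i)) (bwd : ∀ j → Primed.block P′ j ⊆ Primed.block P (τ j)) where
    module A = Primed P
    module B = Primed P′
    inj = Dual.inj d
    inj′ = Dual.inj′ d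
    τσ : ∀ i → τ (σ i) ≡ i
    τσ i = let (a , u) = A.block-elem inj i in
      A.block-unique inj (bwd (σ i) (fwd i u)) u
    στ : ∀ j → σ (τ j) ≡ j
    στ j = let (a , u) = B.block-elem inj′ j in
      B.block-unique inj′ (fwd (τ j) (bwd j u)) u
    back : ∀ i → B.block (σ i) ⊆ A.block i
    back i {a} u = ≡-subst (λ j → A.block j a) (τσ i) (bwd (σ i) u)
    -- The premises of both proofs are merged block by block. The N-part of the right proof is
    -- joined according to the complement of `B.Q`, which corresponds to `A.Q` since the cut graphs
    -- are dual; therefore it takes role M.
    family : Fin (size A.Q) → Role → V → Set
    family i M v = B.family (σ i) N v
    family i N v = A.family i N v
    family i O v = A.family i O v ⊎ B.family (σ i) O v
    right-part : ∀ j {v} → B.rest j v → ∃₂ λ i ρ → family i ρ v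
    right-part j u with τ j | στ j
    right-part j (inj₁ u) | i | refl = i , M , u
    right-part j (inj₂ u) | i | refl = i , O , inj₂ u
    σ-inj : ∀ {i j} → σ i ≡ σ j → i ≡ j
    σ-inj {i} {j} e = trans (sym (τσ i)) (trans (cong τ e) (τσ j))
    edge : ∀ {i j} → i ≢ j → not (adj B.Q (σ i) (σ j)) ≡ adj A.Q i j
    edge {i} {j} ne = at (proj₂ (A.block-elem inj i)) (proj₂ (A.block-elem inj j))
      where
      at : ∀ {a b} → A.block i a → A.block j b → not (adj B.Q (σ i) (σ j)) ≡ adj A.Q i j
      at u w = trans (cong not (sym (Layout.diff B.layout (ne ∘ σ-inj) (fwd i u) (fwd j w))))
        (trans (sym (Dual.flip d λ { refl → ne (A.block-unique inj u w) })) (Layout.diff A.layout ne u w))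
    data Side (i : Fin (size A.Q)) : Role → V → Set where
      left  : ∀ {ρ v} → ρ ≢ M → A.family i ρ v → Side i ρ v
      right : ∀ {ρ v} → ρ ≢ M → B.family (σ i) ρ v → Side i (swapRole ρ) v
    side : ∀ {i} ρ {v} → family i ρ v → Side i ρ v
    side M u = right (λ ()) u
    side N u = left (λ ()) u
    side O (inj₁ u) = left (λ ()) u
    side O (inj₂ u) = right (λ ()) u
    left-Γ : ∀ {i ρ v} → ρ ≢ M → A.family i ρ v → Γ v
    left-Γ {ρ = M} n u = ⊥-elim (n refl)
    left-Γ {ρ = N} n u = A.rest⊆ (inj₁ u)
    left-Γ {ρ = O} n u = A.rest⊆ (inj₂ u)
    right-Δ : ∀ {i ρ v} → ρ ≢ M → B.family i ρ v → Δ v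
    right-Δ {ρ = M} n u = ⊥-elim (n refl)
    right-Δ {ρ = N} n u = B.rest⊆ (inj₁ u)
    right-Δ {ρ = O} n u = B.rest⊆ (inj₂ u)
    across : ∀ ρ σ {b} → ρ ≢ M → σ ≢ M → roleEdge ρ (swapRole σ) b ≡ false
    across M _ n _ = ⊥-elim (n refl)
    across N M _ n = ⊥-elim (n refl)
    across N N _ _ = refl
    across N O _ _ = refl
    across O _ _ _ = refl
    across′ : ∀ ρ σ {b} → ρ ≢ M → σ ≢ M → roleEdge (swapRole σ) ρ b ≡ false
    across′ M _ n _ = ⊥-elim (n refl)
    across′ N M _ n = ⊥-elim (n refl)
    across′ N N _ _ = refl
    across′ N O _ _ = refl
    across′ O M _ n = ⊥-elim (n refl)
    across′ O N _ _ = refl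
    across′ O O _ _ = refl
    swapped : ∀ ρ σ {b c} → ρ ≢ M → σ ≢ M → not b ≡ c → roleEdge ρ σ b ≡ roleEdge (swapRole ρ) (swapRole σ) c
    swapped M _ n _ e = ⊥-elim (n refl)
    swapped N M _ n e = ⊥-elim (n refl)
    swapped N N _ _ e = e
    swapped N O _ _ e = refl
    swapped O M _ n e = ⊥-elim (n refl)
    swapped O N _ _ e = refl
    swapped O O _ _ e = refl
    layout : Layout (adj A.Q) family
    layout = record
      { unique = λ {i} {j} {ρ} {σ} u w → unique′ (side ρ u) (side σ w)
      ; same = λ {i} {ρ} {σ} u w → same′ (side ρ u) (side σ w)
      ; diff = λ {i} {j} {ρ} {σ} ne u w → diff′ ne (side ρ u) (side σ w) }
      where
      unique′ : ∀ {i j ρ σ x} → Side i ρ x → Side j σ x → i ≡ j × ρ ≡ σ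
      unique′ (left _ u) (left _ w) = Layout.unique A.layout u w
      unique′ (left n u) (right n′ w) = ⊥-elim (proj₁ (ΓΔ (left-Γ n u) (right-Δ n′ w)) refl)
      unique′ (right n u) (left n′ w) = ⊥-elim (proj₁ (ΓΔ (left-Γ n′ w) (right-Δ n u)) refl)
      unique′ (right _ u) (right _ w) = let (e , f) = Layout.unique B.layout u w in σ-inj e , cong swapRole f
      same′ : ∀ {i ρ σ x y} → Side i ρ x → Side i σ y → ρ ≢ σ → E x y ≡ false
      same′ (left _ u) (left _ w) ne = Layout.same A.layout u w ne
      same′ (left n u) (right n′ w) ne = proj₂ (ΓΔ (left-Γ n u) (right-Δ n′ w))
      same′ (right n u) (left n′ w) ne = trans (Esym _ _) (proj₂ (ΓΔ (left-Γ n′ w) (right-Δ n u)))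
      same′ (right _ u) (right _ w) ne = Layout.same B.layout u w (ne ∘ cong swapRole)
      diff′ : ∀ {i j ρ σ x y} → i ≢ j → Side i ρ x → Side j σ y → E x y ≡ roleEdge ρ σ (adj A.Q i j)
      diff′ ne (left _ u) (left _ w) = Layout.diff A.layout ne u w
      diff′ ne (left {ρ} n u) (right {σ} n′ w) = trans (proj₂ (ΓΔ (left-Γ n u) (right-Δ n′ w))) (sym (across ρ σ n n′))
      diff′ ne (right {σ} n u) (left {ρ} n′ w) = trans (trans (Esym _ _) (proj₂ (ΓΔ (left-Γ n′ w) (right-Δ n u)))) (sym (across′ ρ σ n′ n))
      diff′ ne (right {ρ} n u) (right {σ} n′ w) = trans (Layout.diff B.layout (ne ∘ σ-inj) u w) (swapped ρ σ n n′ (edge ne))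

    result : ⊢ (Γ ∪ Δ)
    result =
      prm A.Q family A.Q-prime A.Q-size layout
        (λ i → B.someN (σ i)) A.someN
        ( (λ { (inj₁ x) → case proj₁ A.Γ≐ x of λ { (i , inj₁ u) → i , N , u ; (i , inj₂ u) → i , O , inj₁ u }
             ; (inj₂ x) → case proj₁ B.Γ≐ x of λ { (j , u) → right-part j u } })
        , (λ { (i , M , u) → inj₂ (proj₂ B.Γ≐ (σ i , inj₁ u)) ; (i , N , u) → inj₁ (proj₂ A.Γ≐ (i , inj₁ u))
             ; (i , O , inj₁ u) → inj₁ (proj₂ A.Γ≐ (i , inj₂ u)) ; (i , O , inj₂ u) → inj₂ (proj₂ B.Γ≐ (σ i , inj₂ u)) }) )
        λ i → resp
          ( (λ { (inj₁ (inj₁ u)) → N , u ; (inj₁ (inj₂ u)) → O , inj₁ u ; (inj₂ (inj₁ u)) → M , u ; (inj₂ (inj₂ u)) → O , inj₂ u })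
          , (λ { (M , u) → inj₂ (inj₁ u) ; (N , u) → inj₁ (inj₁ u) ; (O , inj₁ u) → inj₁ (inj₂ u) ; (O , inj₂ u) → inj₂ (inj₂ u) }) )
          (cut d (A.block i) (A.block-small inj i small) (A.rest i) (B.rest (σ i))
            (sep-⊆ˡ A.rest⊆ (sep-⊆ʳ B.rest⊆ ΓΔ)) (free A.rest⊆ Γκ) (free B.rest⊆ Δκ′)
            (A.premise inj i)
            (resp ( (λ { (inj₁ x) → inj₁ x ; (inj₂ x) → inj₂ (emb-⊆ (back i) x) })
                  , (λ { (inj₁ x) → inj₁ x ; (inj₂ x) → inj₂ (emb-⊆ (fwd i) x) }) )
                  (B.premise inj′ (σ i))))

  prime-prime : ∀ {κ κ′} → Dual κ κ′ → ∀ {S} → S ≲ suc m → ∀ {Γ Δ} → Sep Γ Δ →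
    Sep Γ (range κ) → Sep Δ (range κ′) → Primed κ S Γ → Primed κ′ S Δ → ⊢ (Γ ∪ Δ)
  prime-prime d small ΓΔ Γκ Δκ′ P P′ = PrimePrime.result d small ΓΔ Γκ Δκ′ P P′
    (λ i → proj₁ (block-into d P P′ i)) (λ j → proj₁ (block-into (dual-swap d) P′ P j))
    (λ i → proj₂ (block-into d P P′ i)) (λ j → proj₂ (block-into (dual-swap d) P′ P j))

-- Principal cuts of all kinds, and cuts on a disconnected graph

module CutPrincipal (m : ℕ) (ih : CutAt m)
  {V : Set} (_≟V_ : DecidableEquality V) (E : V → V → Bool) (Esym : ∀ x y → E x y ≡ E y x)
  (lab : V → Atom) (k : ℕ) where
  open Cuts _≟V_ E Esym lab k
  open CutStep m ih _≟V_ E Esym lab k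
  open CutPrime m ih _≟V_ E Esym lab k

  data PrincipalAt (κ : K → V) (S : K → Set) (Γ : V → Set) : Set₁ where
    atom : ∀ i y → S ≐ (_≡ i) → Γ ≐ (_≡ y) → lab y ≡ dualA (lab (κ i)) → PrincipalAt κ S Γ
    plugged : Plugged κ S Γ → PrincipalAt κ S Γ
    primed : Primed κ S Γ → PrincipalAt κ S Γ

  principal-at : ∀ {κ} → (∀ {i j} → κ i ≡ κ j → i ≡ j) → ∀ {S Γ} → Principal Γ (emb κ S) → PrincipalAt κ S Γ
  principal-at {κ} inj {S} (p-ax x y S≐ Γ≐ e l) with proj₂ S≐ refl
  ... | i , s , refl = atom i y ((λ s′ → inj (proj₁ S≐ (_ , s′ , refl))) , λ { refl → s }) Γ≐ l
  principal-at {κ} inj {S} (p-plg Γ₁ Γ₂ D F S≐ Γ≐ sep dj md (d , dd) (f , ff) hl hr) = plugged record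
    { Γ₁ = Γ₁ ; Γ₂ = Γ₂ ; D = D ∘ κ ; F = F ∘ κ
    ; S≐ = (λ s → proj₁ S≐ (_ , s , refl)) , λ u → from (proj₂ S≐ u) refl
    ; Γ≐ = Γ≐ ; sep = sep ; disj = dj ; modul = md
    ; someD = let (i , _ , e) = proj₂ S≐ (inj₁ dd) in i , ≡-subst D e dd
    ; someF = let (i , _ , e) = proj₂ S≐ (inj₂ ff) in i , ≡-subst F e ff
    ; left = resp ( (λ { (inj₁ x) → inj₁ x ; (inj₂ u) → inj₂ (let (i , _ , e) = proj₂ S≐ (inj₁ u) in i , ≡-subst D e u , e) })
                  , (λ { (inj₁ x) → inj₁ x ; (inj₂ (_ , u , refl)) → inj₂ u }) ) hl
    ; right = resp ( (λ { (inj₁ x) → inj₁ x ; (inj₂ u) → inj₂ (let (i , _ , e) = proj₂ S≐ (inj₂ u) in i , ≡-subst F e u , e) })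
                  , (λ { (inj₁ x) → inj₁ x ; (inj₂ (_ , u , refl)) → inj₂ u }) ) hr }
    where
    from : ∀ {i v} → emb κ S v → v ≡ κ i → S i
    from (j , s , refl) e with inj e
    ... | refl = s
  principal-at inj (p-prm Q F pr sz L m n S≐ Γ≐ ps) = primed record
    { Q = Q ; family = F ; Q-prime = pr ; Q-size = sz ; layout = L ; someM = m ; someN = n ; S≐ = S≐ ; Γ≐ = Γ≐ ; blocks = ps }

  plug-plug : ∀ {κ κ′ μ μ′} → Copies κ κ′ μ μ′ → ∀ {S} → S ≲ suc m → ∀ {Γ Δ} → Sep Γ Δ →
    Free κ κ′ μ μ′ Γ → Free κ κ′ μ μ′ Δ → Plugged κ S Γ → Plugged κ′ S Δ → ⊢ (Γ ∪ Δ)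
  plug-plug {κ} {κ′} copies {S} small {Γ} {Δ} ΓΔ freeΓ freeΔ P P′ =
    cases (Fin.any? (λ i → A.D? i ×-dec B.D? i)) (Fin.any? (λ i → A.D? i ×-dec ¬? (B.D? i))) (Fin.any? (λ i → B.D? i ×-dec ¬? (A.D? i)))
    where
    module L = Plugged P
    module R = Plugged P′
    module A = PlugCut (Copies.κκ′ copies) small ΓΔ (Free.fκ freeΓ) (Free.fκ′ freeΓ) (Free.fκ′ freeΔ) P
    module B = PlugCut (dual-swap (Copies.κκ′ copies)) small (Sep-sym ΓΔ) (Free.fκ′ freeΔ) (Free.fκ freeΔ) (Free.fκ freeΓ) P′
    module LR = PlugPlug copies small ΓΔ freeΓ freeΔ P P′
    module RL = PlugPlug (copies-swap copies) small (Sep-sym ΓΔ) (free-swap freeΔ) (free-swap freeΓ) P′ P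
    sub : ∀ {X Y : K → Set} → Decidable Y → ¬ ∃ (X ∖ Y) → X ⊆ Y
    sub Y? n {i} x with Y? i
    ... | yes y = y
    ... | no ny = ⊥-elim (n (i , x , ny))
    cases : Dec (∃ (L.D ∩ R.D)) → Dec (∃ (L.D ∖ R.D)) → Dec (∃ (R.D ∖ L.D)) → ⊢ (Γ ∪ Δ)
    cases (no n) _ _ = LR.disjoint (λ d d′ → n (_ , d , d′))
    cases (yes _) (no n) _ = LR.nested (sub B.D? n)
    cases (yes _) (yes _) (no n) = resp swap-∪ (RL.nested (sub A.D? n))
    cases (yes (x , dx , dx′)) (yes (y , dy , ny)) (yes (z , dz , nz)) with E (κ x) (κ y) in e
    ... | false = LR.overlapping dx dx′ dy ny dz nz e
    -- The pieces of an overlap are joined to each other by one common value. If it is an edge in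
    -- `κ`, it is a non-edge in `κ′`, and the argument applies with the two sides exchanged.
    ... | true = resp swap-∪ (RL.overlapping dx′ dx dz nz dy ny
      (trans (sym xy-z) (Bool.not-injective (trans (sym (Dual.flip (Copies.κκ′ copies) λ { refl → ny dx′ })) e))))
      where
      xy-z : E (κ′ x) (κ′ y) ≡ E (κ′ x) (κ′ z)
      xy-z = trans (R.modul dx′ dz (B.F-of (A.D⊆S dy) ny)) (trans (Esym _ _)
               (trans (A.module-κ′ dy dx (A.F-of (B.D⊆S dz) nz)) refl))

  single-plugged : ∀ {κ S Γ i} → S ≐ (_≡ i) → ¬ Plugged κ S Γ
  single-plugged S≐ P = let open Plugged P renaming (S≐ to S≐′) ; (d , dd) = someD ; (f , ff) = someF in
    same-vertex {D} {F} disj (trans (proj₁ S≐ (proj₂ S≐′ (inj₁ dd))) (sym (proj₁ S≐ (proj₂ S≐′ (inj₂ ff))))) dd ff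
    where
    same-vertex : ∀ {D F : K → Set} → (∀ {i} → D i → ¬ F i) → ∀ {i j} → i ≡ j → D i → ¬ F j
    same-vertex dj refl = dj

  single-primed : ∀ {κ S Γ i} → (∀ {i j} → κ i ≡ κ j → i ≡ j) → S ≐ (_≡ i) → ¬ Primed κ S Γ
  single-primed {i = a} inj S≐ P =
    let (i , u) = block-of inj (proj₂ S≐ refl)
        (j , ne , _) = avoid₂ (3≤⇐4≤ Q-size) i i
        (b , w) = block-elem inj j
    in ne (block-unique inj (≡-subst (block j) (proj₁ S≐ (block⊆ inj w)) w) u)
    where
    open Primed P using (block; block-of; block-elem; block⊆; block-unique; Q-size)

  principal-cut : ∀ {κ κ′ μ μ′} → Copies κ κ′ μ μ′ → ∀ {S} → S ≲ suc m → ∀ {Γ Δ} → Sep Γ Δ →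
    Free κ κ′ μ μ′ Γ → Free κ κ′ μ μ′ Δ → PrincipalAt κ S Γ → PrincipalAt κ′ S Δ → ⊢ (Γ ∪ Δ)
  principal-cut c small ΓΔ fΓ fΔ (plugged P) (plugged P′) = plug-plug c small ΓΔ fΓ fΔ P P′
  principal-cut c small ΓΔ fΓ fΔ (plugged P) (primed P′) = plug-prime c small ΓΔ fΓ fΔ P P′
  principal-cut c small ΓΔ fΓ fΔ (primed P) (plugged P′) =
    resp swap-∪ (plug-prime (copies-swap c) small (Sep-sym ΓΔ) (free-swap fΔ) (free-swap fΓ) P′ P)
  principal-cut c small ΓΔ fΓ fΔ (primed P) (primed P′) = prime-prime (Copies.κκ′ c) small ΓΔ (Free.fκ fΓ) (Free.fκ′ fΔ) P P′
  principal-cut {κ} {κ′} c small ΓΔ fΓ fΔ (atom i y S≐ Γ≐ l) (atom j z S≐′ Δ≐ l′) with proj₁ S≐′ (proj₂ S≐ refl)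
  ... | refl = ax y z (inj₁ y∈) (inj₂ z∈) (λ { (inj₁ x) → inj₁ (proj₁ Γ≐ x) ; (inj₂ x) → inj₂ (proj₁ Δ≐ x) })
    (proj₂ (ΓΔ y∈ z∈)) (trans l (cong dualA (trans (dual-sym (Dual.labels (Copies.κκ′ c) i)) (sym l′))))
    where
    y∈ = proj₂ Γ≐ refl
    z∈ = proj₂ Δ≐ refl
  principal-cut c small ΓΔ fΓ fΔ (atom i y S≐ Γ≐ l) (plugged P) = ⊥-elim (single-plugged S≐ P)
  principal-cut c small ΓΔ fΓ fΔ (plugged P) (atom i y S≐ Δ≐ l) = ⊥-elim (single-plugged S≐ P)
  principal-cut c small ΓΔ fΓ fΔ (atom i y S≐ Γ≐ l) (primed P) = ⊥-elim (single-primed (Dual.inj′ (Copies.κκ′ c)) S≐ P)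
  principal-cut c small ΓΔ fΓ fΔ (primed P) (atom i y S≐ Δ≐ l) = ⊥-elim (single-primed (Dual.inj (Copies.κκ′ c)) S≐ P)

  record Split (κ : K → V) (S : K → Set) (A : K → Bool) : Set where
    field
      some   : ∃ λ i → S i × A i ≡ true
      other  : ∃ λ i → S i × A i ≡ false
      across : ∀ i j → S i → S j → A i ≡ true → A j ≡ false → E (κ i) (κ j) ≡ false

  split? : ∀ κ {S} → Decidable S → Dec (∃ (Split κ S))
  split? κ S? = any-subset?
    (λ {f} {g} e s → let open Split s in record
      { some = let (i , s , a) = some in i , s , trans (sym (e i)) a
      ; other = let (i , s , a) = other in i , s , trans (sym (e i)) a
      ; across = λ i j s s′ a b → across i j s s′ (trans (e i) a) (trans (e j) b) })
    (λ A → map′ (λ (a , b , c) → record { some = a ; other = b ; across = c })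
                (λ s → let open Split s in some , other , across)
      ( Fin.any? (λ i → S? i ×-dec (A i Bool.≟ true))
      ×-dec Fin.any? (λ i → S? i ×-dec (A i Bool.≟ false))
      ×-dec Fin.all? (λ i → Fin.all? λ j → S? i →-dec (S? j →-dec ((A i Bool.≟ true) →-dec
              ((A j Bool.≟ false) →-dec (E (κ i) (κ j) Bool.≟ false)))))))

  unsplit-conn : ∀ {κ} → ∀ {S} → Decidable S → ¬ ∃ (Split κ S) → Conn (emb κ S)
  unsplit-conn {κ} {S} S? n T T? (_ , (i , si , refl) , ti) (_ , (j , sj , refl) , tj)
    with Fin.any? (λ a → Fin.any? λ b → (S? a ×-dec T? (κ a)) ×-dec (S? b ×-dec ¬? (T? (κ b))) ×-dec (E (κ a) (κ b) Bool.≟ true))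
  ... | yes (a , b , (sa , ta) , (sb , tb) , e) = κ a , κ b , ((a , sa , refl) , ta) , ((b , sb , refl) , tb) , e
  ... | no none = ⊥-elim (n ((λ a → does (T? (κ a))) , record
      { some = i , si , dec-true (T? (κ i)) ti
      ; other = j , sj , dec-false (T? (κ j)) tj
      ; across = λ a b sa sb ta tb → ≢true⇒false λ e →
          none (a , b , (sa , does-true (T? (κ a)) ta) , (sb , does-false (T? (κ b)) tb) , e) }))

  -- In the dual, vertices from different halves are adjacent. If `T` separates two vertices of one
  -- half, a vertex `l` of the other half is adjacent to both, and on whichever side of `T` it is,
  -- one of the two edges crosses.
  split-conn : ∀ {κ κ′} → Dual κ κ′ → ∀ {S A} → Split κ S A → Conn (emb κ′ S)
  split-conn {κ} {κ′} d {S} {A} sp T T? (_ , (i , si , refl) , ti) (_ , (j , sj , refl) , tj) = go (A i) (A j) refl refl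
    where
    open Split sp
    joined : ∀ {a b} → S a → S b → A a ≡ true → A b ≡ false → E (κ′ a) (κ′ b) ≡ true
    joined sa sb ta fb = trans (Dual.flip (dual-swap d) λ { refl → true≢false ta fb }) (cong not (across _ _ sa sb ta fb))
    joined′ : ∀ {a b} → S a → S b → A a ≡ false → A b ≡ true → E (κ′ a) (κ′ b) ≡ true
    joined′ sa sb fa tb = trans (Esym _ _) (joined sb sa tb fa)
    Goal = ∃₂ λ x y → (emb κ′ S ∩ T) x × (emb κ′ S ∖ T) y × E x y ≡ true
    edge : ∀ {a b} → S a → S b → T (κ′ a) → ¬ T (κ′ b) → E (κ′ a) (κ′ b) ≡ true → Goal
    edge sa sb ta tb e = _ , _ , ((_ , sa , refl) , ta) , ((_ , sb , refl) , tb) , e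
    go : ∀ a b → A i ≡ a → A j ≡ b → Goal
    go true false ea eb = edge si sj ti tj (joined si sj ea eb)
    go false true ea eb = edge si sj ti tj (joined′ si sj ea eb)
    go true true ea eb with other
    ... | l , sl , el with T? (κ′ l)
    ...   | yes tl = edge sl sj tl tj (joined′ sl sj el eb)
    ...   | no tl = edge si sl ti tl (joined si sl ea el)
    go false false ea eb with some
    ... | l , sl , el with T? (κ′ l)
    ...   | yes tl = edge sl sj tl tj (joined sl sj el eb)
    ...   | no tl = edge si sl ti tl (joined′ si sl ea el)

  module SplitCut {κ κ′ : K → V} (d : Dual κ κ′) {S : K → Set} (S? : Decidable S) (small : S ≲ suc m) {A : K → Bool}
    (sp : Split κ S A) {Γ Δ : V → Set} (ΓΔ : Sep Γ Δ) (Γκ : Sep Γ (range κ)) (Δκ : Sep Δ (range κ)) (Δκ′ : Sep Δ (range κ′))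
    (h : ⊢ (Γ ∪ emb κ S)) where
    open Split sp
    inj = Dual.inj d
    inj′ = Dual.inj′ d

    across′ : ∀ b {i j} → S i → S j → A i ≡ b → A j ≡ not b → E (κ i) (κ j) ≡ false
    across′ true si sj a b = across _ _ si sj a b
    across′ false si sj a b = trans (Esym _ _) (across _ _ sj si b a)

    half : ∀ b → ∃ λ i → S i × A i ≡ b
    half true = some
    half false = other

    not-atom : ∀ {i} → ¬ (S ≐ (_≡ i))
    not-atom S≐ with some | other
    ... | a , sa , ta | b , sb , fb with trans (proj₁ S≐ sa) (sym (proj₁ S≐ sb))
    ...   | refl = true≢false ta fb

    -- Each half is a module of the dual and not all of it, so it lies in one block. Two blocks
    -- would then contain everything, but `Q` has a third vertex.
    not-prime : ¬ Primed κ′ S Δ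
    not-prime P = third (in-block true) (in-block false)
      where
      open Primed P
      Half : Bool → K → Set
      Half b i = S i × A i ≡ b
      Half? : ∀ b → Decidable (Half b)
      Half? b i = S? i ×-dec (A i Bool.≟ b)
      joined : ∀ b {i j} → S i → ¬ Half b i → Half b j → E (κ′ i) (κ′ j) ≡ true
      joined b si n (sj , aj) = trans (Dual.flip (dual-swap d) λ { refl → n (sj , aj) })
        (cong not (trans (Esym _ _) (across′ b sj si aj (Bool.¬-not λ e → n (si , e)))))
      in-block : ∀ b → ∃ λ i → ∀ {j x} → family j M x → emb κ′ (Half b) x → j ≡ i
      in-block b = module-in-block (emb κ′ (Half b)) (emb? (Half? b))
        (λ { u n _ (_ , hb , refl) _ (_ , hb′ , refl) → case proj₂ S≐ (_ , u) of λ
             { (a , s , refl) → trans (joined b s (λ ha → n (a , ha , refl)) hb) (sym (joined b s (λ ha → n (a , ha , refl)) hb′)) } })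
        (let (a , s , e) = half b ; (i , u) = block-of inj′ s in i , κ′ a , u , (a , (s , e) , refl))
        (let (a , s , e) = half (not b) ; (i , u) = block-of inj′ s in i , κ′ a , u , outside b e)
        where
        outside : ∀ b {a} → A a ≡ not b → ¬ emb κ′ (Half b) (κ′ a)
        outside b e (c , (_ , e′) , q) with inj′ q
        ... | refl = Bool.not-¬ e′ e
      third : (∃ λ i → ∀ {j x} → family j M x → emb κ′ (Half true) x → j ≡ i) →
              (∃ λ i → ∀ {j x} → family j M x → emb κ′ (Half false) x → j ≡ i) → ⊥
      third (i , hi) (j , hj) with avoid₂ (3≤⇐4≤ Q-size) i j
      ... | l , l≢i , l≢j with block-elem inj′ l
      ...   | a , u with A a in e
      ...     | true = l≢i (hi u (a , (block⊆ inj′ u , e) , refl))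
      ...     | false = l≢j (hj u (a , (block⊆ inj′ u , e) , refl))

    -- If `D` lies in one half, the other half of `κ S` counts as context and the cut is made on the
    -- smaller graph. If `D` meets both halves, `κ D` has no edges to `κ F`, so `D` is cut with
    -- `κ F` as context.
    plugged-cut : Plugged κ′ S Δ → ⊢ (Γ ∪ Δ)
    plugged-cut P = resp swap-∪ (conclude {Δ₁ ∪ Γ} {F} (id , id) (id , id)
      (sides (Fin.any? (λ i → D? i ×-dec (A i Bool.≟ true))) (Fin.any? (λ i → D? i ×-dec (A i Bool.≟ false)))))
      where
      open Plugged P renaming (Γ₁ to Δ₁; Γ₂ to Δ₂)
      open PlugCut (dual-swap d) small (Sep-sym ΓΔ) Δκ′ Δκ Γκ P renaming (Γ₁⊆ to Δ₁⊆; module-κ′ to module-κ)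
      one-side : ∀ b → (∀ {i} → D i → A i ≡ b) → ⊢ ((Δ₁ ∪ Γ) ∪ emb κ F)
      one-side b D⊆b = resp
        ( (λ { (inj₁ (inj₁ x)) → inj₁ (inj₂ x)
             ; (inj₁ (inj₂ (i , (s , a) , e))) → inj₂ (i , F-of s (λ di → Bool.not-¬ (D⊆b di) a) , e)
             ; (inj₂ (inj₁ x)) → inj₁ (inj₁ x)
             ; (inj₂ (inj₂ (i , ((s , _) , n) , e))) → inj₂ (i , F-of s n , e) })
        , (λ { (inj₁ (inj₁ x)) → inj₂ (inj₁ x) ; (inj₁ (inj₂ x)) → inj₁ (inj₁ x)
             ; (inj₂ (i , f , e)) → place i f e (A i Bool.≟ b) }) )
        (deep-cut d {S = λ i → S i × A i ≡ b} {X = D}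
          (let (a , s , e) = half (not b) in shrink small proj₁ s λ (_ , e′) → Bool.not-¬ e′ e)
          (λ di → D⊆S di , D⊆b di) (λ i → S? i ×-dec (A i Bool.≟ b)) D?
          (λ di di′ ((s , _) , n) → module-κ di di′ (F-of s n))
          {Γ = Γ ∪ emb κ (λ i → S i × A i ≡ not b)} {Δ = Δ₁}
          (sep-∪ˡ (sep-⊆ʳ Δ₁⊆ ΓΔ) (Sep-sym (free Δ₁⊆ Δκ)))
          (sep-∪ˡ {Y = emb κ (λ i → S i × A i ≡ not b)} (free id Γκ) λ { (i , (si , ri) , refl) (j , (sj , rj) , refl) →
             (λ e → case inj e of λ { refl → Bool.not-¬ rj ri }) , trans (Esym _ _) (across′ b sj si rj ri) })
          (free Δ₁⊆ Δκ′) (free Δ₁⊆ Δκ)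
          (resp ( (λ { (inj₁ x) → inj₁ (inj₁ x) ; (inj₂ (i , s , e)) → case A i Bool.≟ b of λ
                       { (yes a) → inj₂ (i , (s , a) , e) ; (no n) → inj₁ (inj₂ (i , (s , Bool.¬-not n) , e)) } })
                , (λ { (inj₁ (inj₁ x)) → inj₁ x ; (inj₁ (inj₂ (i , (s , _) , e))) → inj₂ (i , s , e) ; (inj₂ (i , (s , _) , e)) → inj₂ (i , s , e) }) ) h)
          left)
        where
        place : ∀ i → F i → ∀ {v} → v ≡ κ i → Dec (A i ≡ b) →
          ((Γ ∪ emb κ (λ i → S i × A i ≡ not b)) ∪ (Δ₁ ∪ emb κ ((λ i → S i × A i ≡ b) ∖ D))) v
        place i f e (yes a) = inj₂ (inj₂ (i , ((F⊆S f , a) , λ di → disj di f) , e))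
        place i f e (no n) = inj₁ (inj₂ (i , (F⊆S f , Bool.¬-not n) , e))
      sides : Dec (∃ λ i → D i × A i ≡ true) → Dec (∃ λ i → D i × A i ≡ false) → ⊢ ((Δ₁ ∪ Γ) ∪ emb κ F)
      sides (no n) _ = one-side false λ di → ≢true⇒false λ a → n (_ , di , a)
      sides (yes _) (no n) = one-side true λ di → Bool.not-injective (≢true⇒false λ a → n (_ , di , Bool.not-injective a))
      sides (yes (a , da , ta)) (yes (b , db , fb)) = resp
        ( (λ { (inj₁ (inj₁ x)) → inj₁ (inj₂ x) ; (inj₁ (inj₂ x)) → inj₂ x ; (inj₂ x) → inj₁ (inj₁ x) })
        , (λ { (inj₁ (inj₁ x)) → inj₂ x ; (inj₁ (inj₂ x)) → inj₁ (inj₁ x) ; (inj₂ x) → inj₁ (inj₂ x) }) )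
        (cut d D smallD (Γ ∪ emb κ F) Δ₁
          (sep-∪ˡ (sep-⊆ʳ Δ₁⊆ ΓΔ) (Sep-sym (free Δ₁⊆ Δκ)))
          (sep-∪ˡ {Y = emb κ F} (free id Γκ) λ { (i , f , refl) (j , di , refl) →
             (λ e → case inj e of λ { refl → disj di f }) , trans (Esym _ _) (apart di f) })
          (free Δ₁⊆ Δκ′)
          (resp ( (λ { (inj₁ x) → inj₁ (inj₁ x) ; (inj₂ (i , s , e)) → case proj₁ S≐ s of λ
                       { (inj₁ di) → inj₂ (i , di , e) ; (inj₂ f) → inj₁ (inj₂ (i , f , e)) } })
                , (λ { (inj₁ (inj₁ x)) → inj₁ x ; (inj₁ (inj₂ (i , f , e))) → inj₂ (i , F⊆S f , e) ; (inj₂ (i , di , e)) → inj₂ (i , D⊆S di , e) }) ) h)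
          left)
        where
        -- The vertex `j` has no edge to the vertex of `D` in the opposite half, and sees all of the
        -- module `D` alike.
        apart : ∀ {i j} → D i → F j → E (κ i) (κ j) ≡ false
        apart {i} {j} di f with A j in e
        ... | true = trans (module-κ di db f) (across′ false (D⊆S db) (F⊆S f) fb e)
        ... | false = trans (module-κ di da f) (across′ true (D⊆S da) (F⊆S f) ta e)

    principal : PrincipalAt κ′ S Δ → ⊢ (Γ ∪ Δ)
    principal (atom i y S≐ _ _) = ⊥-elim (not-atom S≐)
    principal (plugged P) = plugged-cut P
    principal (primed P) = ⊥-elim (not-prime P)

  outside : ∀ {Γ X : V → Set} → Sep Γ X → Γ ≐ (Γ ∪ X) ∖ X
  outside s = (λ g → inj₁ g , λ x → proj₁ (s g x) refl) , λ { (inj₁ g , _) → g ; (inj₂ x , n) → ⊥-elim (n x) }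

  reduce-emb : ∀ {κ κ′} → Dual κ κ′ → ∀ {S} → Decidable S → Conn (emb κ′ S) → ∃ S → ∀ {Γ Δ} → Sep Γ Δ → Sep Δ (range κ′) →
    (∀ Δ′ → PrincipalAt κ′ S Δ′ → Δ′ ⊆ Δ → ⊢ (Γ ∪ Δ′)) → ⊢ (Δ ∪ emb κ′ S) → ⊢ (Γ ∪ Δ)
  reduce-emb {κ} {κ′} d {S} S? conn (i , s) {Γ} {Δ} ΓΔ Δκ′ main h = resp
    ( (λ { (inj₁ x) → inj₁ x ; (inj₂ x) → inj₂ (proj₂ o x) }) , (λ { (inj₁ x) → inj₁ x ; (inj₂ x) → inj₂ (proj₁ o x) }) )
    (reduce Γ Δ (emb κ′ S) (emb? S?) conn (κ′ i , i , s , refl) ΓΔ (Sep-sym (free id Δκ′))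
      (λ Δ′ P → main Δ′ (principal-at (Dual.inj′ d) P)) h inj₂ (proj₂ o))
    where
    o : Δ ≐ (Δ ∪ emb κ′ S) ∖ emb κ′ S
    o = outside (free id Δκ′)

  split-cut : ∀ {κ κ′} → Dual κ κ′ → ∀ {S} → Decidable S → S ≲ suc m → ∃ (Split κ S) → ∀ {Γ Δ} → Sep Γ Δ →
    Sep Γ (range κ) → Sep Δ (range κ) → Sep Δ (range κ′) → ⊢ (Γ ∪ emb κ S) → ⊢ (Δ ∪ emb κ′ S) → ⊢ (Γ ∪ Δ)
  split-cut d S? small (A , sp) ΓΔ Γκ Δκ Δκ′ h h′ =
    reduce-emb d S? (split-conn d sp) (let (i , s , _) = Split.some sp in i , s) ΓΔ Δκ′
      (λ Δ′ P sub → SplitCut.principal d S? small sp (sep-⊆ʳ sub ΓΔ) Γκ (sep-⊆ˡ sub Δκ) (sep-⊆ˡ sub Δκ′) h P) h′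

  free-cut : ∀ {κ κ′ μ μ′} → Copies κ κ′ μ μ′ → ∀ {S} → Decidable S → S ≲ suc m → ∀ {Γ Δ} → Sep Γ Δ →
    Free κ κ′ μ μ′ Γ → Free κ κ′ μ μ′ Δ → ⊢ (Γ ∪ emb κ S) → ⊢ (Δ ∪ emb κ′ S) → ⊢ (Γ ∪ Δ)
  free-cut {κ} {κ′} copies {S} S? small {Γ} {Δ} ΓΔ fΓ fΔ h h′ with Fin.any? S?
  ... | no none = Sep-mix ΓΔ
    (resp ((λ { (inj₁ x) → x ; (inj₂ (i , s , _)) → ⊥-elim (none (i , s)) }) , inj₁) h)
    (resp ((λ { (inj₁ x) → x ; (inj₂ (i , s , _)) → ⊥-elim (none (i , s)) }) , inj₁) h′)
  ... | yes some with split? κ S? | split? κ′ S?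
  ...   | yes sp | _ = split-cut κκ′ S? small sp ΓΔ (Free.fκ fΓ) (Free.fκ fΔ) (Free.fκ′ fΔ) h h′
    where open Copies copies
  ...   | no _ | yes sp = resp swap-∪ (split-cut (dual-swap κκ′) S? small sp (Sep-sym ΓΔ) (Free.fκ′ fΔ) (Free.fκ′ fΓ) (Free.fκ fΓ) h′ h)
    where open Copies copies
  -- The outer reduction reaches the places where `κ S` is principal; for each of them the inner one
  -- is run against the context found there.
  ...   | no n | no n′ = resp swap-∪ (reduce-emb (dual-swap κκ′) S? (unsplit-conn S? n) some (Sep-sym ΓΔ) (Free.fκ fΓ)
    (λ Γ′ P subΓ → resp swap-∪ (reduce-emb κκ′ S? (unsplit-conn S? n′) some (sep-⊆ˡ subΓ ΓΔ) (Free.fκ′ fΔ)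
      (λ Δ′ P′ subΔ → principal-cut copies small (sep-⊆ˡ subΓ (sep-⊆ʳ subΔ ΓΔ)) (free-⊆ subΓ fΓ) (free-⊆ subΔ fΔ) P P′) h′)) h)
    where open Copies copies

-- Fresh copies of the cut graph

module Freshen {V : Set} (_≟V_ : DecidableEquality V) (E : V → V → Bool) (Esym : ∀ x y → E x y ≡ E y x)
  (lab : V → Atom) {k : ℕ} {κ κ′ : Fin k → V} (d : Cuts.Dual _≟V_ E Esym lab k κ κ′) where
  module C = Cuts _≟V_ E Esym lab k
  open C.Dual d

  -- The first Boolean tells the cut graph from its dual, the second tells the copy used for the cut
  -- from the spare one. No copy is joined to another or to `V`, so the contexts are free of all
  -- four.
  V⁺ : Set
  V⁺ = V ⊎ ((Bool × Bool) × Fin k)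

  _≟⁺_ : DecidableEquality V⁺
  _≟⁺_ = Sum.≡-dec _≟V_ (Product.≡-dec (Product.≡-dec Bool._≟_ Bool._≟_) Fin._≟_)

  copyOf : Bool → Fin k → V
  copyOf true = κ
  copyOf false = κ′

  sameCopy : Bool × Bool → Bool × Bool → Bool
  sameCopy c c′ = does (Product.≡-dec Bool._≟_ Bool._≟_ c c′)

  E⁺ : V⁺ → V⁺ → Bool
  E⁺ (inj₁ x) (inj₁ y) = E x y
  E⁺ (inj₁ x) (inj₂ _) = false
  E⁺ (inj₂ _) (inj₁ y) = false
  E⁺ (inj₂ (c , i)) (inj₂ (c′ , j)) = sameCopy c c′ ∧ E (copyOf (proj₁ c) i) (copyOf (proj₁ c) j)

  lab⁺ : V⁺ → Atom
  lab⁺ (inj₁ x) = lab x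
  lab⁺ (inj₂ ((b , _) , i)) = lab (copyOf b i)

  E⁺sym : ∀ x y → E⁺ x y ≡ E⁺ y x
  E⁺sym (inj₁ x) (inj₁ y) = Esym x y
  E⁺sym (inj₁ x) (inj₂ y) = refl
  E⁺sym (inj₂ x) (inj₁ y) = refl
  E⁺sym (inj₂ (c , i)) (inj₂ (c′ , j)) with Product.≡-dec Bool._≟_ Bool._≟_ c c′ | Product.≡-dec Bool._≟_ Bool._≟_ c′ c
  ... | yes refl | yes _ = Esym _ _
  ... | yes refl | no n = ⊥-elim (n refl)
  ... | no n | yes refl = ⊥-elim (n refl)
  ... | no _ | no _ = refl

  module C⁺ = Cuts _≟⁺_ E⁺ E⁺sym lab⁺ k

  copy : Bool × Bool → Fin k → V⁺
  copy c i = inj₂ (c , i)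

  copy-inj : ∀ {c i j} → copy c i ≡ copy c j → i ≡ j
  copy-inj refl = refl

  copies-apart : ∀ {c c′} → c ≢ c′ → ∀ {i j} → copy c i ≢ copy c′ j × E⁺ (copy c i) (copy c′ j) ≡ false
  copies-apart {c} {c′} ne = (λ { refl → ne refl }) , cong (_∧ _) (dec-false (Product.≡-dec Bool._≟_ Bool._≟_ c c′) ne)

  copy-edge : ∀ c {i j} → E⁺ (copy c i) (copy c j) ≡ E (copyOf (proj₁ c) i) (copyOf (proj₁ c) j)
  copy-edge c {i} {j} = cong (_∧ E (copyOf (proj₁ c) i) (copyOf (proj₁ c) j)) (dec-true (Product.≡-dec Bool._≟_ Bool._≟_ c c) refl)

  dual⁺ : ∀ b b′ → C⁺.Dual (copy (true , b)) (copy (false , b′))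
  dual⁺ b b′ = record
    { inj = copy-inj ; inj′ = copy-inj
    ; apart = copies-apart λ ()
    ; flip = λ ne → trans (copy-edge (true , b)) (trans (flip ne) (cong not (sym (copy-edge (false , b′)))))
    ; labels = labels }

  fresh : (V → Set) → V⁺ → Set
  fresh X w = ∃ λ v → X v × w ≡ inj₁ v

  copyOf-inj : ∀ b {i j} → copyOf b i ≡ copyOf b j → i ≡ j
  copyOf-inj true = inj
  copyOf-inj false = inj′

  -- The cut vertices are separated from `X`, so they can be carried to a disjoint copy without
  -- changing the graph.
  to-fresh : ∀ b {X S} → C.Sep X (C.emb (copyOf b) S) → C.⊢ (X ∪ C.emb (copyOf b) S) → C⁺.⊢ (fresh X ∪ C⁺.emb (copy (b , true)) S)
  to-fresh b {X} {S} s h = C⁺.resp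
    ( (λ { (v , _ , inj₁ (x , refl)) → inj₁ (v , x , refl) ; (v , _ , inj₂ (i , si , _ , refl)) → inj₂ (i , si , refl) })
    , (λ { (inj₁ (v , x , refl)) → v , inj₁ x , inj₁ (x , refl)
         ; (inj₂ (i , si , refl)) → copyOf b i , inj₂ (i , si , refl) , inj₂ (i , si , refl , refl) }) )
    (Transfer.transfer E lab E⁺ lab⁺ R Rinj Rfun RE Rlab
      (λ { (inj₁ x) → _ , inj₁ (x , refl) ; (inj₂ (i , si , e)) → _ , inj₂ (i , si , e , refl) }) h)
    where
    R : V → V⁺ → Set
    R v w = (X v × w ≡ inj₁ v) ⊎ (∃ λ i → S i × v ≡ copyOf b i × w ≡ copy (b , true) i)
    Rinj : ∀ {v w w′} → R v w → R v w′ → w ≡ w′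
    Rinj (inj₁ (_ , refl)) (inj₁ (_ , refl)) = refl
    Rinj (inj₁ (x , refl)) (inj₂ (i , si , e , _)) = ⊥-elim (proj₁ (s x (i , si , e)) refl)
    Rinj (inj₂ (i , si , e , _)) (inj₁ (x , refl)) = ⊥-elim (proj₁ (s x (i , si , e)) refl)
    Rinj (inj₂ (i , _ , refl , refl)) (inj₂ (j , _ , e , refl)) = cong (copy (b , true)) (copyOf-inj b e)
    Rfun : ∀ {v v′ w} → R v w → R v′ w → v ≡ v′
    Rfun (inj₁ (_ , refl)) (inj₁ (_ , refl)) = refl
    Rfun (inj₁ (_ , refl)) (inj₂ (_ , _ , _ , ()))
    Rfun (inj₂ (_ , _ , _ , refl)) (inj₁ (_ , ()))
    Rfun (inj₂ (i , _ , refl , refl)) (inj₂ (.i , _ , refl , refl)) = refl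
    RE : ∀ {v v′ w w′} → R v w → R v′ w′ → E v v′ ≡ E⁺ w w′
    RE (inj₁ (_ , refl)) (inj₁ (_ , refl)) = refl
    RE (inj₁ (x , refl)) (inj₂ (i , si , e , refl)) = proj₂ (s x (i , si , e))
    RE (inj₂ (i , si , e , refl)) (inj₁ (x , refl)) = trans (Esym _ _) (proj₂ (s x (i , si , e)))
    RE (inj₂ (i , _ , refl , refl)) (inj₂ (j , _ , refl , refl)) = sym (copy-edge (b , true))
    Rlab : ∀ {v w} → R v w → lab v ≡ lab⁺ w
    Rlab (inj₁ (_ , refl)) = refl
    Rlab (inj₂ (i , _ , refl , refl)) = refl

  from-fresh : ∀ {X} → C⁺.⊢ (fresh X) → C.⊢ X
  from-fresh h = C.resp
    ( (λ { (_ , (v , x , refl) , refl) → x }) , (λ {v} x → inj₁ v , (v , x , refl) , refl) )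
    (Transfer.transfer E⁺ lab⁺ E lab (λ w v → w ≡ inj₁ v)
      (λ { refl refl → refl }) (λ { refl refl → refl }) (λ { refl refl → refl }) (λ { refl → refl })
      (λ { (v , _ , e) → v , e }) h)

  fresh-sep : ∀ {X Y} → C.Sep X Y → C⁺.Sep (fresh X) (fresh Y)
  fresh-sep s (v , x , refl) (w , y , refl) = (λ { refl → proj₁ (s x y) refl }) , proj₂ (s x y)

-- The hypotheses separate each context only from its own side of the cut; `free-cut` wants it
-- separated from both sides and their spare copies, which holds in the enlarged type.
cut-suc : ∀ m → CutAt m → CutAt (suc m)
cut-suc m ih {V} _≟V_ E Esym lab {k} {κ} {κ′} d S small Γ Δ ΓΔ Γκ Δκ′ h h′ = from-fresh
  (C⁺.resp ( (λ { (inj₁ (v , g , e)) → v , inj₁ g , e ; (inj₂ (v , g , e)) → v , inj₂ g , e })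
           , (λ { (v , inj₁ g , e) → inj₁ (v , g , e) ; (v , inj₂ g , e) → inj₂ (v , g , e) }) )
    (free-cut copies (Ambient.emb-dec (C.Dual.inj d) h Γκ) small (fresh-sep ΓΔ) free⁺ free⁺
      (to-fresh true Γκ h) (to-fresh false Δκ′ h′)))
  where
  open Freshen _≟V_ E Esym lab d
  open CutPrincipal m ih _≟⁺_ E⁺ E⁺sym lab⁺ k using (free-cut)
  module Ambient = CutStep m ih _≟V_ E Esym lab k
  open CutStep m ih _≟⁺_ E⁺ E⁺sym lab⁺ k using (Copies; Free; range)
  copies : Copies (copy (true , true)) (copy (false , true)) (copy (true , false)) (copy (false , false))
  copies = record
    { κκ′ = dual⁺ true true ; μκ′ = dual⁺ false true ; κμ′ = dual⁺ true false
    ; κμ = copies-apart λ () ; κ′μ′ = copies-apart λ ()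
    ; loop = λ i → trans (copy-edge (true , true)) (sym (copy-edge (true , false)))
    ; loop′ = λ i → trans (copy-edge (false , true)) (sym (copy-edge (false , false))) }
  away : ∀ {X c} → C⁺.Sep (fresh X) (range (copy c))
  away (_ , _ , refl) (_ , refl) = (λ ()) , refl
  free⁺ : ∀ {X} → Free (copy (true , true)) (copy (false , true)) (copy (true , false)) (copy (false , false)) (fresh X)
  free⁺ = record { fκ = away ; fκ′ = away ; fμ = away ; fμ′ = away }

cut-at : ∀ m → CutAt m
-- An empty cut graph leaves two separated proofs, to be joined by mix.
cut-at zero _≟V_ E Esym lab {k} d S (A , sub , c) Γ Δ ΓΔ Γκ Δκ′ h h′ = Sep-mix ΓΔ
  (resp ((λ { (inj₁ x) → x ; (inj₂ (i , s , _)) → ⊥-elim (card-empty {A = A} c (sub s)) }) , inj₁) h)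
  (resp ((λ { (inj₁ x) → x ; (inj₂ (i , s , _)) → ⊥-elim (card-empty {A = A} c (sub s)) }) , inj₁) h′)
  where open Cuts _≟V_ E Esym lab k
cut-at (suc m) = cut-suc m (cut-at m)

-- Vertices of juxtapositions and substitutions

data Side {m n : ℕ} : Fin (m + n) → Set where
  inl : (x : Fin m) → Side (x ↑ˡ n)
  inr : (y : Fin n) → Side (m ↑ʳ y)

side : ∀ m n (z : Fin (m + n)) → Side {m} {n} z
side zero n z = inr z
side (suc m) n zero = inl zero
side (suc m) n (suc z) with side m n z
... | inl x = inl (suc x)
... | inr y = inr y

↑ˡ≢↑ʳ : ∀ {m n} (x : Fin m) (y : Fin n) → x ↑ˡ n ≢ m ↑ʳ y
↑ˡ≢↑ʳ zero y ()
↑ˡ≢↑ʳ (suc x) y e = ↑ˡ≢↑ʳ x y (Fin.suc-injective e)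

does-injective : ∀ {m n} (f : Fin m → Fin n) → (∀ {x y} → f x ≡ f y → x ≡ y) → ∀ x y →
  does (f x Fin.≟ f y) ≡ does (x Fin.≟ y)
does-injective f inj x y with x Fin.≟ y
... | yes refl = dec-true (f x Fin.≟ f x) refl
... | no n = dec-false (f x Fin.≟ f y) (n ∘ inj)

-- `juxt` and `subst` use `adj` in their raw relations, so their adjacency symmetrises and removes
-- loops twice; this is the idempotence of that operation.
∨-not-idem : ∀ b c → not b ∧ (not b ∧ c ∨ not b ∧ c) ≡ not b ∧ c
∨-not-idem true c = refl
∨-not-idem false c = Bool.∨-idem c

module _ (G H : Graph) (r : Fin (size G) → Bool) where
  private
    m = size G
    n = size H

  juxt-ll : ∀ x y → adj (juxt G H r) (x ↑ˡ n) (y ↑ˡ n) ≡ adj G x y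
  juxt-ll x y rewrite Fin.splitAt-↑ˡ m x n | Fin.splitAt-↑ˡ m y n | does-injective (_↑ˡ n) (Fin.↑ˡ-injective n _ _) x y
    | adj-sym G y x = ∨-not-idem (does (x Fin.≟ y)) (raw G x y ∨ raw G y x)

  juxt-rr : ∀ x y → adj (juxt G H r) (m ↑ʳ x) (m ↑ʳ y) ≡ adj H x y
  juxt-rr x y rewrite Fin.splitAt-↑ʳ m n x | Fin.splitAt-↑ʳ m n y | does-injective (m ↑ʳ_) (Fin.↑ʳ-injective m _ _) x y
    | adj-sym H y x = ∨-not-idem (does (x Fin.≟ y)) (raw H x y ∨ raw H y x)

  juxt-lr : ∀ x y → adj (juxt G H r) (x ↑ˡ n) (m ↑ʳ y) ≡ r x
  juxt-lr x y rewrite Fin.splitAt-↑ˡ m x n | Fin.splitAt-↑ʳ m n y | dec-false (x ↑ˡ n Fin.≟ m ↑ʳ y) (↑ˡ≢↑ʳ x y) = Bool.∨-idem (r x)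

  juxt-rl : ∀ x y → adj (juxt G H r) (m ↑ʳ y) (x ↑ˡ n) ≡ r x
  juxt-rl x y = trans (adj-sym (juxt G H r) (m ↑ʳ y) (x ↑ˡ n)) (juxt-lr x y)

  juxt-label-l : ∀ x → label (juxt G H r) (x ↑ˡ n) ≡ label G x
  juxt-label-l x rewrite Fin.splitAt-↑ˡ m x n = refl

  juxt-label-r : ∀ y → label (juxt G H r) (m ↑ʳ y) ≡ label H y
  juxt-label-r y rewrite Fin.splitAt-↑ʳ m n y = refl

pair : ∀ {n} (k : Fin n → ℕ) (i : Fin n) → Fin (k i) → Fin (sumF n k)
pair {suc n} k zero a = a ↑ˡ sumF n (k ∘ suc)
pair {suc n} k (suc i) a = k zero ↑ʳ pair (k ∘ suc) i a

unpair-pair : ∀ {n} (k : Fin n → ℕ) i a → unpair n k (pair k i a) ≡ (i , a)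
unpair-pair {suc n} k zero a rewrite Fin.splitAt-↑ˡ (k zero) a (sumF n (k ∘ suc)) = refl
unpair-pair {suc n} k (suc i) a
  rewrite Fin.splitAt-↑ʳ (k zero) (sumF n (k ∘ suc)) (pair (k ∘ suc) i a) | unpair-pair (k ∘ suc) i a = refl

data Paired {n : ℕ} (k : Fin n → ℕ) : Fin (sumF n k) → Set where
  paired : ∀ i a → Paired k (pair k i a)

paired? : ∀ {n} (k : Fin n → ℕ) z → Paired k z
paired? {suc n} k z with side (k zero) (sumF n (k ∘ suc)) z
... | inl a = paired zero a
... | inr w with paired? (k ∘ suc) w
...   | paired i a = paired (suc i) a

module _ (P : Graph) (Hs : Fin (size P) → Graph) where
  private
    k : Fin (size P) → ℕ
    k = size ∘ Hs

  pair-inj : ∀ {i j a b} → pair k i a ≡ pair k j b → (i , a) ≡ (j , b)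
  pair-inj {i} {j} {a} {b} e = trans (sym (unpair-pair k i a)) (trans (cong (unpair (size P) k) e) (unpair-pair k j b))

  pair-inj₂ : ∀ {i a b} → pair k i a ≡ pair k i b → a ≡ b
  pair-inj₂ e with pair-inj e
  ... | refl = refl

  pair-inj₁ : ∀ {i j a b} → pair k i a ≡ pair k j b → i ≡ j
  pair-inj₁ e with pair-inj e
  ... | refl = refl

  substAdj-same : ∀ i a b → substAdj P Hs i i a b ≡ adj (Hs i) a b
  substAdj-same i a b with i Fin.≟ i
  ... | yes refl = refl
  ... | no n = ⊥-elim (n refl)

  substAdj-diff : ∀ {i j} → i ≢ j → ∀ a b → substAdj P Hs i j a b ≡ adj P i j
  substAdj-diff {i} {j} ne a b with i Fin.≟ j
  ... | yes e = ⊥-elim (ne e)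
  ... | no n = cong (λ b → not b ∧ (raw P i j ∨ raw P j i)) (dec-false (i Fin.≟ j) n)

  raw-subst : ∀ i j a b → raw (subst P Hs) (pair k i a) (pair k j b) ≡ substAdj P Hs i j a b
  raw-subst i j a b = cong₂ (λ u v → substAdj P Hs (proj₁ u) (proj₁ v) (proj₂ u) (proj₂ v)) (unpair-pair k i a) (unpair-pair k j b)

  subst-same : ∀ i a b → adj (subst P Hs) (pair k i a) (pair k i b) ≡ adj (Hs i) a b
  subst-same i a b rewrite raw-subst i i a b | raw-subst i i b a | substAdj-same i a b | substAdj-same i b a
    | does-injective (pair k i) pair-inj₂ a b | adj-sym (Hs i) b a =
    ∨-not-idem (does (a Fin.≟ b)) (raw (Hs i) a b ∨ raw (Hs i) b a)

  subst-diff : ∀ {i j} → i ≢ j → ∀ a b → adj (subst P Hs) (pair k i a) (pair k j b) ≡ adj P i j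
  subst-diff {i} {j} ne a b rewrite raw-subst i j a b | raw-subst j i b a | substAdj-diff ne a b | substAdj-diff (ne ∘ sym) b a
    | dec-false (pair k i a Fin.≟ pair k j b) (ne ∘ pair-inj₁) | adj-sym P j i = Bool.∨-idem (adj P i j)

  subst-label : ∀ i a → label (subst P Hs) (pair k i a) ≡ label (Hs i) a
  subst-label i a = cong (λ u → label (Hs (proj₁ u)) (proj₂ u)) (unpair-pair k i a)

complete-adj : ∀ {n} {i j : Fin n} → i ≢ j → adj (complete n) i j ≡ true
complete-adj {n} {i} {j} ne = cong (λ b → not b ∧ true) (dec-false (i Fin.≟ j) ne)

-- Soundness

module Push {V V′ : Set} {E : V → V → Bool} {lab : V → Atom} {E′ : V′ → V′ → Bool} {lab′ : V′ → Atom}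
  (f : V → V′) (inj : ∀ {x y} → f x ≡ f y → x ≡ y) (fE : ∀ x y → E x y ≡ E′ (f x) (f y))
  (flab : ∀ x → lab x ≡ lab′ (f x)) where

  push : ∀ {U} → Calculus.⊢ E lab U → Calculus.⊢ E′ lab′ (λ w → ∃ λ v → U v × w ≡ f v)
  push h = Transfer.transfer E lab E′ lab′ (λ v w → w ≡ f v)
    (λ { refl refl → refl }) (λ { refl e → inj e }) (λ { refl refl → fE _ _ }) (λ { refl → flab _ }) (λ {x} _ → f x , refl) h

  pull : ∀ {U} → Calculus.⊢ E′ lab′ (λ w → ∃ λ v → U v × w ≡ f v) → Calculus.⊢ E lab U
  pull {U} h = Calculus.resp E lab
    ( (λ { (_ , (v , u , refl) , e) → ≡-subst U (inj e) u }) , (λ {v} u → f v , (v , u , refl) , refl) )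
    (Transfer.transfer E′ lab′ E lab (λ w v → w ≡ f v)
      (λ { refl e → inj e }) (λ { refl refl → refl }) (λ { refl refl → sym (fE _ _) }) (λ { refl → sym (flab _) })
      (λ { (v , _ , e) → v , e }) h)

Full : ∀ {V : Set} → V → Set
Full _ = ⊤

Provable : Graph → Set₁
Provable G = Calculus.⊢ (adj G) (label G) Full

-- The disjoint union of the dual of `X` with `Y`, kept on a sum type so that cases are decided by
-- constructors instead of `splitAt`.
entail-edge : (X Y : Graph) → Fin (size X) ⊎ Fin (size Y) → Fin (size X) ⊎ Fin (size Y) → Bool
entail-edge X Y (inj₁ x) (inj₁ x′) = adj (compl X) x x′
entail-edge X Y (inj₂ y) (inj₂ y′) = adj Y y y′
entail-edge X Y _ _ = false

entail-label : (X Y : Graph) → Fin (size X) ⊎ Fin (size Y) → Atom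
entail-label X Y = [ dualA ∘ label X , label Y ]

Entails : Graph → Graph → Set₁
Entails X Y = Calculus.⊢ (entail-edge X Y) (entail-label X Y) Full

_≟⊎_ : ∀ {m n} → DecidableEquality (Fin m ⊎ Fin n)
_≟⊎_ = Sum.≡-dec Fin._≟_ Fin._≟_

entail-sym : ∀ X Y x y → entail-edge X Y x y ≡ entail-edge X Y y x
entail-sym X Y (inj₁ x) (inj₁ y) = adj-sym (compl X) x y
entail-sym X Y (inj₁ x) (inj₂ y) = refl
entail-sym X Y (inj₂ x) (inj₁ y) = refl
entail-sym X Y (inj₂ x) (inj₂ y) = adj-sym Y x y

compl-flip : ∀ G {x y} → x ≢ y → adj G x y ≡ not (adj (compl G) x y)
compl-flip G ne = trans (sym (Bool.not-involutive _)) (cong not (sym (adj-compl G ne)))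

adj-compl-cong : ∀ G H {x y : Fin (size G)} {x′ y′ : Fin (size H)} → (x′ ≡ y′ → x ≡ y) → (x ≡ y → x′ ≡ y′) →
  adj G x y ≡ adj H x′ y′ → adj (compl G) x y ≡ adj (compl H) x′ y′
adj-compl-cong G H {x} {y} {x′} {y′} f g e = cases (x Fin.≟ y)
  where
  cases : Dec (x ≡ y) → adj (compl G) x y ≡ adj (compl H) x′ y′
  cases (yes refl) with g refl
  ... | refl = trans (adj-irrefl (compl G) x) (sym (adj-irrefl (compl H) x′))
  cases (no ne) = trans (adj-compl G ne) (trans (cong not e) (sym (adj-compl H (ne ∘ f))))

entails-refl : ∀ X → Entails X X
entails-refl X = resp ((λ _ → tt) , (λ { {inj₁ x} _ → inj₂ (x , tt , refl) ; {inj₂ x} _ → inj₁ (x , tt , refl) }))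
  (identity {κ = inj₂} {κ′ = inj₁} d (λ _ → yes tt))
  where
  open Cuts _≟⊎_ (entail-edge X X) (entail-sym X X) (entail-label X X) (size X)
  -- The module is opened for `identity` alone, with the base case as its induction hypothesis.
  open CutStep 0 (cut-at 0) _≟⊎_ (entail-edge X X) (entail-sym X X) (entail-label X X) (size X) using (identity)
  d : Dual inj₂ inj₁
  d = record
    { inj = λ { refl → refl } ; inj′ = λ { refl → refl } ; apart = (λ ()) , refl
    ; flip = compl-flip X ; labels = λ _ → refl }

-- The cut is on all of `X`, in a vertex type holding `X`, its dual and `Y` side by side. The left
-- context is empty and the right one is `Y`.
entails-cut : ∀ {X Y} → Provable X → Entails X Y → Provable Y
entails-cut {X} {Y} h h′ = Push.pull (inj₂ ∘ inj₂) (λ { refl → refl }) (λ _ _ → refl) (λ _ → refl)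
  (resp ( (λ { (inj₁ ()) ; (inj₂ x) → x }) , inj₂ )
    (cut-at (size X) _≟V_ E Esym lab {κ = inj₁} {κ′ = inj₂ ∘ inj₁} d Full ((λ _ → true) , (λ _ → refl) , card≤)
      (λ _ → ⊥) (λ w → ∃ λ y → ⊤ × w ≡ inj₂ (inj₂ y)) (λ ()) (λ ()) (λ { (y , _ , refl) (x , _ , refl) → (λ ()) , refl })
      (resp ( (λ { (x , _ , e) → inj₂ (x , tt , e) }) , (λ { (inj₁ ()) ; (inj₂ (x , _ , e)) → x , tt , e }) )
        (Push.push inj₁ (λ { refl → refl }) (λ _ _ → refl) (λ _ → refl) h))
      (resp ( (λ { (inj₁ x , _ , e) → inj₂ (x , tt , e) ; (inj₂ y , _ , e) → inj₁ (y , tt , e) })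
            , (λ { (inj₂ (x , _ , e)) → inj₁ x , tt , e ; (inj₁ (y , _ , e)) → inj₂ y , tt , e }) )
        (Push.push inj₂ (λ { refl → refl }) (λ _ _ → refl) (λ _ → refl) h′))))
  where
  V : Set
  V = Fin (size X) ⊎ (Fin (size X) ⊎ Fin (size Y))
  _≟V_ : DecidableEquality V
  _≟V_ = Sum.≡-dec Fin._≟_ _≟⊎_
  E : V → V → Bool
  E (inj₁ x) (inj₁ x′) = adj X x x′
  E (inj₂ y) (inj₂ y′) = entail-edge X Y y y′
  E _ _ = false
  lab : V → Atom
  lab = [ label X , entail-label X Y ]
  Esym : ∀ x y → E x y ≡ E y x
  Esym (inj₁ x) (inj₁ y) = adj-sym X x y
  Esym (inj₁ x) (inj₂ y) = refl
  Esym (inj₂ x) (inj₁ y) = refl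
  Esym (inj₂ x) (inj₂ y) = entail-sym X Y x y
  open Cuts _≟V_ E Esym lab (size X)
  d : Dual inj₁ (inj₂ ∘ inj₁)
  d = record
    { inj = λ { refl → refl } ; inj′ = λ { refl → refl } ; apart = (λ ()) , refl
    ; flip = compl-flip X ; labels = λ _ → refl }
  card≤ : ∀ {n} → card {n} (λ _ → true) ≤ n
  card≤ {zero} = z≤n
  card≤ {suc n} = s≤s card≤

compl-ll : ∀ G H r x y → adj (compl (juxt G H r)) (x ↑ˡ size H) (y ↑ˡ size H) ≡ adj (compl G) x y
compl-ll G H r x y = adj-compl-cong (juxt G H r) G (cong (_↑ˡ size H)) (Fin.↑ˡ-injective _ _ _) (juxt-ll G H r x y)

compl-rr : ∀ G H r x y → adj (compl (juxt G H r)) (size G ↑ʳ x) (size G ↑ʳ y) ≡ adj (compl H) x y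
compl-rr G H r x y = adj-compl-cong (juxt G H r) H (cong (size G ↑ʳ_)) (Fin.↑ʳ-injective _ _ _) (juxt-rr G H r x y)

compl-lr : ∀ G H r x y → adj (compl (juxt G H r)) (x ↑ˡ size H) (size G ↑ʳ y) ≡ not (r x)
compl-lr G H r x y = trans (adj-compl (juxt G H r) (↑ˡ≢↑ʳ x y)) (cong not (juxt-lr G H r x y))

compl-rl : ∀ G H r x y → adj (compl (juxt G H r)) (size G ↑ʳ y) (x ↑ˡ size H) ≡ not (r x)
compl-rl G H r x y = trans (adj-sym (compl (juxt G H r)) (size G ↑ʳ y) (x ↑ˡ size H)) (compl-lr G H r x y)

module _ (B A : Graph) (r s : Fin (size B) → Bool) where
  private
    X Y : Graph
    X = juxt B A r
    Y = juxt B A s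
    b = size B
    a = size A
  open Calculus (entail-edge X Y) (entail-label X Y)

  left-part right-part : Fin (size X) ⊎ Fin (size Y) → Set
  left-part v = (∃ λ x → v ≡ inj₁ (x ↑ˡ a)) ⊎ (∃ λ x → v ≡ inj₂ (x ↑ˡ a))
  right-part v = (∃ λ y → v ≡ inj₁ (b ↑ʳ y)) ⊎ (∃ λ y → v ≡ inj₂ (b ↑ʳ y))

  parts : ∀ v → left-part v ⊎ right-part v
  parts (inj₁ z) with side b a z
  ... | inl x = inj₁ (inj₁ (x , refl))
  ... | inr y = inj₂ (inj₁ (y , refl))
  parts (inj₂ z) with side b a z
  ... | inl x = inj₁ (inj₂ (x , refl))
  ... | inr y = inj₂ (inj₂ (y , refl))

  left-provable : ⊢ left-part
  left-provable = resp
    ( (λ { (inj₁ x , _ , e) → inj₁ (x , e) ; (inj₂ x , _ , e) → inj₂ (x , e) })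
    , (λ { (inj₁ (x , e)) → inj₁ x , tt , e ; (inj₂ (x , e)) → inj₂ x , tt , e }) )
    (Push.push f inj (λ { (inj₁ x) (inj₁ y) → sym (compl-ll B A r x y) ; (inj₁ x) (inj₂ y) → refl
                        ; (inj₂ x) (inj₁ y) → refl ; (inj₂ x) (inj₂ y) → sym (juxt-ll B A s x y) })
      (λ { (inj₁ x) → cong dualA (sym (juxt-label-l B A r x)) ; (inj₂ x) → sym (juxt-label-l B A s x) }) (entails-refl B))
    where
    f : Fin b ⊎ Fin b → Fin (size X) ⊎ Fin (size Y)
    f = [ (λ x → inj₁ (x ↑ˡ a)) , (λ x → inj₂ (x ↑ˡ a)) ]
    inj : ∀ {x y} → f x ≡ f y → x ≡ y
    inj {inj₁ x} {inj₁ y} e = cong inj₁ (Fin.↑ˡ-injective a _ _ (Sum.inj₁-injective e))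
    inj {inj₂ x} {inj₂ y} e = cong inj₂ (Fin.↑ˡ-injective a _ _ (Sum.inj₂-injective e))

  right-provable : ⊢ right-part
  right-provable = resp
    ( (λ { (inj₁ x , _ , e) → inj₁ (x , e) ; (inj₂ x , _ , e) → inj₂ (x , e) })
    , (λ { (inj₁ (x , e)) → inj₁ x , tt , e ; (inj₂ (x , e)) → inj₂ x , tt , e }) )
    (Push.push f inj (λ { (inj₁ x) (inj₁ y) → sym (compl-rr B A r x y) ; (inj₁ x) (inj₂ y) → refl
                        ; (inj₂ x) (inj₁ y) → refl ; (inj₂ x) (inj₂ y) → sym (juxt-rr B A s x y) })
      (λ { (inj₁ x) → cong dualA (sym (juxt-label-r B A r x)) ; (inj₂ x) → sym (juxt-label-r B A s x) }) (entails-refl A))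
    where
    f : Fin a ⊎ Fin a → Fin (size X) ⊎ Fin (size Y)
    f = [ (λ x → inj₁ (b ↑ʳ x)) , (λ x → inj₂ (b ↑ʳ x)) ]
    inj : ∀ {x y} → f x ≡ f y → x ≡ y
    inj {inj₁ x} {inj₁ y} e = cong inj₁ (Fin.↑ʳ-injective b _ _ (Sum.inj₁-injective e))
    inj {inj₂ x} {inj₂ y} e = cong inj₂ (Fin.↑ʳ-injective b _ _ (Sum.inj₂-injective e))

  private
    ll≢rr : ∀ {x y} → inj₁ (x ↑ˡ a) ≢ inj₁ {B = Fin (size Y)} (b ↑ʳ y)
    ll≢rr e = ↑ˡ≢↑ʳ _ _ (Sum.inj₁-injective e)
    ll≢rr′ : ∀ {x y} → inj₂ (x ↑ˡ a) ≢ inj₂ {A = Fin (size X)} (b ↑ʳ y)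
    ll≢rr′ e = ↑ˡ≢↑ʳ _ _ (Sum.inj₂-injective e)

  -- The copy of `A` in `Y` has no edges to `B`, and the dual copy is a module, so they serve as `G`
  -- and `D` of a plugging of the identity on `A` into the identity on `B`.
  entails-weaken : (∀ x → s x ≡ false) → Entails X Y
  entails-weaken no-s = plg (λ v → ∃ λ y → v ≡ inj₂ (b ↑ʳ y)) (λ v → ∃ λ y → v ≡ inj₁ (b ↑ʳ y)) left-part
    ( (λ {v} _ → case parts v of λ { (inj₁ l) → inj₂ l ; (inj₂ (inj₁ x)) → inj₁ (inj₂ x) ; (inj₂ (inj₂ x)) → inj₁ (inj₁ x) })
    , (λ _ → tt) )
    (λ { (_ , refl) (_ , refl) → (λ ()) , refl })
    (λ { (_ , refl) (inj₁ (_ , refl)) → (λ ()) , refl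
       ; (y , refl) (inj₂ (x , refl)) → (ll≢rr′ ∘ sym) , trans (juxt-rl B A s x y) (no-s x) })
    (λ { (_ , refl) (inj₁ (_ , refl)) e → ll≢rr (sym e) ; (_ , refl) (inj₂ (_ , refl)) () })
    (λ { (y , refl) (y′ , refl) (inj₁ (x , refl)) → trans (compl-rl B A r x y) (sym (compl-rl B A r x y′))
       ; (y , refl) (y′ , refl) (inj₂ (_ , refl)) → refl })
    (resp ([ inj₂ , inj₁ ] , [ inj₂ , inj₁ ]) right-provable) left-provable

  -- Complementation removes all edges between `B` and `A` from the dual of `X`, so now the dual
  -- copy of `A` is the part `G` and the copy in `Y` is the module `D`.
  entails-strengthen : (∀ x → r x ≡ true) → Entails X Y
  entails-strengthen all-r = plg (λ v → ∃ λ y → v ≡ inj₁ (b ↑ʳ y)) (λ v → ∃ λ y → v ≡ inj₂ (b ↑ʳ y)) left-part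
    ( (λ {v} _ → case parts v of λ { (inj₁ l) → inj₂ l ; (inj₂ x) → inj₁ x })
    , (λ _ → tt) )
    (λ { (_ , refl) (_ , refl) → (λ ()) , refl })
    (λ { (_ , refl) (inj₂ (_ , refl)) → (λ ()) , refl
       ; (y , refl) (inj₁ (x , refl)) → (ll≢rr ∘ sym) , trans (compl-rl B A r x y) (cong not (all-r x)) })
    (λ { (_ , refl) (inj₂ (_ , refl)) e → ll≢rr′ (sym e) ; (_ , refl) (inj₁ (_ , refl)) () })
    (λ { (y , refl) (y′ , refl) (inj₂ (x , refl)) → trans (juxt-rl B A s x y) (sym (juxt-rl B A s x y′))
       ; (y , refl) (y′ , refl) (inj₁ (_ , refl)) → refl })
    right-provable left-provable

entails-ai : ∀ a → Entails emptyG (single (dualA a) ⊔ single a)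
entails-ai a = ax (inj₂ zero) (inj₂ (suc zero)) tt tt
  (λ { {inj₂ zero} _ → inj₁ refl ; {inj₂ (suc zero)} _ → inj₂ refl }) refl refl
  where open Calculus (entail-edge emptyG (single (dualA a) ⊔ single a)) (entail-label emptyG (single (dualA a) ⊔ single a))

module Context (C : Graph) (R : Fin (size C) → Bool) where
  private
    c = size C

  -- A plugging is a substitution into `C` with one more vertex: `zero` stands for the hole and is
  -- joined to `R`, as in `edge`.
  colour : ∀ n → Fin (c + n) → Fin (suc c)
  colour n z = [ suc , (λ _ → zero) ] (splitAt c z)

  colour-l : ∀ n i → colour n (i ↑ˡ n) ≡ suc i
  colour-l n i rewrite Fin.splitAt-↑ˡ c i n = refl

  colour-r : ∀ n y → colour n (c ↑ʳ y) ≡ zero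
  colour-r n y rewrite Fin.splitAt-↑ʳ c n y = refl

  edge : Fin (suc c) → Fin (suc c) → Bool
  edge zero zero = false
  edge zero (suc j) = R j
  edge (suc i) zero = R i
  edge (suc i) (suc j) = adj C i j

  edge-sym : ∀ i j → edge i j ≡ edge j i
  edge-sym zero zero = refl
  edge-sym zero (suc j) = refl
  edge-sym (suc i) zero = refl
  edge-sym (suc i) (suc j) = adj-sym C i j

  plug-edge : ∀ X {z w} → colour (size X) z ≢ colour (size X) w →
    adj (plug C R X) z w ≡ edge (colour (size X) z) (colour (size X) w)
  plug-edge X {z} {w} ne with side c (size X) z | side c (size X) w
  ... | inl i | inl j rewrite colour-l (size X) i | colour-l (size X) j = juxt-ll C X R i j
  ... | inl i | inr y rewrite colour-l (size X) i | colour-r (size X) y = juxt-lr C X R i y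
  ... | inr y | inl i rewrite colour-l (size X) i | colour-r (size X) y = juxt-rl C X R i y
  ... | inr y | inr y′ = ⊥-elim (ne (trans (colour-r (size X) y) (sym (colour-r (size X) y′))))

  -- The block of the hole is the given proof, and the block of a vertex of `C` is an axiom between
  -- its two copies. The dual of C[X] has role N and C[Y] has role M.
  entails-context : ∀ {X Y} → Entails X Y → Entails (plug C R X) (plug C R Y)
  entails-context {X} {Y} h = resp ((λ _ → tt) , (λ {v} _ → hue v , role v , refl , refl))
    (substituted edge edge-sym F L block)
    where
    open Substitution _≟⊎_ (entail-edge (plug C R X) (plug C R Y)) (entail-sym (plug C R X) (plug C R Y)) (entail-label (plug C R X) (plug C R Y))
    V : Set
    V = Fin (c + size X) ⊎ Fin (c + size Y)
    hue : V → Fin (suc c)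
    hue = [ colour (size X) , colour (size Y) ]
    role : V → Role
    role = [ (λ _ → N) , (λ _ → M) ]
    F : Fin (suc c) → Role → V → Set
    F i ρ v = hue v ≡ i × role v ≡ ρ
    L : Layout edge F
    L = record
      { unique = λ { (refl , refl) (refl , refl) → refl , refl }
      ; same = λ { {x = inj₁ _} {inj₁ _} (refl , refl) (_ , refl) ne → ⊥-elim (ne refl)
                 ; {x = inj₁ _} {inj₂ _} _ _ _ → refl
                 ; {x = inj₂ _} {inj₁ _} _ _ _ → refl
                 ; {x = inj₂ _} {inj₂ _} (refl , refl) (_ , refl) ne → ⊥-elim (ne refl) }
      ; diff = λ { {x = inj₁ z} {inj₁ w} ne (refl , refl) (refl , refl) →
                     trans (adj-compl (plug C R X) {z} {w} (λ { refl → ne refl })) (cong not (plug-edge X ne))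
                 ; {x = inj₁ _} {inj₂ _} _ (_ , refl) (_ , refl) → refl
                 ; {x = inj₂ _} {inj₁ _} _ (_ , refl) (_ , refl) → refl
                 ; {x = inj₂ _} {inj₂ _} ne (refl , refl) (refl , refl) → plug-edge Y ne } }
    into : Fin (size X) ⊎ Fin (size Y) → V
    into = [ (λ x → inj₁ (c ↑ʳ x)) , (λ y → inj₂ (c ↑ʳ y)) ]
    into-inj : ∀ {x y} → into x ≡ into y → x ≡ y
    into-inj {inj₁ x} {inj₁ y} e = cong inj₁ (Fin.↑ʳ-injective c _ _ (Sum.inj₁-injective e))
    into-inj {inj₂ x} {inj₂ y} e = cong inj₂ (Fin.↑ʳ-injective c _ _ (Sum.inj₂-injective e))
    in-hole : ∀ {v} → hue v ≡ zero → ∃ λ x → ⊤ × v ≡ into x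
    in-hole {inj₁ z} e with side c (size X) z
    ... | inl i = ⊥-elim (case trans (sym (colour-l (size X) i)) e of λ ())
    ... | inr x = inj₁ x , tt , refl
    in-hole {inj₂ z} e with side c (size Y) z
    ... | inl i = ⊥-elim (case trans (sym (colour-l (size Y) i)) e of λ ())
    ... | inr y = inj₂ y , tt , refl
    at : ∀ {i v} → hue v ≡ suc i → v ≡ inj₁ (i ↑ˡ size X) ⊎ v ≡ inj₂ (i ↑ˡ size Y)
    at {i} {inj₁ z} e with side c (size X) z
    ... | inl j = inj₁ (cong (λ k → inj₁ (k ↑ˡ size X)) (Fin.suc-injective (trans (sym (colour-l (size X) j)) e)))
    ... | inr x = ⊥-elim (case trans (sym (colour-r (size X) x)) e of λ ())
    at {i} {inj₂ z} e with side c (size Y) z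
    ... | inl j = inj₂ (cong (λ k → inj₂ (k ↑ˡ size Y)) (Fin.suc-injective (trans (sym (colour-l (size Y) j)) e)))
    ... | inr x = ⊥-elim (case trans (sym (colour-r (size Y) x)) e of λ ())
    block : ∀ i → ⊢ (λ v → ∃ λ ρ → F i ρ v)
    block zero = resp
      ( (λ { (inj₁ x , _ , refl) → N , colour-r (size X) x , refl ; (inj₂ y , _ , refl) → M , colour-r (size Y) y , refl })
      , (λ (ρ , e , _) → in-hole e) )
      (Push.push into into-inj
        (λ { (inj₁ x) (inj₁ y) → sym (compl-rr C X R x y) ; (inj₁ x) (inj₂ y) → refl
           ; (inj₂ x) (inj₁ y) → refl ; (inj₂ x) (inj₂ y) → sym (juxt-rr C Y R x y) })
        (λ { (inj₁ x) → cong dualA (sym (juxt-label-r C X R x)) ; (inj₂ y) → sym (juxt-label-r C Y R y) }) h)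
    block (suc i) = ax (inj₁ (i ↑ˡ size X)) (inj₂ (i ↑ˡ size Y))
      (N , colour-l (size X) i , refl) (M , colour-l (size Y) i , refl) (λ (_ , e , _) → at e) refl
      (cong dualA (trans (juxt-label-l C X R i) (sym (juxt-label-l C Y R i))))

module PRule (P : Graph) (Ms Ns : Fin (size P) → Graph) where
  private
    n = size P
    Ts : Fin n → Graph
    Ts i = Ms i ⊔ Ns i
    kM kN kT : Fin n → ℕ
    kM = size ∘ Ms
    kN = size ∘ Ns
    kT = size ∘ Ts
    GM GN X Y : Graph
    GM = subst (compl P) Ms
    GN = subst P Ns
    X = bigTensor n Ts
    Y = GM ⊔ GN
    none : Fin (size GM) → Bool
    none _ = false
  open Substitution _≟⊎_ (entail-edge X Y) (entail-sym X Y) (entail-label X Y)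

  -- The dual of a tensor is a disjoint union, so the dual of the premise of the rule has no edges
  -- between different indices and can be given role O.
  data Spot : Fin (size X) ⊎ Fin (size Y) → Fin n → Role → Set where
    dualM : ∀ i a → Spot (inj₁ (pair kT i (a ↑ˡ kN i))) i O
    dualN : ∀ i b → Spot (inj₁ (pair kT i (kM i ↑ʳ b))) i O
    inM   : ∀ i a → Spot (inj₂ (pair kM i a ↑ˡ size GN)) i M
    inN   : ∀ i b → Spot (inj₂ (size GM ↑ʳ pair kN i b)) i N

  hue : Fin (size X) ⊎ Fin (size Y) → Fin n × Role
  hue (inj₁ z) = proj₁ (unpair n kT z) , O
  hue (inj₂ z) = [ (λ w → proj₁ (unpair n kM w) , M) , (λ w → proj₁ (unpair n kN w) , N) ] (splitAt (size GM) z)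

  hue-spot : ∀ {v i ρ} → Spot v i ρ → hue v ≡ (i , ρ)
  hue-spot (dualM i a) = cong (λ u → proj₁ u , O) (unpair-pair kT i (a ↑ˡ kN i))
  hue-spot (dualN i b) = cong (λ u → proj₁ u , O) (unpair-pair kT i (kM i ↑ʳ b))
  hue-spot (inM i a) rewrite Fin.splitAt-↑ˡ (size GM) (pair kM i a) (size GN) = cong (λ u → proj₁ u , M) (unpair-pair kM i a)
  hue-spot (inN i b) rewrite Fin.splitAt-↑ʳ (size GM) (size GN) (pair kN i b) = cong (λ u → proj₁ u , N) (unpair-pair kN i b)

  spot : ∀ v → ∃₂ λ i ρ → Spot v i ρ
  spot (inj₁ z) with paired? kT z
  ... | paired i t with side (kM i) (kN i) t
  ...   | inl a = i , O , dualM i a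
  ...   | inr b = i , O , dualN i b
  spot (inj₂ z) with side (size GM) (size GN) z
  ... | inl w with paired? kM w
  ...   | paired i a = i , M , inM i a
  spot (inj₂ z) | inr w with paired? kN w
  ...   | paired i b = i , N , inN i b

  dual-diff : ∀ {i j} → i ≢ j → ∀ s t → adj (compl X) (pair kT i s) (pair kT j t) ≡ false
  dual-diff ne s t = trans (adj-compl X (ne ∘ pair-inj₁ (complete n) Ts))
    (cong not (trans (subst-diff (complete n) Ts ne s t) (complete-adj ne)))

  dual-same : ∀ i s t → adj (compl X) (pair kT i s) (pair kT i t) ≡ adj (compl (Ts i)) s t
  dual-same i s t = adj-compl-cong X (Ts i) (cong (pair kT i)) (pair-inj₂ (complete n) Ts) (subst-same (complete n) Ts i s t)

  layout : Layout (adj (compl P)) (λ i ρ v → Spot v i ρ)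
  layout = record
    { unique = λ u w → let e = trans (sym (hue-spot u)) (hue-spot w) in cong proj₁ e , cong proj₂ e
    ; same = same
    ; diff = diff }
    where
    same : ∀ {i ρ σ x y} → Spot x i ρ → Spot y i σ → ρ ≢ σ → entail-edge X Y x y ≡ false
    same (dualM i a) (dualM .i _) ne = ⊥-elim (ne refl)
    same (dualM i a) (dualN .i _) ne = ⊥-elim (ne refl)
    same (dualM i a) (inM .i _) ne = refl
    same (dualM i a) (inN .i _) ne = refl
    same (dualN i a) (dualM .i _) ne = ⊥-elim (ne refl)
    same (dualN i a) (dualN .i _) ne = ⊥-elim (ne refl)
    same (dualN i a) (inM .i _) ne = refl
    same (dualN i a) (inN .i _) ne = refl
    same (inM i a) (dualM .i _) ne = refl
    same (inM i a) (dualN .i _) ne = refl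
    same (inM i a) (inM .i _) ne = ⊥-elim (ne refl)
    same (inM i a) (inN .i b) ne = juxt-lr GM GN none (pair kM i a) (pair kN i b)
    same (inN i b) (dualM .i _) ne = refl
    same (inN i b) (dualN .i _) ne = refl
    same (inN i b) (inM .i a) ne = juxt-rl GM GN none (pair kM i a) (pair kN i b)
    same (inN i b) (inN .i _) ne = ⊥-elim (ne refl)
    diff : ∀ {i j ρ σ x y} → i ≢ j → Spot x i ρ → Spot y j σ → entail-edge X Y x y ≡ roleEdge ρ σ (adj (compl P) i j)
    diff ne (dualM i a) (dualM j _) = dual-diff ne _ _
    diff ne (dualM i a) (dualN j _) = dual-diff ne _ _
    diff ne (dualM i a) (inM j _) = refl
    diff ne (dualM i a) (inN j _) = refl
    diff ne (dualN i a) (dualM j _) = dual-diff ne _ _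
    diff ne (dualN i a) (dualN j _) = dual-diff ne _ _
    diff ne (dualN i a) (inM j _) = refl
    diff ne (dualN i a) (inN j _) = refl
    diff ne (inM i a) (dualM j _) = refl
    diff ne (inM i a) (dualN j _) = refl
    diff ne (inM i a) (inM j b) = trans (juxt-ll GM GN none (pair kM i a) (pair kM j b)) (subst-diff (compl P) Ms ne a b)
    diff ne (inM i a) (inN j b) = juxt-lr GM GN none (pair kM i a) (pair kN j b)
    diff ne (inN i b) (dualM j _) = refl
    diff ne (inN i b) (dualN j _) = refl
    diff ne (inN i b) (inM j a) = juxt-rl GM GN none (pair kM j a) (pair kN i b)
    diff ne (inN i a) (inN j b) = trans (juxt-rr GM GN none (pair kN i a) (pair kN j b))
      (trans (subst-diff P Ns ne a b) (compl-flip P ne))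

  embM : ∀ i → Fin (kM i) ⊎ Fin (kM i) → Fin (size X) ⊎ Fin (size Y)
  embM i = [ (λ a → inj₁ (pair kT i (a ↑ˡ kN i))) , (λ a → inj₂ (pair kM i a ↑ˡ size GN)) ]

  embN : ∀ i → Fin (kN i) ⊎ Fin (kN i) → Fin (size X) ⊎ Fin (size Y)
  embN i = [ (λ b → inj₁ (pair kT i (kM i ↑ʳ b))) , (λ b → inj₂ (size GM ↑ʳ pair kN i b)) ]

  provableM : ∀ i → ⊢ (λ w → ∃ λ v → Full v × w ≡ embM i v)
  provableM i = Push.push (embM i) inj
    (λ { (inj₁ a) (inj₁ b) → sym (trans (dual-same i (a ↑ˡ kN i) (b ↑ˡ kN i)) (compl-ll (Ms i) (Ns i) _ a b))
       ; (inj₁ _) (inj₂ _) → refl ; (inj₂ _) (inj₁ _) → refl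
       ; (inj₂ a) (inj₂ b) → sym (trans (juxt-ll GM GN none (pair kM i a) (pair kM i b)) (subst-same (compl P) Ms i a b)) })
    (λ { (inj₁ a) → cong dualA (sym (trans (subst-label (complete n) Ts i (a ↑ˡ kN i)) (juxt-label-l (Ms i) (Ns i) (λ _ → false) a)))
       ; (inj₂ a) → sym (trans (juxt-label-l GM GN none (pair kM i a)) (subst-label (compl P) Ms i a)) })
    (entails-refl (Ms i))
    where
    inj : ∀ {x y} → embM i x ≡ embM i y → x ≡ y
    inj {inj₁ x} {inj₁ y} e = cong inj₁ (Fin.↑ˡ-injective (kN i) _ _ (pair-inj₂ (complete n) Ts (Sum.inj₁-injective e)))
    inj {inj₂ x} {inj₂ y} e = cong inj₂ (pair-inj₂ (compl P) Ms (Fin.↑ˡ-injective (size GN) _ _ (Sum.inj₂-injective e)))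

  provableN : ∀ i → ⊢ (λ w → ∃ λ v → Full v × w ≡ embN i v)
  provableN i = Push.push (embN i) inj
    (λ { (inj₁ a) (inj₁ b) → sym (trans (dual-same i (kM i ↑ʳ a) (kM i ↑ʳ b)) (compl-rr (Ms i) (Ns i) _ a b))
       ; (inj₁ _) (inj₂ _) → refl ; (inj₂ _) (inj₁ _) → refl
       ; (inj₂ a) (inj₂ b) → sym (trans (juxt-rr GM GN none (pair kN i a) (pair kN i b)) (subst-same P Ns i a b)) })
    (λ { (inj₁ a) → cong dualA (sym (trans (subst-label (complete n) Ts i (kM i ↑ʳ a)) (juxt-label-r (Ms i) (Ns i) (λ _ → false) a)))
       ; (inj₂ a) → sym (trans (juxt-label-r GM GN none (pair kN i a)) (subst-label P Ns i a)) })
    (entails-refl (Ns i))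
    where
    inj : ∀ {x y} → embN i x ≡ embN i y → x ≡ y
    inj {inj₁ x} {inj₁ y} e = cong inj₁ (Fin.↑ʳ-injective (kM i) _ _ (pair-inj₂ (complete n) Ts (Sum.inj₁-injective e)))
    inj {inj₂ x} {inj₂ y} e = cong inj₂ (pair-inj₂ P Ns (Fin.↑ʳ-injective (size GM) _ _ (Sum.inj₂-injective e)))

  -- In this premise the duals of `Ms i` and `Ns i` are fully joined, so the identity on `Ms i`,
  -- with its dual copy as the module, is plugged into the identity on `Ns i`.
  block : ∀ i → ⊢ (λ v → ∃ λ ρ → Spot v i ρ)
  block i = plg (λ v → ∃ λ a → v ≡ embM i (inj₂ a)) (λ v → ∃ λ a → v ≡ embM i (inj₁ a)) (λ w → ∃ λ v → Full v × w ≡ embN i v)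
    ( (λ { (_ , dualM .i a) → inj₁ (inj₂ (a , refl)) ; (_ , dualN .i b) → inj₂ (inj₁ b , tt , refl)
         ; (_ , inM .i a) → inj₁ (inj₁ (a , refl)) ; (_ , inN .i b) → inj₂ (inj₂ b , tt , refl) })
    , (λ { (inj₁ (inj₁ (a , refl))) → M , inM i a ; (inj₁ (inj₂ (a , refl))) → O , dualM i a
         ; (inj₂ (inj₁ b , _ , refl)) → O , dualN i b ; (inj₂ (inj₂ b , _ , refl)) → N , inN i b }) )
    (λ { (_ , refl) (_ , refl) → (λ ()) , refl })
    (λ { (_ , refl) (inj₁ _ , _ , refl) → (λ ()) , refl
       ; (a , refl) (inj₂ b , _ , refl) → (λ e → ↑ˡ≢↑ʳ _ _ (Sum.inj₂-injective e)) , juxt-lr GM GN none (pair kM i a) (pair kN i b) })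
    (λ { (a , refl) (inj₁ b , _ , refl) e → ↑ˡ≢↑ʳ a b (pair-inj₂ (complete n) Ts (Sum.inj₁-injective e)) ; (_ , refl) (inj₂ _ , _ , refl) () })
    (λ { (a , refl) (a′ , refl) (inj₁ b , _ , refl) →
           trans (dual-same i (a ↑ˡ kN i) (kM i ↑ʳ b)) (trans (compl-lr (Ms i) (Ns i) _ a b)
             (sym (trans (dual-same i (a′ ↑ˡ kN i) (kM i ↑ʳ b)) (compl-lr (Ms i) (Ns i) _ a′ b))))
       ; (_ , refl) (_ , refl) (inj₂ _ , _ , refl) → refl })
    (resp ( (λ { (inj₁ a , _ , e) → inj₂ (a , e) ; (inj₂ a , _ , e) → inj₁ (a , e) })
          , (λ { (inj₁ (a , e)) → inj₂ a , tt , e ; (inj₂ (a , e)) → inj₁ a , tt , e }) ) (provableM i))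
    (provableN i)

  entails-p : Entails X Y
  entails-p = resp ((λ _ → tt) , (λ {v} _ → spot v)) (substituted (adj (compl P)) (adj-sym (compl P)) (λ i ρ v → Spot v i ρ) layout block)

provable-≅ : ∀ {G H} → G ≅ H → Provable G → Provable H
provable-≅ {G} {H} g h = Calculus.resp (adj H) (label H)
  ( (λ _ → tt) , (λ {w} _ → Inverse.from bij w , tt , sym (Inverse.strictlyInverseˡ bij w)) )
  (Push.push (Inverse.to bij) (λ {x} {y} e → trans (sym (Inverse.strictlyInverseʳ bij x)) (trans (cong (Inverse.from bij) e) (Inverse.strictlyInverseʳ bij y)))
    (λ x y → sym (edge x y)) (λ x → sym (lab x)) h)
  where open _≅_ g

≅-sym : ∀ {G H} → G ≅ H → H ≅ G
≅-sym {G} {H} g = record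
  { bij = Inverses.↔-sym bij
  ; lab = λ y → trans (sym (lab (from y))) (cong (label H) (strictlyInverseˡ y))
  ; edge = λ x y → trans (sym (edge (from x) (from y))) (cong₂ (adj H) (strictlyInverseˡ x) (strictlyInverseˡ y)) }
  where
  open _≅_ g
  open Inverse bij using (from; strictlyInverseˡ)

rule-entails : ∀ {X Y} → GSssUp X Y → Entails X Y
rule-entails (r-ai (ai a)) = entails-ai a
rule-entails (r-ss (ss B A S _ _)) = entails-weaken B A S (λ _ → false) (λ _ → refl)
rule-entails (r-p (p P Ms Ns _ _ _)) = PRule.entails-p P Ms Ns
rule-entails (r-ssu (ss B A S _ _)) = entails-strengthen B A (λ _ → true) S (λ _ → refl)

sound : ∀ {G H} → Derivation GSssUp G H → Provable G → Provable H
sound (done G) h = h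
sound (step (iso g) d) h = sound d (provable-≅ g h)
sound (step (rule C R X Y r g g′) d) h =
  sound d (provable-≅ (≅-sym g′) (entails-cut (provable-≅ g h) (Context.entails-context C R (rule-entails r))))

-- Prime induced subgraphs and connectors

-- The colour classes are modules of `Q`, so each of them is a single vertex or all of `Q`.
prime-blocks : ∀ {Q} → Prime Q → {I : Set} → DecidableEquality I → (c : Fin (size Q) → I) →
  (∀ {v x y} → c v ≢ c x → c x ≡ c y → adj Q v x ≡ adj Q v y) →
  (∀ x y → c x ≡ c y) ⊎ (∀ x y → c x ≡ c y → x ≡ y)
prime-blocks {Q} (_ , triv) _≟I_ c md with Fin.all? (λ x → Fin.all? λ y → c x ≟I c y)
... | yes all = inj₁ all
... | no not-all = inj₂ λ x y e → at x y e (triv (class x) (class-module x))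
  where
  class : Fin (size Q) → Fin (size Q) → Bool
  class x y = does (c y ≟I c x)
  class-module : ∀ x → IsModule Q (class x)
  class-module x v y z nv cy cz =
    md (λ e → does-false (c v ≟I c x) nv (trans e (does-true (c y ≟I c x) cy)))
       (trans (does-true (c y ≟I c x) cy) (sym (does-true (c z ≟I c x) cz)))
  at : ∀ x y → c x ≡ c y → _ → x ≡ y
  at x y e (inj₁ em) = ⊥-elim (true≢false (dec-true (c x ≟I c x) refl) (em x))
  at x y e (inj₂ (inj₁ (z , sg))) = trans (proj₁ (sg x) (dec-true (c x ≟I c x) refl)) (sym (proj₁ (sg y) (dec-true (c y ≟I c x) (sym e))))
  at x y e (inj₂ (inj₂ full)) = ⊥-elim (not-all λ u v →
    trans (does-true (c u ≟I c x) (full u)) (sym (does-true (c v ≟I c x) (full v))))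

adj-off-diagonal : ∀ G H (f : Fin (size G) → Fin (size H)) → (∀ {x y} → x ≢ y → adj H (f x) (f y) ≡ adj G x y) →
  ∀ x y → adj H (f x) (f y) ≡ adj G x y
adj-off-diagonal G H f h x y = cases (x Fin.≟ y)
  where
  cases : Dec (x ≡ y) → adj H (f x) (f y) ≡ adj G x y
  cases (yes refl) = trans (adj-irrefl H (f x)) (sym (adj-irrefl G x))
  cases (no ne) = h ne

fin-nonempty : ∀ {n} → Fin n → 1 ≤ n
fin-nonempty {suc n} _ = s≤s z≤n

two-distinct : ∀ {n} {i j : Fin n} → i ≢ j → 2 ≤ n
two-distinct {suc (suc n)} _ = s≤s (s≤s z≤n)
two-distinct {1} {zero} {zero} ne = ⊥-elim (ne refl)

two-vertices : ∀ {n} → 2 ≤ n → Σ (Fin n) λ x → ∃ λ y → x ≢ y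
two-vertices (s≤s (s≤s _)) = zero , suc zero , λ ()

induced-trans : ∀ {P Q R} → InducedSub P Q → InducedSub Q R → InducedSub P R
induced-trans (f , fi , fe) (g , gi , ge) = g ∘ f , (λ e → fi (gi e)) , λ x y → trans (ge (f x) (f y)) (fe x y)

≅-induced : ∀ {G H} → G ≅ H → InducedSub G H
≅-induced g = Inverse.to bij
  , (λ {x} {y} e → trans (sym (Inverse.strictlyInverseʳ bij x)) (trans (cong (Inverse.from bij) e) (Inverse.strictlyInverseʳ bij y)))
  , edge
  where open _≅_ g

-- Speaking of induced primes instead of connectors gives a property that passes to induced
-- subgraphs and along isomorphisms without any reference to decompositions.
Good : Graph → Graph → Set
Good Z H = ∀ Q → Prime Q → InducedSub Q H → InducedSub Q Z

good-⊆ : ∀ {Z G H} → InducedSub G H → Good Z H → Good Z G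
good-⊆ {G = G} {H} i g Q pr j = g Q pr (induced-trans {Q} {G} {H} j i)

good-≅ : ∀ {Z G H} → G ≅ H → Good Z G → Good Z H
good-≅ {Z} {G} {H} g = good-⊆ {Z} {H} {G} (≅-induced (≅-sym g))

good-induced : ∀ {Z H} → InducedSub H Z → Good Z H
good-induced {Z} {H} i Q pr j = induced-trans {Q} {H} {Z} j i

-- A prime graph whose edges all have the same value b has only two vertices.
good-constant : ∀ {Z Q} → Prime Q → ∀ b → (∀ {x y} → x ≢ y → adj Q x y ≡ b) →
  (u v : Fin (size Z)) → u ≢ v → adj Z u v ≡ b → InducedSub Q Z
good-constant {Z} {Q} pr b h u v ne e with prime-size {Q} pr
... | inj₂ big = ⊥-elim (no-uniform-vertex {Q} pr (3≤⇐4≤ big) (proj₁ (two-vertices (proj₁ pr)))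
                  λ nx ny → trans (h (nx ∘ sym)) (sym (h (ny ∘ sym))))
good-constant {Z} {mkGraph 2 l r} pr b h u v ne e | inj₁ refl = f , inj , ed
  where
  f : Fin 2 → Fin (size Z)
  f zero = u
  f (suc zero) = v
  inj : ∀ {x y} → f x ≡ f y → x ≡ y
  inj {zero} {zero} _ = refl
  inj {zero} {suc zero} q = ⊥-elim (ne q)
  inj {suc zero} {zero} q = ⊥-elim (ne (sym q))
  inj {suc zero} {suc zero} _ = refl
  ed : ∀ x y → adj Z (f x) (f y) ≡ adj (mkGraph 2 l r) x y
  ed zero zero = adj-irrefl Z u
  ed zero (suc zero) = trans e (sym (h {zero} {suc zero} λ ()))
  ed (suc zero) zero = trans (adj-sym Z v u) (trans e (sym (h {suc zero} {zero} λ ())))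
  ed (suc zero) (suc zero) = adj-irrefl Z v

factor : ∀ {Q G H} (f : InducedSub Q H) (h : Fin (size G) → Fin (size H)) → (∀ x y → adj H (h x) (h y) ≡ adj G x y) →
  (∀ x → ∃ λ y → h y ≡ proj₁ f x) → InducedSub Q G
factor {Q} {G} {H} (f , fi , fe) h he pre = (λ x → proj₁ (pre x))
  , (λ {x} {y} e → fi (trans (sym (proj₂ (pre x))) (trans (cong h e) (proj₂ (pre y)))))
  , λ x y → trans (sym (he _ _)) (trans (cong₂ (adj H) (proj₂ (pre x)) (proj₂ (pre y))) (fe x y))

module _ {Z : Graph} where
  good-blocks : ∀ {H} {I : Set} → DecidableEquality I → (c : Fin (size H) → I) → (e : I → I → Bool) →
    (∀ {x y} → c x ≢ c y → adj H x y ≡ e (c x) (c y)) →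
    ∀ Q → Prime Q → (f : InducedSub Q H) →
    ((∀ x y → c (proj₁ f x) ≡ c (proj₁ f y)) → InducedSub Q Z) →
    ((∀ x y → c (proj₁ f x) ≡ c (proj₁ f y) → x ≡ y) → InducedSub Q Z) → InducedSub Q Z
  good-blocks {H} _≟I_ c e ce Q pr (f , fi , fe) one many
    with prime-blocks {Q} pr _≟I_ (c ∘ f) (λ {v} {x} {y} ne eq →
           trans (sym (fe v x)) (trans (ce ne) (trans (cong (e (c (f v))) eq) (trans (sym (ce (λ q → ne (trans q (sym eq))))) (fe v y)))))
  ... | inj₁ a = one a
  ... | inj₂ b = many b

  private
    side-of : ∀ m n → Fin (m + n) → Bool
    side-of m n z = [ (λ _ → true) , (λ _ → false) ] (splitAt m z)

    side-of-l : ∀ m n x → side-of m n (x ↑ˡ n) ≡ true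
    side-of-l m n x rewrite Fin.splitAt-↑ˡ m x n = refl

    side-of-r : ∀ m n y → side-of m n (m ↑ʳ y) ≡ false
    side-of-r m n y rewrite Fin.splitAt-↑ʳ m n y = refl

    from-l : ∀ {m n z} → side-of m n z ≡ true → ∃ λ x → x ↑ˡ n ≡ z
    from-l {m} {n} {z} e with side m n z
    ... | inl x = x , refl
    ... | inr y = ⊥-elim (true≢false e (side-of-r m n y))

    from-r : ∀ {m n z} → side-of m n z ≡ false → ∃ λ y → m ↑ʳ y ≡ z
    from-r {m} {n} {z} e with side m n z
    ... | inl x = ⊥-elim (true≢false (side-of-l m n x) e)
    ... | inr y = y , refl

  -- A prime meeting both sides has one vertex on each, so all its pairs have value `b`; then `u`
  -- and `v` are a copy of it in `Z`.
  good-join : ∀ {G H} b (u v : Fin (size Z)) → u ≢ v → adj Z u v ≡ b → Good Z G → Good Z H → Good Z (juxt G H (λ _ → b))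
  good-join {G} {H} b u v ne e gG gH Q pr f@(f₀ , fi , fe) =
    good-blocks {juxt G H (λ _ → b)} Bool._≟_ (side-of (size G) (size H)) (λ _ _ → b) cross Q pr f one many
    where
    cross : ∀ {x y} → side-of (size G) (size H) x ≢ side-of (size G) (size H) y → adj (juxt G H (λ _ → b)) x y ≡ b
    cross {x} {y} n with side (size G) (size H) x | side (size G) (size H) y
    ... | inl i | inl j = ⊥-elim (n (trans (side-of-l (size G) (size H) i) (sym (side-of-l (size G) (size H) j))))
    ... | inl i | inr j = juxt-lr G H (λ _ → b) i j
    ... | inr i | inl j = juxt-rl G H (λ _ → b) j i
    ... | inr i | inr j = ⊥-elim (n (trans (side-of-r (size G) (size H) i) (sym (side-of-r (size G) (size H) j))))
    one : (∀ x y → side-of (size G) (size H) (f₀ x) ≡ side-of (size G) (size H) (f₀ y)) → InducedSub Q Z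
    one same with side-of (size G) (size H) (f₀ (proj₁ (two-vertices (proj₁ pr)))) in eq
    ... | true = gG Q pr (factor {Q} {G} {juxt G H (λ _ → b)} f (_↑ˡ size H) (juxt-ll G H (λ _ → b)) λ x → from-l (trans (same x _) eq))
    ... | false = gH Q pr (factor {Q} {H} {juxt G H (λ _ → b)} f (size G ↑ʳ_) (juxt-rr G H (λ _ → b)) λ x → from-r (trans (same x _) eq))
    many : (∀ x y → side-of (size G) (size H) (f₀ x) ≡ side-of (size G) (size H) (f₀ y) → x ≡ y) → InducedSub Q Z
    many inj = good-constant {Z} {Q} pr b (λ {x} {y} n → trans (sym (fe x y)) (cross λ q → n (inj x y q))) u v ne e

  -- A prime not contained in the hole uses at most one vertex of it, and any vertex of `A` can
  -- stand for that one.
  good-plug : ∀ C R A H → Good Z (plug C R A) → 1 ≤ size A → Good Z H → Good Z (plug C R H)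
  good-plug C R A H gA (s≤s {n = n} _) gH Q pr f@(f₀ , fi , fe) =
    good-blocks {plug C R H} Fin._≟_ col edge (plug-edge H) Q pr f one many
    where
    open Context C R
    col : Fin (size (plug C R H)) → Fin (suc (size C))
    col = colour (size H)
    a₀ : Fin (suc n)
    a₀ = zero
    h : Fin (suc (size C)) → Fin (size C + suc n)
    h zero = size C ↑ʳ a₀
    h (suc i) = i ↑ˡ suc n
    col-h : ∀ i → colour (suc n) (h i) ≡ i
    col-h zero = colour-r (suc n) a₀
    col-h (suc i) = colour-l (suc n) i
    one : (∀ x y → col (f₀ x) ≡ col (f₀ y)) → InducedSub Q Z
    one same with two-vertices (proj₁ pr)
    ... | x , y , x≢y with col (f₀ x) in eq
    ...   | zero = gH Q pr (factor {Q} {H} {plug C R H} f (size C ↑ʳ_) (juxt-rr C H R) λ z → hole (trans (same z x) eq))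
      where
      hole : ∀ {z} → col z ≡ zero → ∃ λ w → size C ↑ʳ w ≡ z
      hole {z} e with side (size C) (size H) z
      ... | inl i = case trans (sym e) (colour-l (size H) i) of λ ()
      ... | inr w = w , refl
    ...   | suc i = ⊥-elim (x≢y (fi (trans (spot eq) (sym (spot (trans (same y x) eq))))))
      where
      spot : ∀ {z} → col z ≡ suc i → z ≡ i ↑ˡ size H
      spot {z} e with side (size C) (size H) z
      ... | inl j = cong (_↑ˡ size H) (Fin.suc-injective (trans (sym (colour-l (size H) j)) e))
      ... | inr w = case trans (sym e) (colour-r (size H) w) of λ ()
    many : (∀ x y → col (f₀ x) ≡ col (f₀ y) → x ≡ y) → InducedSub Q Z
    many inj = gA Q pr (h ∘ col ∘ f₀
      , (λ {x} {y} e → inj x y (trans (sym (col-h (col (f₀ x)))) (trans (cong (colour (suc n)) e) (col-h (col (f₀ y))))))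
      , edges)
      where
      edges : ∀ x y → adj (plug C R A) (h (col (f₀ x))) (h (col (f₀ y))) ≡ adj Q x y
      edges = adj-off-diagonal Q (plug C R A) _ λ {x} {y} ne → let ne′ = λ q → ne (inj x y q) in
        trans (plug-edge A (λ q → ne′ (trans (sym (col-h (col (f₀ x)))) (trans q (col-h (col (f₀ y)))))))
          (trans (cong₂ edge (col-h (col (f₀ x))) (col-h (col (f₀ y)))) (trans (sym (plug-edge H ne′)) (fe x y)))

mkIso : ∀ {G H} (f : Fin (size G) → Fin (size H)) → (∀ {x y} → f x ≡ f y → x ≡ y) → (∀ y → ∃ λ x → f x ≡ y) →
  (∀ x y → adj H (f x) (f y) ≡ adj G x y) → (∀ x → label H (f x) ≡ label G x) → G ≅ H
mkIso f inj onto e l = record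
  { bij = mk↔ₛ′ f (λ y → proj₁ (onto y)) (λ y → proj₂ (onto y)) (λ x → inj (proj₂ (onto (f x)))) ; lab = l ; edge = e }

subst-rep : ∀ P (Hs : Fin (size P) → Graph) → (∀ i → NonEmpty (Hs i)) → InducedSub P (subst P Hs)
subst-rep P Hs ne = (λ i → pair (size ∘ Hs) i (elem i)) , pair-inj₁ P Hs , edges
  where
  first : ∀ {n} → 1 ≤ n → Fin n
  first (s≤s _) = zero
  elem : ∀ i → Fin (size (Hs i))
  elem i = first (ne i)
  edges : ∀ i j → adj (subst P Hs) (pair (size ∘ Hs) i (elem i)) (pair (size ∘ Hs) j (elem j)) ≡ adj P i j
  edges = adj-off-diagonal P (subst P Hs) _ λ {i} {j} n → subst-diff P Hs n (elem i) (elem j)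

block-index : ∀ P (Hs : Fin (size P) → Graph) → Fin (size (subst P Hs)) → Fin (size P)
block-index P Hs z = proj₁ (unpair (size P) (size ∘ Hs) z)

block-index-pair : ∀ P Hs i a → block-index P Hs (pair (size ∘ Hs) i a) ≡ i
block-index-pair P Hs i a = cong proj₁ (unpair-pair (size ∘ Hs) i a)

block-index-edge : ∀ P Hs {z w} → block-index P Hs z ≢ block-index P Hs w →
  adj (subst P Hs) z w ≡ adj P (block-index P Hs z) (block-index P Hs w)
block-index-edge P Hs {z} {w} ne with paired? (size ∘ Hs) z | paired? (size ∘ Hs) w
... | paired i a | paired j b = trans
  (subst-diff P Hs (λ e → ne (trans (block-index-pair P Hs i a) (trans e (sym (block-index-pair P Hs j b))))) a b)
  (sym (cong₂ (adj P) (block-index-pair P Hs i a) (block-index-pair P Hs j b)))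

subst-block : ∀ P (Hs : Fin (size P) → Graph) i → InducedSub (Hs i) (subst P Hs)
subst-block P Hs i = pair (size ∘ Hs) i , pair-inj₂ P Hs , subst-same P Hs i

-- Taking one vertex out of each nonempty block finds the quotient inside the graph.
connector-prime : ∀ {P H} → Connector P H → Prime P × InducedSub P H
connector-prime {P} {H} (here Q As (ne , (sz , triv) , _) g PQ) =
  (Nat.≤-trans sz (Fin.injective⇒≤ {f = from} from-inj) , trivial)
  , induced-trans {P} {Q} {H} (to , to-inj , edge)
      (induced-trans {Q} {subst Q As} {H} (subst-rep Q As ne) (≅-induced (≅-sym g)))
  where
  open _≃_ PQ
  open Inverse bij using (to; from; strictlyInverseˡ; strictlyInverseʳ)
  to-inj : ∀ {x y} → to x ≡ to y → x ≡ y
  to-inj {x} {y} e = trans (sym (strictlyInverseʳ x)) (trans (cong from e) (strictlyInverseʳ y))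
  from-inj : ∀ {x y} → from x ≡ from y → x ≡ y
  from-inj {x} {y} e = trans (sym (strictlyInverseˡ x)) (trans (cong to e) (strictlyInverseˡ y))
  trivial : ∀ X → IsModule P X → IsEmptySet X ⊎ IsSingleton X ⊎ IsFull X
  trivial X md with triv (X ∘ from) (λ v x y nv mx my →
    trans (edge′ v x) (trans (md (from v) (from x) (from y) nv mx my) (sym (edge′ v y))))
    where
    edge′ : ∀ x y → adj Q x y ≡ adj P (from x) (from y)
    edge′ x y = trans (sym (cong₂ (adj Q) (strictlyInverseˡ x) (strictlyInverseˡ y))) (edge (from x) (from y))
  ... | inj₁ em = inj₁ λ x → trans (sym (cong X (strictlyInverseʳ x))) (em (to x))
  ... | inj₂ (inj₂ fl) = inj₂ (inj₂ λ x → trans (sym (cong X (strictlyInverseʳ x))) (fl (to x)))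
  ... | inj₂ (inj₁ (z , sg)) = inj₂ (inj₁ (from z , λ y →
    (λ t → trans (sym (strictlyInverseʳ y)) (cong from (proj₁ (sg (to y)) (trans (cong X (strictlyInverseʳ y)) t))))
    , λ { refl → proj₂ (sg z) refl }))
connector-prime {P} {H} (below Q As nd g i c) = let (pr , j) = connector-prime c in
  pr , induced-trans {P} {As i} {H} j (induced-trans {As i} {subst Q As} {H} (subst-block Q As i) (≅-induced (≅-sym g)))

-- Existence of decompositions and the connectors they yield

restrict : ∀ G → (Fin (size G) → Bool) → Graph
restrict G A = mkGraph count (label G ∘ at) (λ x y → adj G (at x) (at y))
  where open Enumeration (enumerate A)

restrict-adj : ∀ G A x y → adj (restrict G A) x y ≡ adj G (Enumeration.at (enumerate A) x) (Enumeration.at (enumerate A) y)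
restrict-adj G A x y = sym (adj-off-diagonal (restrict G A) G at (λ {x} {y} ne → sym (
    trans (cong (λ b → not b ∧ (adj G (at x) (at y) ∨ adj G (at y) (at x))) (dec-false (x Fin.≟ y) ne))
      (trans (cong (adj G (at x) (at y) ∨_) (adj-sym G (at y) (at x))) (Bool.∨-idem _)))) x y)
  where open Enumeration (enumerate A)

Decomposed : Graph → Set
Decomposed G = Σ Graph λ Q → Σ (Fin (size Q) → Graph) λ As → DecompNode Q As × G ≅ subst Q As

-- J is a set of representatives of a partition of G into modules and c the map to
-- representatives; while the quotient has a nontrivial module, its blocks are merged.
module _ (G : Graph) where
  private
    n : ℕ
    n = size G

  quotient-decomposed : (J : Fin n → Bool) → ¬ ∃ (NontrivialModule (adj G) J) → (c : Fin n → Fin n) →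
    (∀ x → J (c x) ≡ true) → (∀ {j} → J j ≡ true → c j ≡ j) →
    (∀ {x y} → c x ≢ c y → adj G x y ≡ adj G (c x) (c y)) →
    (∃₂ λ i j → J i ≡ true × J j ≡ true × i ≢ j) → Decomposed G
  quotient-decomposed J no-module c cJ cid md (i₁ , i₂ , j₁ , j₂ , ne₁₂) =
    Q , As , (nonempty , Q-prime , prime-size {Q} Q-prime) , ≅-sym (mkIso f inj onto edges labels)
    where
    open Enumeration (enumerate J)
    Q : Graph
    Q = induced (adj G) J
    two : 2 ≤ count
    two = let (a , ea) = at-onto j₁ ; (b , eb) = at-onto j₂ in two-distinct {i = a} {b} λ e → ne₁₂ (trans (sym ea) (trans (cong at e) eb))
    Q-prime : Prime Q
    Q-prime = induced-prime (adj-sym G) J no-module two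
    class : Fin count → Fin n → Bool
    class i x = does (c x Fin.≟ at i)
    As : Fin count → Graph
    As i = restrict G (class i)
    module En i = Enumeration (enumerate (class i))
    k : Fin count → ℕ
    k = size ∘ As
    nonempty : ∀ i → NonEmpty (As i)
    nonempty i with En.at-onto i {at i} (dec-true (c (at i) Fin.≟ at i) (cid (at-in i)))
    ... | a , _ = fin-nonempty a
    g : Σ (Fin count) (λ i → Fin (k i)) → Fin n
    g (i , a) = En.at i a
    f : Fin (size (subst Q As)) → Fin n
    f z = g (unpair count k z)
    f-pair : ∀ i a → f (pair k i a) ≡ En.at i a
    f-pair i a = cong g (unpair-pair k i a)
    class-of : ∀ i a → c (En.at i a) ≡ at i
    class-of i a = does-true (c (En.at i a) Fin.≟ at i) (En.at-in i a)
    at-class : ∀ {i j a b} → En.at i a ≡ En.at j b → i ≡ j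
    at-class {i} {j} {a} {b} e = at-inj (trans (sym (class-of i a)) (trans (cong c e) (class-of j b)))
    inj : ∀ {x y} → f x ≡ f y → x ≡ y
    inj {x} {y} e with paired? k x | paired? k y
    ... | paired i a | paired j b with at-class {i} {j} {a} {b} (trans (sym (f-pair i a)) (trans e (f-pair j b)))
    ...   | refl = cong (pair k i) (En.at-inj i (trans (sym (f-pair i a)) (trans e (f-pair i b))))
    onto : ∀ y → ∃ λ x → f x ≡ y
    onto y with at-onto (cJ y)
    ... | i , e with En.at-onto i {y} (dec-true (c y Fin.≟ at i) (sym e))
    ...   | a , e′ = pair k i a , trans (f-pair i a) e′
    edges : ∀ x y → adj G (f x) (f y) ≡ adj (subst Q As) x y
    edges x y with paired? k x | paired? k y
    ... | paired i a | paired j b rewrite f-pair i a | f-pair j b = pairs i j a b (i Fin.≟ j)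
      where
      pairs : ∀ i j a b → Dec (i ≡ j) → adj G (En.at i a) (En.at j b) ≡ adj (subst Q As) (pair k i a) (pair k j b)
      pairs i .i a b (yes refl) = sym (trans (subst-same Q As i a b) (restrict-adj G (class i) a b))
      pairs i j a b (no ne) = trans (md λ q → ne (at-inj (trans (sym (class-of i a)) (trans q (class-of j b)))))
        (trans (cong₂ (adj G) (class-of i a) (class-of j b))
          (sym (trans (subst-diff Q As ne a b) (induced-adj (adj-sym G) J ne))))
    labels : ∀ x → label G (f x) ≡ label (subst Q As) x
    labels x with paired? k x
    ... | paired i a = trans (cong (label G) (f-pair i a)) (sym (subst-label Q As i a))

  coarsen : ∀ m (J : Fin n → Bool) → card J ≤ m → (c : Fin n → Fin n) →
    (∀ x → J (c x) ≡ true) → (∀ {j} → J j ≡ true → c j ≡ j) →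
    (∀ {x y} → c x ≢ c y → adj G x y ≡ adj G (c x) (c y)) →
    (∃₂ λ i j → J i ≡ true × J j ≡ true × i ≢ j) → Decomposed G
  coarsen zero J cJ≤ c cJ cid md (i , _ , ji , _) = ⊥-elim (card-empty {A = J} cJ≤ ji)
  coarsen (suc m) J cJ≤ c cJ cid md two with nontrivial-module? (adj G) J
  ... | no no-module = quotient-decomposed J no-module c cJ cid md two
  ... | yes (S , nm) = coarsen m J′ (Nat.≤-pred (Nat.≤-trans J′<J cJ≤)) (merge ∘ c) mJ mid mmd
      -- Two representatives always survive a merge: `s₀`, and some `k₀` outside the proper subset
      -- `S` of `J`.
      (s₀ , k₀ , in-J′ (inside s₀ s₀∈) (λ _ → refl) , in-J′ k₀∈J (λ t → ⊥-elim (true≢false t k₀∉S)) , λ { refl → true≢false s₀∈ k₀∉S })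
    where
    open NontrivialModule nm using (inside; proper; module-of) renaming (two to two-in-S)
    s₀ s₁ k₀ : Fin n
    s₀ = proj₁ two-in-S
    s₁ = proj₁ (proj₂ two-in-S)
    k₀ = proj₁ proper
    s₀∈ : S s₀ ≡ true
    s₀∈ = proj₁ (proj₂ (proj₂ two-in-S))
    s₁∈ : S s₁ ≡ true
    s₁∈ = proj₁ (proj₂ (proj₂ (proj₂ two-in-S)))
    k₀∈J : J k₀ ≡ true
    k₀∈J = proj₁ (proj₂ proper)
    k₀∉S : S k₀ ≡ false
    k₀∉S = proj₂ (proj₂ proper)
    drop? : ∀ i → Dec (S i ≡ true × i ≢ s₀)
    drop? i = (S i Bool.≟ true) ×-dec ¬? (i Fin.≟ s₀)
    J′ : Fin n → Bool
    J′ i = J i ∧ not (does (drop? i))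
    in-J′ : ∀ {i} → J i ≡ true → (S i ≡ true → i ≡ s₀) → J′ i ≡ true
    in-J′ {i} ji h rewrite ji = cong not (dec-false (drop? i) λ (t , ne) → ne (h t))
    out-J′ : ∀ {i} → J′ i ≡ true → J i ≡ true × (S i ≡ true → i ≡ s₀)
    out-J′ {i} t = let (ji , d) = ∧-not-true t in ji , λ si → decidable-stable (i Fin.≟ s₀) λ ne → does-false (drop? i) d (si , ne)
      where
      ∧-not-true : ∀ {a b} → a ∧ not b ≡ true → a ≡ true × b ≡ false
      ∧-not-true {true} {false} _ = refl , refl
    J′<J : card J′ < card J
    J′<J = card-strict (λ i t → proj₁ (out-J′ {i} t)) s₁
      (≢true⇒false λ t → proj₂ (proj₂ (proj₂ (proj₂ two-in-S))) (sym (proj₂ (out-J′ {s₁} t) s₁∈))) (inside s₁ s₁∈)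
    merge : Fin n → Fin n
    merge i with S i
    ... | true = s₀
    ... | false = i
    mJ : ∀ x → J′ (merge (c x)) ≡ true
    mJ x with S (c x) in sx
    ... | true = in-J′ (inside s₀ s₀∈) λ _ → refl
    ... | false = in-J′ (cJ x) λ t → ⊥-elim (true≢false t sx)
    mid : ∀ {j} → J′ j ≡ true → merge (c j) ≡ j
    mid {j} t with out-J′ {j} t
    ... | jj , h rewrite cid jj with S j in sj
    ...   | true = sym (h refl)
    ...   | false = refl
    mmd : ∀ {x y} → merge (c x) ≢ merge (c y) → adj G x y ≡ adj G (merge (c x)) (merge (c y))
    mmd {x} {y} ne = trans (md λ e → ne (cong merge e)) (merged (cJ x) (cJ y) ne)
      where
      merged : ∀ {a b} → J a ≡ true → J b ≡ true → merge a ≢ merge b → adj G a b ≡ adj G (merge a) (merge b)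
      merged {a} {b} ja jb ne with S a in sa | S b in sb
      ... | true | true = ⊥-elim (ne refl)
      ... | true | false = trans (adj-sym G a b) (trans (module-of b a s₀ jb sb sa s₀∈) (adj-sym G b s₀))
      ... | false | true = module-of a b s₀ ja sa sb s₀∈
      ... | false | false = refl

  decompose : 2 ≤ size G → Decomposed G
  decompose two = coarsen _ (λ _ → true) Nat.≤-refl id (λ _ → refl) (λ _ → refl) (λ _ → refl)
    (let (x , y , ne) = two-vertices two in x , y , refl , refl , ne)

sumF-≥ : ∀ {n} (k : Fin n → ℕ) → (∀ i → 1 ≤ k i) → n ≤ sumF n k
sumF-≥ {zero} k h = z≤n
sumF-≥ {suc n} k h = Nat.+-mono-≤ (h zero) (sumF-≥ (k ∘ suc) (h ∘ suc))

sumF-block : ∀ {n} (k : Fin n → ℕ) → (∀ i → 1 ≤ k i) → 2 ≤ n → ∀ i → k i < sumF n k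
sumF-block {suc n} k h (s≤s one) zero =
  Nat.≤-trans (Nat.≤-reflexive (Nat.+-comm 1 (k zero))) (Nat.+-monoʳ-≤ (k zero) (Nat.≤-trans one (sumF-≥ (k ∘ suc) (h ∘ suc))))
sumF-block {suc n} k h _ (suc i) = Nat.+-mono-≤ (h zero) (below-sum (k ∘ suc) i)
  where
  below-sum : ∀ {n} (k : Fin n → ℕ) i → k i ≤ sumF n k
  below-sum {suc n} k zero = Nat.m≤m+n (k zero) _
  below-sum {suc n} k (suc i) = Nat.≤-trans (below-sum (k ∘ suc) i) (Nat.m≤n+m _ (k zero))

-- At the root of a decomposition `Q` either has at most one vertex in each block, and then embeds
-- into the quotient, or it lies within one block, which is smaller.
prime-connector : ∀ m G → size G ≤ m → ∀ Q → Prime Q → InducedSub Q G → Σ Graph λ P → Connector P G × InducedSub Q P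
prime-connector zero G sz Q pr (f , _) =
  ⊥-elim (Nat.<⇒≱ (fin-nonempty (f (proj₁ (two-vertices (proj₁ pr))))) sz)
prime-connector (suc m) G sz Q pr@(two , _) i@(f , f-inj , _) = go (decompose G (two-distinct (proj₂ (proj₂ (two-vertices two)) ∘ f-inj)))
  where
  go : Decomposed G → Σ Graph λ P → Connector P G × InducedSub Q P
  go (P , As , nd@(nonempty , (P-two , _) , _) , g) = cases (prime-blocks {Q} pr Fin._≟_ (hue ∘ h) λ {v} {x} {y} ne e →
      trans (sym (he v x)) (trans (block-index-edge P As ne) (trans (cong (adj P (hue (h v))) e)
        (trans (sym (block-index-edge P As λ q → ne (trans q (sym e)))) (he v y)))))
    where
    k : Fin (size P) → ℕ
    k = size ∘ As
    j : InducedSub Q (subst P As)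
    j = induced-trans {Q} {G} {subst P As} i (≅-induced g)
    h : Fin (size Q) → Fin (size (subst P As))
    h = proj₁ j
    he : ∀ x y → adj (subst P As) (h x) (h y) ≡ adj Q x y
    he = proj₂ (proj₂ j)
    hue : Fin (size (subst P As)) → Fin (size P)
    hue = block-index P As
    i₀ : Fin (size P)
    i₀ = hue (h (proj₁ (two-vertices two)))
    small : size (As i₀) ≤ m
    small = Nat.≤-pred (Nat.≤-trans (sumF-block k nonempty P-two i₀)
      (Nat.≤-trans (let (_ , inj , _) = ≅-induced (≅-sym g) in Fin.injective⇒≤ inj) sz))
    located : ∀ z i → hue z ≡ i → ∃ λ a → pair k i a ≡ z
    located z i e with paired? k z
    ... | paired i′ a with trans (sym (block-index-pair P As i′ a)) e
    ...   | refl = a , refl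
    cases : (∀ x y → hue (h x) ≡ hue (h y)) ⊎ (∀ x y → hue (h x) ≡ hue (h y) → x ≡ y) → Σ Graph λ P → Connector P G × InducedSub Q P
    cases (inj₁ all) =
      let (P′ , c , s) = prime-connector m (As i₀) small Q pr
            (factor {Q} {As i₀} {subst P As} j (pair k i₀) (subst-same P As i₀) (λ x → located (h x) i₀ (all x _)))
      in P′ , below P As nd g i₀ c , s
    cases (inj₂ inj) = P , here P As nd g (record { bij = Inverses.↔-refl ; edge = λ _ _ → refl })
      , hue ∘ h , (λ {x} {y} → inj x y)
      , adj-off-diagonal Q P (hue ∘ h) λ {x} {y} ne → trans (sym (block-index-edge P As λ q → ne (inj x y q))) (he x y)

good-subconnector : ∀ {G H} → Good G H → ∀ P → Connector P H → Subconnector P G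
good-subconnector {G} good P c = let (pr , i) = connector-prime c in pr , prime-connector _ G Nat.≤-refl P pr (good P pr i)

-- Realisation of vertex sets by graphs

record Realises {V : Set} (E : V → V → Bool) (lab : V → Atom) (U : V → Set) (H : Graph) : Set where
  constructor realises
  field
    at      : Fin (size H) → V
    at-inj  : ∀ {x y} → at x ≡ at y → x ≡ y
    at-in   : ∀ x → U (at x)
    at-onto : ∀ {v} → U v → ∃ λ x → at x ≡ v
    at-edge : ∀ x y → E (at x) (at y) ≡ adj H x y
    at-lab  : ∀ x → lab (at x) ≡ label H x

realises-self : ∀ H → Realises (adj H) (label H) Full H
realises-self H = realises id id (λ _ → tt) (λ {v} _ → v , refl) (λ _ _ → refl) (λ _ → refl)

realises-resp : ∀ {V E lab U W H} → U ≐ W → Realises {V} E lab U H → Realises E lab W H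
realises-resp (f , g) r = record { at = at ; at-inj = at-inj ; at-in = f ∘ at-in ; at-onto = at-onto ∘ g ; at-edge = at-edge ; at-lab = at-lab }
  where open Realises r

realises-edge : ∀ {V E E′ lab U H} → (∀ {x y} → U x → U y → E x y ≡ E′ x y) → Realises {V} E lab U H → Realises E′ lab U H
realises-edge h r = record { at = at ; at-inj = at-inj ; at-in = at-in ; at-onto = at-onto
  ; at-edge = λ x y → trans (sym (h (at-in x) (at-in y))) (at-edge x y) ; at-lab = at-lab }
  where open Realises r

realises-comp : ∀ {V E lab U H W G} (r : Realises {V} E lab U H) → Realises (adj H) (label H) W G →
  Realises E lab (λ v → ∃ λ x → W x × Realises.at r x ≡ v) G
realises-comp r s = record
  { at = R.at ∘ S.at ; at-inj = λ e → S.at-inj (R.at-inj e) ; at-in = λ x → S.at x , S.at-in x , refl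
  ; at-onto = λ { (x , w , refl) → let (y , e) = S.at-onto w in y , cong R.at e }
  ; at-edge = λ x y → trans (R.at-edge _ _) (S.at-edge x y) ; at-lab = λ x → trans (R.at-lab _) (S.at-lab x) }
  where
  module R = Realises r
  module S = Realises s

-- Isomorphisms between compound graphs come from here: both are read as realisations of one vertex
-- set, which avoids bijections written out on the indices of `splitAt` and `unpair`.
realises-unique : ∀ {V E lab U G H} → Realises {V} E lab U G → Realises E lab U H → G ≅ H
realises-unique {E = E} {lab} r s = mkIso f
  (λ {x} {y} e → R.at-inj (trans (sym (f-at x)) (trans (cong S.at e) (f-at y))))
  (λ y → let (x , e) = R.at-onto (S.at-in y) in x , S.at-inj (trans (f-at x) e))
  (λ x y → trans (sym (S.at-edge _ _)) (trans (cong₂ E (f-at x) (f-at y)) (R.at-edge x y)))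
  (λ x → trans (sym (S.at-lab _)) (trans (cong lab (f-at x)) (R.at-lab x)))
  where
  module R = Realises r
  module S = Realises s
  f : _ → _
  f x = proj₁ (S.at-onto (R.at-in x))
  f-at : ∀ x → S.at (f x) ≡ R.at x
  f-at x = proj₂ (S.at-onto (R.at-in x))

realises-image : ∀ {V} {E : V → V → Bool} {lab} {H} (f : Fin (size H) → V) → (∀ {x y} → f x ≡ f y → x ≡ y) →
  (∀ x y → E (f x) (f y) ≡ adj H x y) → (∀ x → lab (f x) ≡ label H x) → Realises E lab (λ v → ∃ λ x → f x ≡ v) H
realises-image f inj e l = realises f inj (λ x → x , refl) id e l

realises-≅ : ∀ {V E lab U G H} → G ≅ H → Realises {V} E lab U H → Realises E lab U G
realises-≅ g r = let (f , fi , fe) = ≅-induced g in record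
  { at = at ∘ f ; at-inj = λ e → fi (at-inj e) ; at-in = at-in ∘ f
  ; at-onto = λ u → let (y , e) = at-onto u in Inverse.from bij y , trans (cong at (Inverse.strictlyInverseˡ bij y)) e
  ; at-edge = λ x y → trans (at-edge _ _) (fe x y) ; at-lab = λ x → trans (at-lab _) (lab x) }
  where
  open Realises r
  open _≅_ g

module _ {V : Set} {E : V → V → Bool} (Esym : ∀ x y → E x y ≡ E y x) {lab : V → Atom} where

  juxt-realises : ∀ {U W G H} (r : Realises E lab U G) (s : Realises E lab W H) (c : Fin (size G) → Bool) →
    (∀ {v} → U v → ¬ W v) → (∀ x y → E (Realises.at r x) (Realises.at s y) ≡ c x) → Realises E lab (U ∪ W) (juxt G H c)
  juxt-realises {U} {W} {G} {H} r s c dj cross = realises at inj isin onto edge labels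
    where
    module R = Realises r
    module S = Realises s
    at : Fin (size G + size H) → V
    at z = [ R.at , S.at ] (splitAt (size G) z)
    at-l : ∀ x → at (x ↑ˡ size H) ≡ R.at x
    at-l x = cong [ R.at , S.at ] (Fin.splitAt-↑ˡ (size G) x (size H))
    at-r : ∀ y → at (size G ↑ʳ y) ≡ S.at y
    at-r y = cong [ R.at , S.at ] (Fin.splitAt-↑ʳ (size G) (size H) y)
    clash : ∀ {x y} → R.at x ≢ S.at y
    clash {x} {y} e = dj (R.at-in x) (≡-subst W (sym e) (S.at-in y))
    inj : ∀ {x y} → at x ≡ at y → x ≡ y
    inj {x} {y} e with side (size G) (size H) x | side (size G) (size H) y
    ... | inl a | inl b = cong (_↑ˡ size H) (R.at-inj (trans (sym (at-l a)) (trans e (at-l b))))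
    ... | inl a | inr b = ⊥-elim (clash (trans (sym (at-l a)) (trans e (at-r b))))
    ... | inr a | inl b = ⊥-elim (clash (sym (trans (sym (at-r a)) (trans e (at-l b)))))
    ... | inr a | inr b = cong (size G ↑ʳ_) (S.at-inj (trans (sym (at-r a)) (trans e (at-r b))))
    isin : ∀ z → (U ∪ W) (at z)
    isin z with splitAt (size G) z
    ... | inj₁ x = inj₁ (R.at-in x)
    ... | inj₂ y = inj₂ (S.at-in y)
    onto : ∀ {v} → (U ∪ W) v → ∃ λ z → at z ≡ v
    onto (inj₁ u) = let (x , e) = R.at-onto u in x ↑ˡ size H , trans (at-l x) e
    onto (inj₂ w) = let (y , e) = S.at-onto w in size G ↑ʳ y , trans (at-r y) e
    edge : ∀ x y → E (at x) (at y) ≡ adj (juxt G H c) x y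
    edge x y with side (size G) (size H) x | side (size G) (size H) y
    ... | inl a | inl b = trans (cong₂ E (at-l a) (at-l b)) (trans (R.at-edge a b) (sym (juxt-ll G H c a b)))
    ... | inl a | inr b = trans (cong₂ E (at-l a) (at-r b)) (trans (cross a b) (sym (juxt-lr G H c a b)))
    ... | inr a | inl b = trans (cong₂ E (at-r a) (at-l b)) (trans (Esym _ _) (trans (cross b a) (sym (juxt-rl G H c b a))))
    ... | inr a | inr b = trans (cong₂ E (at-r a) (at-r b)) (trans (S.at-edge a b) (sym (juxt-rr G H c a b)))
    labels : ∀ z → lab (at z) ≡ label (juxt G H c) z
    labels z with side (size G) (size H) z
    ... | inl a = trans (cong lab (at-l a)) (trans (R.at-lab a) (sym (juxt-label-l G H c a)))
    ... | inr b = trans (cong lab (at-r b)) (trans (S.at-lab b) (sym (juxt-label-r G H c b)))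

  subst-realises : ∀ P (Hs : Fin (size P) → Graph) {U : Fin (size P) → V → Set} (r : ∀ i → Realises E lab (U i) (Hs i)) →
    (∀ {i j v} → U i v → U j v → i ≡ j) → (∀ {i j v w} → i ≢ j → U i v → U j w → E v w ≡ adj P i j) →
    Realises E lab (λ v → ∃ λ i → U i v) (subst P Hs)
  subst-realises P Hs {U} r dj cross = realises at inj isin onto edge labels
    where
    module R i = Realises (r i)
    k : Fin (size P) → ℕ
    k = size ∘ Hs
    at′ : Σ (Fin (size P)) (λ i → Fin (k i)) → V
    at′ (i , a) = R.at i a
    at : Fin (size (subst P Hs)) → V
    at z = at′ (unpair (size P) k z)
    at-pair : ∀ i a → at (pair k i a) ≡ R.at i a
    at-pair i a = cong at′ (unpair-pair k i a)
    same-block : ∀ {i j a b} → R.at i a ≡ R.at j b → i ≡ j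
    same-block {i} {j} {a} {b} e = dj (≡-subst (U i) e (R.at-in i a)) (R.at-in j b)
    inj : ∀ {x y} → at x ≡ at y → x ≡ y
    inj {x} {y} e with paired? k x | paired? k y
    ... | paired i a | paired j b with same-block {i} {j} {a} {b} (trans (sym (at-pair i a)) (trans e (at-pair j b)))
    ...   | refl = cong (pair k i) (R.at-inj i (trans (sym (at-pair i a)) (trans e (at-pair i b))))
    isin : ∀ z → ∃ λ i → U i (at z)
    isin z = _ , R.at-in _ _
    onto : ∀ {v} → (∃ λ i → U i v) → ∃ λ z → at z ≡ v
    onto (i , u) = let (a , e) = R.at-onto i u in pair k i a , trans (at-pair i a) e
    edge : ∀ x y → E (at x) (at y) ≡ adj (subst P Hs) x y
    edge x y with paired? k x | paired? k y
    ... | paired i a | paired j b = trans (cong₂ E (at-pair i a) (at-pair j b)) (pairs i j a b (i Fin.≟ j))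
      where
      pairs : ∀ i j a b → Dec (i ≡ j) → E (R.at i a) (R.at j b) ≡ adj (subst P Hs) (pair k i a) (pair k j b)
      pairs i .i a b (yes refl) = trans (R.at-edge i a b) (sym (subst-same P Hs i a b))
      pairs i j a b (no ne) = trans (cross ne (R.at-in i a) (R.at-in j b)) (sym (subst-diff P Hs ne a b))
    labels : ∀ z → lab (at z) ≡ label (subst P Hs) z
    labels z with paired? k z
    ... | paired i a = trans (cong lab (at-pair i a)) (trans (R.at-lab i a) (sym (subst-label P Hs i a)))

  realise : ∀ {n} (v : Fin n → V) → (∀ {i j} → v i ≡ v j → i ≡ j) → (∀ x → E x x ≡ false) →
    ∀ {U : V → Set} → Decidable U → (∀ {x} → U x → ∃ λ i → v i ≡ x) → Σ Graph (Realises E lab U)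
  realise {n} v v-inj Eirr {U} U? cover = G , realises (v ∘ at) (λ e → at-inj (v-inj e))
    (λ x → does-true (U? (v (at x))) (at-in x)) onto edge (λ _ → refl)
    where
    A : Fin n → Bool
    A i = does (U? (v i))
    open Enumeration (enumerate A)
    G : Graph
    G = mkGraph count (lab ∘ v ∘ at) (λ x y → E (v (at x)) (v (at y)))
    onto : ∀ {x} → U x → ∃ λ a → v (at a) ≡ x
    onto u with cover u
    ... | i , refl = let (a , e) = at-onto (dec-true (U? (v i)) u) in a , cong v e
    edge : ∀ x y → E (v (at x)) (v (at y)) ≡ adj G x y
    edge x y = cases (x Fin.≟ y)
      where
      cases : Dec (x ≡ y) → E (v (at x)) (v (at y)) ≡ adj G x y
      cases (yes refl) = trans (Eirr _) (sym (adj-irrefl G x))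
      cases (no ne) = sym (trans (cong (λ b → not b ∧ (E (v (at x)) (v (at y)) ∨ E (v (at y)) (v (at x)))) (dec-false (x Fin.≟ y) ne))
        (trans (cong (E (v (at x)) (v (at y)) ∨_) (Esym _ _)) (Bool.∨-idem _)))

juxt-cong : ∀ {G G′ H H′} (g : G′ ≅ G) (h : H′ ≅ H) (r : Fin (size G) → Bool) (r′ : Fin (size G′) → Bool) →
  (∀ x → Fin (size H′) → r (Inverse.to (_≅_.bij g) x) ≡ r′ x) → juxt G′ H′ r′ ≅ juxt G H r
juxt-cong {G} {G′} {H} {H′} g h r r′ e = realises-unique
  (juxt-realises (adj-sym (juxt G H r)) (realises-≅ g l) (realises-≅ h rr) r′ dj
    (λ x y → trans (juxt-lr G H r (Inverse.to (_≅_.bij g) x) (Inverse.to (_≅_.bij h) y)) (e x y)))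
  (juxt-realises (adj-sym (juxt G H r)) l rr r dj (juxt-lr G H r))
  where
  l : Realises (adj (juxt G H r)) (label (juxt G H r)) (λ v → ∃ λ x → x ↑ˡ size H ≡ v) G
  l = realises-image (_↑ˡ size H) (Fin.↑ˡ-injective (size H) _ _) (juxt-ll G H r) (juxt-label-l G H r)
  rr : Realises (adj (juxt G H r)) (label (juxt G H r)) (λ v → ∃ λ y → size G ↑ʳ y ≡ v) H
  rr = realises-image (size G ↑ʳ_) (Fin.↑ʳ-injective (size G) _ _) (juxt-rr G H r) (juxt-label-r G H r)
  dj : ∀ {v} → (∃ λ x → x ↑ˡ size H ≡ v) → ¬ (∃ λ y → size G ↑ʳ y ≡ v)
  dj (x , refl) (y , q) = ↑ˡ≢↑ʳ x y (sym q)

≅-refl : ∀ {G} → G ≅ G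
≅-refl {G} = realises-unique (realises-self G) (realises-self G)

≅-trans : ∀ {G H K} → G ≅ H → H ≅ K → G ≅ K
≅-trans {K = K} g h = realises-unique (realises-≅ g (realises-≅ h (realises-self K))) (realises-self K)

plug-cong : ∀ C R {X Y} → X ≅ Y → plug C R X ≅ plug C R Y
plug-cong C R {X} {Y} g = juxt-cong {C} {C} {Y} {X} ≅-refl g R R (λ _ _ → refl)

juxt-assoc : ∀ C A B (r : Fin (size C) → Bool) (s : Fin (size A) → Bool) →
  juxt C (juxt A B s) r ≅ juxt (juxt C A r) B (λ z → [ r , s ] (splitAt (size C) z))
juxt-assoc C A B r s = realises-unique
  (juxt-realises Esym rC (juxt-realises Esym rA rB s dAB cAB) r (λ { c (inj₁ a) → dCA c a ; c (inj₂ b) → dCB c b }) cC)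
  (realises-resp ([ [ inj₁ , inj₂ ∘ inj₁ ] , inj₂ ∘ inj₂ ] , [ inj₁ ∘ inj₁ , [ inj₁ ∘ inj₂ , inj₂ ] ])
    (juxt-realises Esym (juxt-realises Esym rC rA r dCA cCA) rB _ (λ { (inj₁ c) b → dCB c b ; (inj₂ a) b → dAB a b }) cB))
  where
  X = juxt C (juxt A B s) r
  Esym = adj-sym X
  a b c : ℕ
  a = size A
  b = size B
  c = size C
  rC : Realises (adj X) (label X) (λ (v : Fin (size X)) → ∃ λ (x : Fin c) → x ↑ˡ (a + b) ≡ v) C
  rC = realises-image (_↑ˡ (a + b)) (Fin.↑ˡ-injective (a + b) _ _) (juxt-ll C (juxt A B s) r) (juxt-label-l C (juxt A B s) r)
  rA : Realises (adj X) (label X) (λ (v : Fin (size X)) → ∃ λ (x : Fin a) → c ↑ʳ (x ↑ˡ b) ≡ v) A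
  rA = realises-image (λ x → c ↑ʳ (x ↑ˡ b)) (λ e → Fin.↑ˡ-injective b _ _ (Fin.↑ʳ-injective c _ _ e))
    (λ x y → trans (juxt-rr C (juxt A B s) r (x ↑ˡ b) (y ↑ˡ b)) (juxt-ll A B s x y))
    (λ x → trans (juxt-label-r C (juxt A B s) r (x ↑ˡ b)) (juxt-label-l A B s x))
  rB : Realises (adj X) (label X) (λ (v : Fin (size X)) → ∃ λ (x : Fin b) → c ↑ʳ (a ↑ʳ x) ≡ v) B
  rB = realises-image (λ x → c ↑ʳ (a ↑ʳ x)) (λ e → Fin.↑ʳ-injective a _ _ (Fin.↑ʳ-injective c _ _ e))
    (λ x y → trans (juxt-rr C (juxt A B s) r (a ↑ʳ x) (a ↑ʳ y)) (juxt-rr A B s x y))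
    (λ x → trans (juxt-label-r C (juxt A B s) r (a ↑ʳ x)) (juxt-label-r A B s x))
  dCA : ∀ {v : Fin (size X)} → (∃ λ (x : Fin c) → x ↑ˡ (a + b) ≡ v) → ¬ (∃ λ (x : Fin a) → c ↑ʳ (x ↑ˡ b) ≡ v)
  dCA (x , refl) (y , e) = ↑ˡ≢↑ʳ x (y ↑ˡ b) (sym e)
  dCB : ∀ {v : Fin (size X)} → (∃ λ (x : Fin c) → x ↑ˡ (a + b) ≡ v) → ¬ (∃ λ (x : Fin b) → c ↑ʳ (a ↑ʳ x) ≡ v)
  dCB (x , refl) (y , e) = ↑ˡ≢↑ʳ x (a ↑ʳ y) (sym e)
  dAB : ∀ {v : Fin (size X)} → (∃ λ (x : Fin a) → c ↑ʳ (x ↑ˡ b) ≡ v) → ¬ (∃ λ (x : Fin b) → c ↑ʳ (a ↑ʳ x) ≡ v)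
  dAB (x , refl) (y , e) = ↑ˡ≢↑ʳ x y (Fin.↑ʳ-injective c _ _ (sym e))
  cAB : ∀ x y → adj X (Realises.at rA x) (Realises.at rB y) ≡ s x
  cAB x y = trans (juxt-rr C (juxt A B s) r (x ↑ˡ b) (a ↑ʳ y)) (juxt-lr A B s x y)
  cCA : ∀ x y → adj X (Realises.at rC x) (Realises.at rA y) ≡ r x
  cCA x y = juxt-lr C (juxt A B s) r x (y ↑ˡ b)
  cC : ∀ x y → adj X (Realises.at rC x) (Realises.at (juxt-realises Esym rA rB s dAB cAB) y) ≡ r x
  cC x y with splitAt a y
  ... | inj₁ u = juxt-lr C (juxt A B s) r x (u ↑ˡ b)
  ... | inj₂ u = juxt-lr C (juxt A B s) r x (a ↑ʳ u)
  cB : ∀ z y → adj X (Realises.at (juxt-realises Esym rC rA r dCA cCA) z) (Realises.at rB y) ≡ [ r , s ] (splitAt c z)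
  cB z y with splitAt c z
  ... | inj₁ u = juxt-lr C (juxt A B s) r u (a ↑ʳ y)
  ... | inj₂ u = cAB u y

plug-empty : ∀ K → K ≅ plug emptyG (λ ()) K
plug-empty K = mkIso id id (λ y → y , refl) (juxt-rr emptyG K (λ ())) (λ x → refl)

plug-hole : ∀ C R → C ≅ plug C R emptyG
plug-hole C R = realises-unique (realises-self C)
  (realises-resp ((λ _ → tt) , inj₁)
    (juxt-realises (adj-sym C) (realises-self C) (realises {U = λ _ → ⊥} (λ ()) (λ {}) (λ ()) (λ ()) (λ ()) (λ ())) R (λ _ ()) (λ _ ())))

-- Derivations all of whose graphs have their prime induced subgraphs in Z

module Analytic (Z : Graph) where

  Der : Graph → Graph → Set
  Der G H = Σ (Derivation GSssUp G H) (AllOccurring (Good Z))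

  good-end : ∀ {G H} → Der G H → Good Z H
  good-end (done _ , g) = g
  good-end (step _ d , _ , gs) = good-end (d , gs)

  infixl 5 _▷_
  _▷_ : ∀ {G H K} → Der G H → Step GSssUp H K × Good Z K → Der G K
  (done _ , g) ▷ (s , k) = step s (done _) , g , k
  (step t d , g , gs) ▷ sk = let (d′ , gs′) = (d , gs) ▷ sk in step t d′ , g , gs′

  _▷≅_ : ∀ {G H K} → Der G H → H ≅ K → Der G K
  _▷≅_ {H = H} {K} d g = d ▷ (iso g , good-≅ {Z} {H} {K} g (good-end d))

  _▷▷_ : ∀ {G H K} → Der G H → Der H K → Der G K
  (done _ , g) ▷▷ e = e
  (step t d , g , gs) ▷▷ e = let (d′ , gs′) = (d , gs) ▷▷ e in step t d′ , g , gs′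

  in-context : ∀ C R → (∀ K → Good Z K → Good Z (plug C R K)) → ∀ {G H} → Der G H → Der (plug C R G) (plug C R H)
  in-context C R good (done G , g) = done _ , good G g
  in-context C R good {G} (step {H = H} s d , g , gs) =
    let (d′ , gs′) = in-context C R good (d , gs) in step (deepen s) d′ , good G g , gs′
    where
    deepen : Step GSssUp G H → Step GSssUp (plug C R G) (plug C R H)
    deepen (iso g) = iso (plug-cong C R g)
    deepen (rule C′ R′ X Y r g h) = rule (plug C R C′) _ X Y r
      (≅-trans (plug-cong C R g) (juxt-assoc C C′ X R R′)) (≅-trans (plug-cong C R h) (juxt-assoc C C′ Y R R′))

  Analysed : Graph → Set
  Analysed G = Der emptyG G

  analysed-empty : Analysed emptyG
  analysed-empty = done emptyG , λ Q pr (f , _) → ⊥-elim (Fin.¬Fin0 (f (proj₁ (two-vertices (proj₁ pr)))))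

  -- `C` has an empty hole at `R`, and the derivation of `A` is run inside this hole.
  analysed-plug : ∀ C R A → (∀ K → Good Z K → Good Z (plug C R K)) → Analysed C → Analysed A → Analysed (plug C R A)
  analysed-plug C R A good c a = (c ▷≅ plug-hole C R) ▷▷ in-context C R good a

  -- Where the side conditions of `ss↓` fail, `S` or `A` is empty and the two graphs are isomorphic.
  release : ∀ B A S → Good Z (B ⊔ A) → Analysed (juxt B A S) → Analysed (B ⊔ A)
  release B A S good d with Fin.any? (λ x → S x Bool.≟ true) | Fin.any? {n = size A} (λ _ → yes tt)
  ... | no none | _ = d ▷≅ juxt-cong {B} {B} {A} {A} ≅-refl ≅-refl (λ _ → false) S
        (λ x _ → sym (≢true⇒false λ t → none (x , t)))
  ... | yes _ | no none = d ▷≅ juxt-cong {B} {B} {A} {A} ≅-refl ≅-refl (λ _ → false) S (λ x y → ⊥-elim (none (y , tt)))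
  ... | yes (x , t) | yes (y , _) = d ▷ (rule emptyG (λ ()) _ _ (r-ss (ss B A S (x , t) (fin-nonempty y)))
        (plug-empty _) (plug-empty _) , good)

  bigTensor-suc : ∀ n (T : Fin (suc n) → Graph) → (T zero ⊗ bigTensor n (T ∘ suc)) ≅ bigTensor (suc n) T
  bigTensor-suc n T = mkIso id id (λ y → y , refl) edge labels
    where
    k : Fin (suc n) → ℕ
    k = size ∘ T
    rest : Graph
    rest = bigTensor n (T ∘ suc)
    yes-all : Fin (size (T zero)) → Bool
    yes-all _ = true
    edge : ∀ x y → adj (bigTensor (suc n) T) x y ≡ adj (T zero ⊗ rest) x y
    edge x y with side (k zero) (sumF n (k ∘ suc)) x | side (k zero) (sumF n (k ∘ suc)) y
    ... | inl a | inl b = trans (subst-same (complete (suc n)) T zero a b) (sym (juxt-ll (T zero) rest yes-all a b))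
    ... | inl a | inr w with paired? (k ∘ suc) w
    ...   | paired i b = trans (trans (subst-diff (complete (suc n)) T (λ ()) a b) (complete-adj {suc n} {zero} {suc i} (λ ())))
              (sym (juxt-lr (T zero) rest yes-all a (pair (k ∘ suc) i b)))
    edge x y | inr w | inl b with paired? (k ∘ suc) w
    ...   | paired i a = trans (trans (subst-diff (complete (suc n)) T (λ ()) a b) (complete-adj {suc n} {suc i} {zero} (λ ())))
              (sym (juxt-rl (T zero) rest yes-all b (pair (k ∘ suc) i a)))
    edge x y | inr w | inr w′ with paired? (k ∘ suc) w | paired? (k ∘ suc) w′
    ...   | paired i a | paired j b = trans (tail i j a b (i Fin.≟ j)) (sym (juxt-rr (T zero) rest yes-all (pair (k ∘ suc) i a) (pair (k ∘ suc) j b)))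
      where
      tail : ∀ i j a b → Dec (i ≡ j) → adj (bigTensor (suc n) T) (pair k (suc i) a) (pair k (suc j) b) ≡
        adj rest (pair (k ∘ suc) i a) (pair (k ∘ suc) j b)
      tail i .i a b (yes refl) = trans (subst-same (complete (suc n)) T (suc i) a b) (sym (subst-same (complete n) (T ∘ suc) i a b))
      tail i j a b (no ne) = trans (trans (subst-diff (complete (suc n)) T (ne ∘ Fin.suc-injective) a b) (complete-adj (ne ∘ Fin.suc-injective)))
        (sym (trans (subst-diff (complete n) (T ∘ suc) ne a b) (complete-adj ne)))
    labels : ∀ x → label (bigTensor (suc n) T) x ≡ label (T zero ⊗ rest) x
    labels x with side (k zero) (sumF n (k ∘ suc)) x
    ... | inl a = trans (subst-label (complete (suc n)) T zero a) (sym (juxt-label-l (T zero) rest yes-all a))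
    ... | inr w with paired? (k ∘ suc) w
    ...   | paired i a = trans (subst-label (complete (suc n)) T (suc i) a)
              (sym (trans (juxt-label-r (T zero) rest yes-all (pair (k ∘ suc) i a)) (subst-label (complete n) (T ∘ suc) i a)))

  -- The only prime that can arise across two factors is the one-edge graph, for which `u` and `v`
  -- are a copy in `Z`.
  analysed-bigTensor : (u v : Fin (size Z)) → u ≢ v → adj Z u v ≡ true →
    ∀ n (T : Fin n → Graph) → (∀ i → Analysed (T i)) → Analysed (bigTensor n T)
  analysed-bigTensor u v ne e zero T a = analysed-empty ▷≅ mkIso id id (λ ()) (λ ()) (λ ())
  analysed-bigTensor u v ne e (suc n) T a = analysed-plug (T zero) (λ _ → true) (bigTensor n (T ∘ suc))
    (λ K g → good-join {Z} {T zero} {K} true u v ne e (good-end (a zero)) g) (a zero)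
    (analysed-bigTensor u v ne e n (T ∘ suc) (a ∘ suc)) ▷≅ bigTensor-suc n T

-- Unfolding proofs of the calculus into derivations

choose : ∀ {A : Set} → Dec A → Bool → Bool → Bool
choose (yes _) a b = a
choose (no _) a b = b

choose-elim : ∀ {A : Set} (d : Dec A) {a b c} → (A → a ≡ c) → (¬ A → b ≡ c) → choose d a b ≡ c
choose-elim (yes t) f g = f t
choose-elim (no n) f g = g n

module Primal (Z : Graph) where
  open Analytic Z
  open Calculus (adj Z) (label Z)

  Real : (Fin (size Z) → Set) → Graph → Set
  Real = Realises (adj Z) (label Z)

  good-real : ∀ {U H} → Real U H → Good Z H
  good-real {H = H} r = good-induced {Z} {H} (at , at-inj , at-edge)
    where open Realises r

  roleEdge-sym : ∀ ρ σ b → roleEdge ρ σ b ≡ roleEdge σ ρ b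
  roleEdge-sym M M b = refl
  roleEdge-sym M N b = refl
  roleEdge-sym M O b = refl
  roleEdge-sym N M b = refl
  roleEdge-sym N N b = refl
  roleEdge-sym N O b = refl
  roleEdge-sym O M b = refl
  roleEdge-sym O N b = refl
  roleEdge-sym O O b = refl

  -- The premises give the tensor of the n i ⊔ (m i ⊔ o i), and p↓ the graph in which each
  -- O-block i still sits beside m i inside Q⟨…⟩.  The O-blocks are then released one by one:
  -- B is the set of released ones, and an unreleased O-vertex has the edges of an M-vertex.
  module PrimeCase (Q : Graph) (Q-prime : Prime Q) (Q-size : 4 ≤ size Q)
    (F : Fin (size Q) → Role → Fin (size Z) → Set) (L : Layout (adj Q) F)
    (someM : ∀ i → ∃ (F i M)) (someN : ∀ i → ∃ (F i N))
    (U : Fin (size Z) → Set) (U≐ : U ≐ (λ x → ∃₂ λ i ρ → F i ρ x))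
    (premises : ∀ i H → Real (λ x → ∃ λ ρ → F i ρ x) H → Analysed H)
    (H : Graph) (real : Real U H) where
    open Realises real

    private
      s : ℕ
      s = size Q
      h : ℕ
      h = size H

    abstract
      place : ∀ x → ∃₂ λ i ρ → F i ρ (at x)
      place x = proj₁ U≐ (at-in x)

    hue : Fin h → Fin s
    hue x = proj₁ (place x)
    role : Fin h → Role
    role x = proj₁ (proj₂ (place x))
    spot : ∀ x → F (hue x) (role x) (at x)
    spot x = proj₂ (proj₂ (place x))

    hue-of : ∀ {x i ρ} → F i ρ (at x) → hue x ≡ i
    hue-of {x} u = proj₁ (Layout.unique L (spot x) u)
    role-of : ∀ {x i ρ} → F i ρ (at x) → role x ≡ ρ
    role-of {x} u = proj₂ (Layout.unique L (spot x) u)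

    in-spot : ∀ {x i ρ} → hue x ≡ i → role x ≡ ρ → F i ρ (at x)
    in-spot {x} refl refl = spot x

    same : ∀ {x y} → hue x ≡ hue y → role x ≢ role y → adj H x y ≡ false
    same {x} {y} e ne = trans (sym (at-edge x y)) (Layout.same L (spot x) (in-spot (sym e) refl) ne)

    diff : ∀ {x y} → hue x ≢ hue y → adj H x y ≡ roleEdge (role x) (role y) (adj Q (hue x) (hue y))
    diff {x} {y} ne = trans (sym (at-edge x y)) (Layout.diff L ne (spot x) (spot y))

    keep : Role → Bool → Role
    keep O false = M
    keep ρ _ = ρ

    keep-true : ∀ ρ → keep ρ true ≡ ρ
    keep-true M = refl
    keep-true N = refl
    keep-true O = refl

    keep-≢ : ∀ ρ {b c} → ρ ≢ O → keep ρ b ≡ keep ρ c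
    keep-≢ M n = refl
    keep-≢ N n = refl
    keep-≢ O n = ⊥-elim (n refl)

    keep-N : ∀ ρ b → keep ρ b ≡ N → ρ ≡ N
    keep-N N b e = refl
    keep-N O true ()
    keep-N O false ()

    roleAt : (Fin s → Bool) → Fin h → Role
    roleAt B x = keep (role x) (B (hue x))

    E : (Fin s → Bool) → Fin h → Fin h → Bool
    E B x y = choose (hue x Fin.≟ hue y) (adj H x y) (roleEdge (roleAt B x) (roleAt B y) (adj Q (hue x) (hue y)))

    E-by : ∀ B {x y b} → (hue x ≡ hue y → adj H x y ≡ b) →
      (hue x ≢ hue y → roleEdge (roleAt B x) (roleAt B y) (adj Q (hue x) (hue y)) ≡ b) → E B x y ≡ b
    E-by B {x} {y} = choose-elim (hue x Fin.≟ hue y)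

    E-same : ∀ B {x y} → hue x ≡ hue y → E B x y ≡ adj H x y
    E-same B e = E-by B (λ _ → refl) (λ n → ⊥-elim (n e))

    E-diff : ∀ B {x y} → hue x ≢ hue y → E B x y ≡ roleEdge (roleAt B x) (roleAt B y) (adj Q (hue x) (hue y))
    E-diff B n = E-by B (λ e → ⊥-elim (n e)) (λ _ → refl)

    E-sym : ∀ B x y → E B x y ≡ E B y x
    E-sym B x y = E-by B (λ e → trans (adj-sym H x y) (sym (E-same B (sym e))))
      λ n → trans (trans (roleEdge-sym (roleAt B x) (roleAt B y) _) (cong (roleEdge (roleAt B y) (roleAt B x)) (adj-sym Q (hue x) (hue y))))
              (sym (E-diff B (n ∘ sym)))

    E-irrefl : ∀ B x → E B x x ≡ false
    E-irrefl B x = trans (E-same B refl) (adj-irrefl H x)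

    E-role : ∀ B {x y} → roleAt B x ≡ role x → roleAt B y ≡ role y → E B x y ≡ adj H x y
    E-role B {x} {y} ex ey = E-by B (λ _ → refl) λ n →
      trans (cong₂ (λ ρ σ → roleEdge ρ σ (adj Q (hue x) (hue y))) ex ey) (sym (diff n))

    m₀ : Fin s → Fin (size Z)
    m₀ i = proj₁ (someM i)

    m₀-edge : ∀ {i j} → i ≢ j → adj Z (m₀ i) (m₀ j) ≡ adj Q i j
    m₀-edge {i} {j} ne = Layout.diff L ne (proj₂ (someM i)) (proj₂ (someM j))

    i₀ : Fin s
    i₀ = proj₁ (two-vertices (proj₁ Q-prime))

    -- Both two-vertex primes have to occur in `Z`: the edgeless one for parts lying side by side,
    -- and the one of `edge` for the tensor of the premises.
    nonedge : ∃₂ λ (u v : Fin (size Z)) → u ≢ v × adj Z u v ≡ false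
    nonedge = let (u , a) = someM i₀ ; (v , b) = someN i₀ in
      u , v , distinct a b , Layout.same L a b λ ()
      where
      distinct : ∀ {i u v} → F i M u → F i N v → u ≢ v
      distinct a b refl = case Layout.unique L a b of λ ()

    edge : ∃₂ λ (u v : Fin (size Z)) → u ≢ v × adj Z u v ≡ true
    edge with Fin.any? (λ i → Fin.any? λ j → adj Q i j Bool.≟ true)
    ... | no none = ⊥-elim (no-uniform-vertex {Q} Q-prime (3≤⇐4≤ Q-size) i₀ λ {x} {y} _ _ →
            trans (≢true⇒false (λ t → none (i₀ , x , t))) (sym (≢true⇒false (λ t → none (i₀ , y , t)))))
    ... | yes (i , j , t) = m₀ i , m₀ j
      , (λ e → i≢j (proj₁ (Layout.unique L (proj₂ (someM i)) (≡-subst (F j M) (sym e) (proj₂ (someM j))))))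
      , trans (m₀-edge i≢j) t
      where
      i≢j : i ≢ j
      i≢j refl = true≢false t (adj-irrefl Q i)

    -- The N-vertices, the vertices counted as M, and each released O-block are pairwise without
    -- edges, so a prime is edgeless on two vertices or lies in one of these parts. N-vertices and
    -- single O-blocks look as in `H`. The M-like part is a substitution into `Q`: inside one block
    -- it agrees with `H`, and otherwise the prime has one vertex per block.
    good-E : ∀ B {K} → Realises (E B) (label H) Full K → Good Z K
    good-E B {K} r Q′ pr (f , f-inj , fe) = cases (prime-blocks {Q′} pr (Sum.≡-dec Fin._≟_ Bool._≟_) (part ∘ g) modules)
      where
      module R = Realises r
      g : Fin (size Q′) → Fin h
      g = R.at ∘ f
      g-inj : ∀ {x y} → g x ≡ g y → x ≡ y
      g-inj e = f-inj (R.at-inj e)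
      g-edge : ∀ x y → E B (g x) (g y) ≡ adj Q′ x y
      g-edge x y = trans (R.at-edge (f x) (f y)) (fe x y)
      Part : Set
      Part = Fin s ⊎ Bool
      partOf : Role → Fin s → Part
      partOf M _ = inj₂ true
      partOf N _ = inj₂ false
      partOf O i = inj₁ i
      part : Fin h → Part
      part x = partOf (roleAt B x) (hue x)
      apart : ∀ {x y} → part x ≢ part y → E B x y ≡ false
      apart {x} {y} ne = E-by B
        (λ e → same e λ q → ne (cong₂ partOf (cong₂ keep q (cong B e)) e))
        (λ n → roles (roleAt B x) (roleAt B y) ne)
        where
        roles : ∀ ρ σ {i j b} → partOf ρ i ≢ partOf σ j → roleEdge ρ σ b ≡ false
        roles M M ne = ⊥-elim (ne refl)
        roles M N ne = refl
        roles M O ne = refl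
        roles N M ne = refl
        roles N N ne = ⊥-elim (ne refl)
        roles N O ne = refl
        roles O σ ne = refl
      modules : ∀ {v x y} → part (g v) ≢ part (g x) → part (g x) ≡ part (g y) → adj Q′ v x ≡ adj Q′ v y
      modules {v} {x} {y} ne e = trans (sym (g-edge v x)) (trans (apart ne)
        (trans (sym (apart λ q → ne (trans q (sym e)))) (g-edge v y)))
      in-H : (∀ x y → E B (g x) (g y) ≡ adj H (g x) (g y)) → InducedSub Q′ Z
      in-H eq = at ∘ g , (λ e → g-inj (at-inj e)) , λ x y → trans (at-edge (g x) (g y)) (trans (sym (eq x y)) (g-edge x y))
      x₀ : Fin (size Q′)
      x₀ = proj₁ (two-vertices (proj₁ pr))
      partOf-N : ∀ ρ i → partOf ρ i ≡ inj₂ false → ρ ≡ N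
      partOf-N N i e = refl
      partOf-M : ∀ ρ i → partOf ρ i ≡ inj₂ true → ρ ≡ M
      partOf-M M i e = refl
      partOf-O : ∀ ρ i j → partOf ρ i ≡ inj₁ j → i ≡ j
      partOf-O O i j refl = refl
      all-M : (∀ x → roleAt B (g x) ≡ M) → InducedSub Q′ Z
      all-M isM = by-hue (prime-blocks {Q′} pr Fin._≟_ (hue ∘ g) λ {v} {x} {y} ne e →
          trans (sym (g-edge v x)) (trans (M-edge ne) (trans (cong (adj Q (hue (g v))) e)
            (trans (sym (M-edge λ q → ne (trans q (sym e)))) (g-edge v y)))))
        where
        M-edge : ∀ {x y} → hue (g x) ≢ hue (g y) → E B (g x) (g y) ≡ adj Q (hue (g x)) (hue (g y))
        M-edge {x} {y} ne = trans (E-diff B ne) (cong₂ (λ ρ σ → roleEdge ρ σ (adj Q (hue (g x)) (hue (g y)))) (isM x) (isM y))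
        by-hue : (∀ x y → hue (g x) ≡ hue (g y)) ⊎ (∀ x y → hue (g x) ≡ hue (g y) → x ≡ y) → InducedSub Q′ Z
        by-hue (inj₁ all) = in-H λ x y → E-same B (all x y)
        -- With at most one vertex in each block, every vertex can be exchanged for a genuine
        -- M-vertex of its block, so the unreleased O-vertices disappear.
        by-hue (inj₂ inj) = m₀ ∘ hue ∘ g
          , (λ {x} {y} e → inj x y (proj₁ (Layout.unique L (proj₂ (someM (hue (g x)))) (≡-subst (F _ M) (sym e) (proj₂ (someM (hue (g y))))))))
          , adj-off-diagonal Q′ Z (m₀ ∘ hue ∘ g) λ {x} {y} ne → let ne′ = λ q → ne (inj x y q) in
              trans (m₀-edge ne′) (trans (sym (M-edge ne′)) (g-edge x y))
      cases : (∀ x y → part (g x) ≡ part (g y)) ⊎ (∀ x y → part (g x) ≡ part (g y) → x ≡ y) → InducedSub Q′ Z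
      cases (inj₂ inj) = let (u , v , ne , e) = nonedge in
        good-constant {Z} {Q′} pr false (λ {x} {y} n → trans (sym (g-edge x y)) (apart λ q → n (inj x y q))) u v ne e
      cases (inj₁ all) = by-part (part (g x₀)) (λ x → all x x₀)
        where
        by-part : ∀ p′ → (∀ x → part (g x) ≡ p′) → InducedSub Q′ Z
        by-part (inj₁ i) eq = in-H λ x y → E-same B (trans (partOf-O _ _ i (eq x)) (sym (partOf-O _ _ i (eq y))))
        by-part (inj₂ true) eq = all-M λ x → partOf-M _ _ (eq x)
        by-part (inj₂ false) eq = in-H λ x y → E-role B (isN x) (isN y)
          where
          isN : ∀ x → roleAt B (g x) ≡ role (g x)
          isN x = let q = partOf-N (roleAt B (g x)) _ (eq x) in trans q (sym (keep-N _ _ q))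

    Piece : Fin s → Role → Fin h → Set
    Piece i ρ x = hue x ≡ i × role x ≡ ρ

    piece : ∀ i ρ → Σ Graph (Realises (adj H) (label H) (Piece i ρ))
    piece i ρ = realise (adj-sym H) id id (adj-irrefl H) (λ x → (hue x Fin.≟ i) ×-dec (role x ≟R ρ)) (λ {x} _ → x , refl)

    g : Role → Fin s → Graph
    g ρ i = proj₁ (piece i ρ)

    MO : Fin s → Graph
    MO i = g M i ⊔ g O i

    MO-real : ∀ i → Realises (adj H) (label H) (Piece i M ∪ Piece i O) (MO i)
    MO-real i = juxt-realises (adj-sym H) (proj₂ (piece i M)) (proj₂ (piece i O)) (λ _ → false)
      (λ (_ , e) (_ , e′) → case trans (sym e) e′ of λ ())
      (λ x y → let (a , b) = M.at-in x ; (c , d) = O.at-in y in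
         same (trans a (sym c)) λ q → case trans (sym b) (trans q d) of λ ())
      where
      module M = Realises (proj₂ (piece i M))
      module O = Realises (proj₂ (piece i O))

    NMO-real : ∀ i → Real (λ x → ∃ λ ρ → F i ρ x) (g N i ⊔ MO i)
    NMO-real i = realises-resp
      ( (λ { (x , inj₁ (a , b) , refl) → N , in-spot a b ; (x , inj₂ (inj₁ (a , b)) , refl) → M , in-spot a b ; (x , inj₂ (inj₂ (a , b)) , refl) → O , in-spot a b })
      , (λ { (ρ , u) → let (x , e) = at-onto (proj₂ U≐ (i , ρ , u)) in x , sort ρ (≡-subst (F i ρ) (sym e) u) , e }) )
      (realises-comp real (juxt-realises (adj-sym H) (proj₂ (piece i N)) (MO-real i) (λ _ → false)
        (λ { (_ , e) (inj₁ (_ , e′)) → case trans (sym e) e′ of λ () ; (_ , e) (inj₂ (_ , e′)) → case trans (sym e) e′ of λ () })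
        (λ x y → let (a , b) = N.at-in x in case MO.at-in y of λ
          { (inj₁ (c , d)) → same (trans a (sym c)) (λ q → case trans (sym b) (trans q d) of λ ())
          ; (inj₂ (c , d)) → same (trans a (sym c)) (λ q → case trans (sym b) (trans q d) of λ ()) })))
      where
      module N = Realises (proj₂ (piece i N))
      module MO = Realises (MO-real i)
      sort : ∀ ρ {x} → F i ρ (at x) → (Piece i N ∪ (Piece i M ∪ Piece i O)) x
      sort M u = inj₂ (inj₁ (hue-of u , role-of u))
      sort N u = inj₁ (hue-of u , role-of u)
      sort O u = inj₂ (inj₂ (hue-of u , role-of u))

    AnalysedE : (Fin s → Bool) → Set
    AnalysedE B = ∀ K → Realises (E B) (label H) Full K → Analysed K

    none : Fin s → Bool
    none _ = false

    none-real : Realises (E none) (label H) Full (subst (compl Q) (g N) ⊔ subst Q MO)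
    none-real = realises-resp ((λ _ → tt) , λ {x} _ → sort x (role x) refl)
      (juxt-realises (E-sym none) rN rMO (λ _ → false)
        (λ { (i , _ , e) (j , inj₁ (_ , e′)) → case trans (sym e) e′ of λ () ; (i , _ , e) (j , inj₂ (_ , e′)) → case trans (sym e) e′ of λ () })
        (λ x y → cross (Realises.at-in rN x) (Realises.at-in rMO y)))
      where
      local : ∀ {i K X} → (∀ {x} → X x → hue x ≡ i) → Realises (adj H) (label H) X K → Realises (E none) (label H) X K
      local inX = realises-edge (λ a b → sym (E-same none (trans (inX a) (sym (inX b)))))
      rN : Realises (E none) (label H) (λ x → ∃ λ i → Piece i N x) (subst (compl Q) (g N))
      rN = subst-realises (E-sym none) (compl Q) (g N) (λ i → local proj₁ (proj₂ (piece i N)))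
        (λ (a , _) (b , _) → trans (sym a) b)
        λ { {v = v} {w} ne (refl , b) (refl , d) → trans (E-diff none ne)
              (trans (cong₂ (λ ρ σ → roleEdge (keep ρ false) (keep σ false) (adj Q (hue v) (hue w))) b d) (sym (adj-compl Q ne))) }
      asM : ∀ {i x} → (Piece i M ∪ Piece i O) x → keep (role x) false ≡ M
      asM (inj₁ (_ , e)) = cong (λ ρ → keep ρ false) e
      asM (inj₂ (_ , e)) = cong (λ ρ → keep ρ false) e
      hueMO : ∀ {i x} → (Piece i M ∪ Piece i O) x → hue x ≡ i
      hueMO = [ proj₁ , proj₁ ]
      rMO : Realises (E none) (label H) (λ x → ∃ λ i → (Piece i M ∪ Piece i O) x) (subst Q MO)
      rMO = subst-realises (E-sym none) Q MO (λ i → local hueMO (MO-real i))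
        (λ a b → trans (sym (hueMO a)) (hueMO b))
        λ {i} {j} {v} {w} ne a b → trans (E-diff none (λ e → ne (trans (sym (hueMO a)) (trans e (hueMO b)))))
          (trans (cong₂ (λ ρ σ → roleEdge ρ σ (adj Q (hue v) (hue w))) (asM a) (asM b)) (cong₂ (adj Q) (hueMO a) (hueMO b)))
      cross : ∀ {x y} → (∃ λ i → Piece i N x) → (∃ λ j → (Piece j M ∪ Piece j O) y) → E none x y ≡ false
      cross {x} {y} (i , _ , e) (j , u) = E-by none
        (λ q → same q λ r → case trans (sym (cong (λ ρ → keep ρ false) (trans (sym r) e))) (asM u) of λ ())
        λ _ → cong₂ (λ ρ σ → roleEdge ρ σ (adj Q (hue x) (hue y))) (cong (λ ρ → keep ρ false) e) (asM u)
      sort : ∀ x ρ → role x ≡ ρ → ((λ x → ∃ λ i → Piece i N x) ∪ (λ x → ∃ λ i → (Piece i M ∪ Piece i O) x)) x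
      sort x M e = inj₂ (hue x , inj₁ (refl , e))
      sort x N e = inj₁ (hue x , refl , e)
      sort x O e = inj₂ (hue x , inj₂ (refl , e))

    analysed-none : AnalysedE none
    -- `p↓` substitutes its first family into the complement of the quotient, so that family is the
    -- N-part; the second one is M with O beside it.
    analysed-none K r = (tensor ▷ (rule emptyG (λ ()) _ _ (r-p (p Q (g N) MO Q-prime Q-size nonemptyN)) (plug-empty _) (plug-empty _)
        , good-E none none-real)) ▷≅ realises-unique none-real r
      where
      tensor : Analysed (bigTensor s (λ i → g N i ⊔ MO i))
      tensor = let (u , v , ne , e) = edge in analysed-bigTensor u v ne e s _ λ i → premises i _ (NMO-real i)
      nonemptyN : ∀ i → NonEmpty (g N i)
      nonemptyN i = let (v , u) = someN i ; (x , e) = at-onto (proj₂ U≐ (i , N , u))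
                        u′ = ≡-subst (F i N) (sym e) u
                    in fin-nonempty (proj₁ (Realises.at-onto (proj₂ (piece i N)) (hue-of u′ , role-of u′)))

    insert : (Fin s → Bool) → Fin s → Fin s → Bool
    insert B i j = B j ∨ does (j Fin.≟ i)

    insert-≢ : ∀ B {i j} → j ≢ i → insert B i j ≡ B j
    insert-≢ B {i} {j} ne = trans (cong (B j ∨_) (dec-false (j Fin.≟ i) ne)) (Bool.∨-identityʳ _)

    insert-self : ∀ B i → insert B i i ≡ true
    insert-self B i = trans (cong (B i ∨_) (dec-true (i Fin.≟ i) refl)) (Bool.∨-zeroʳ _)

    release-step : ∀ B i → AnalysedE B → AnalysedE (insert B i)
    release-step B i a K r = release C (g O i) S (good-E (insert B i) after) (a _ before) ▷≅ realises-unique after r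
      where
      Rest : Fin h → Set
      Rest x = ¬ Piece i O x
      rest : Σ Graph (Realises (E B) (label H) Rest)
      rest = realise (E-sym B) id id (E-irrefl B) (λ x → ¬? ((hue x Fin.≟ i) ×-dec (role x ≟R O))) (λ {x} _ → x , refl)
      C : Graph
      C = proj₁ rest
      module C = Realises (proj₂ rest)
      module P = Realises (proj₂ (piece i O))
      -- The edges from a vertex `y` outside to the O-part of block `i` do not depend on the vertex
      -- chosen in it, which makes them a set `S` for `ss↓`.
      link : Fin h → Bool
      link y = choose (hue y Fin.≟ i) false (roleEdge (roleAt B y) (keep O (B i)) (adj Q (hue y) i))
      S : Fin (size C) → Bool
      S c = link (C.at c)
      local : ∀ B → Realises (E B) (label H) (Piece i O) (g O i)
      local B = realises-edge (λ (a , _) (b , _) → sym (E-same B (trans a (sym b)))) (proj₂ (piece i O))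
      linked : ∀ {y x} → Rest y → Piece i O x → E B y x ≡ link y
      linked {y} {x} n (refl , e) = sym (choose-elim (hue y Fin.≟ hue x)
        (λ q → sym (trans (E-same B q) (same q λ e′ → n (q , trans e′ e))))
        λ ne → sym (trans (E-diff B ne) (cong (λ ρ → roleEdge (roleAt B y) (keep ρ (B (hue x))) (adj Q (hue y) (hue x))) e)))
      unlinked : ∀ {y x} → Rest y → Piece i O x → E (insert B i) y x ≡ false
      unlinked {y} {x} n (refl , e) = E-by (insert B i) (λ q → same q λ e′ → n (q , trans e′ e))
        λ _ → trans (cong₂ (λ ρ b → roleEdge (roleAt (insert B i) y) (keep ρ b) (adj Q (hue y) (hue x))) e (insert-self B (hue x)))
                (roleEdge-sym (roleAt (insert B i) y) O _)
      unchanged : ∀ {x} → Rest x → roleAt B x ≡ roleAt (insert B i) x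
      unchanged {x} n with role x ≟R O
      ... | no ne = keep-≢ (role x) ne
      ... | yes e = cong (keep (role x)) (sym (insert-≢ B λ q → n (q , e)))
      sort : ∀ x → (Rest ∪ Piece i O) x
      sort x with (hue x Fin.≟ i) ×-dec (role x ≟R O)
      ... | yes q = inj₂ q
      ... | no n = inj₁ n
      before : Realises (E B) (label H) Full (juxt C (g O i) S)
      before = realises-resp ((λ _ → tt) , λ {x} _ → sort x)
        (juxt-realises (E-sym B) (proj₂ rest) (local B) S (λ n p′ → n p′) (λ x y → linked (C.at-in x) (P.at-in y)))
      after : Realises (E (insert B i)) (label H) Full (C ⊔ g O i)
      after = realises-resp ((λ _ → tt) , λ {x} _ → sort x)
        (juxt-realises (E-sym (insert B i))
          (realises-edge (λ {x} {y} a b → E-by B (λ e → sym (E-same (insert B i) e)) (λ n →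
             trans (cong₂ (λ ρ σ → roleEdge ρ σ (adj Q (hue x) (hue y))) (unchanged a) (unchanged b)) (sym (E-diff (insert B i) n)))) (proj₂ rest))
          (local (insert B i)) (λ _ → false) (λ n p′ → n p′) (λ x y → unlinked (C.at-in x) (P.at-in y)))

    release-all : ∀ is B → AnalysedE B → (∀ i → B i ≡ true ⊎ i ∈ is) → Σ (Fin s → Bool) λ B → (∀ i → B i ≡ true) × AnalysedE B
    release-all [] B a cover = B , (λ i → case cover i of λ { (inj₁ t) → t }) , a
    release-all (j ∷ is) B a cover = release-all is (insert B j) (release-step B j a) λ i → case cover i of λ
      { (inj₁ t) → inj₁ (cong (_∨ does (i Fin.≟ j)) t)
      ; (inj₂ (here refl)) → inj₁ (insert-self B i)
      ; (inj₂ (there k)) → inj₂ k }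

    result : Analysed H
    result = let (B , all , a) = release-all (allFin s) none analysed-none (λ i → inj₂ (List.∈-allFin i))
                 kept = λ x → trans (cong (keep (role x)) (all (hue x))) (keep-true (role x))
             in a H (realises-edge (λ {x} {y} _ _ → sym (E-role B (kept x) (kept y))) (realises-self H))

  exists-real : ∀ {U} → Decidable U → Σ Graph (Real U)
  exists-real U? = realise (adj-sym Z) id id (adj-irrefl Z) U? (λ {x} _ → x , refl)

  -- Quantifying over all realisations `H` of `U` allows each case to build the presentation that
  -- suits its rule and to end with an isomorphism.
  analyse : ∀ {U} → ⊢ U → ∀ H → Real U H → Analysed H
  analyse {U} (ε e) H r = analysed-empty ▷≅
    realises-unique (realises {U = U} (λ ()) (λ {}) (λ ()) (λ u → ⊥-elim (e u)) (λ ()) (λ ())) r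
  analyse {U} (ax x y ux uy uz e l) H r = (analysed-empty ▷
      (rule emptyG (λ ()) _ _ (r-ai (ai (label Z y))) (plug-empty _) (plug-empty _) , good-real real)) ▷≅ realises-unique real r
    where
    at-vertex : ∀ v {b} → label Z v ≡ b → Real (_≡ v) (single b)
    at-vertex v e = realises (λ _ → v) (λ { {zero} {zero} _ → refl }) (λ _ → refl) (λ q → zero , sym q)
      (λ { zero zero → adj-irrefl Z v }) (λ _ → e)
    real : Real U (single (dualA (label Z y)) ⊔ single (label Z y))
    real = realises-resp ([ (λ { refl → ux }) , (λ { refl → uy }) ] , uz)
      (juxt-realises (adj-sym Z) (at-vertex x l) (at-vertex y refl) (λ _ → false)
        (λ { refl refl → dualA-≢ _ l }) (λ _ _ → e))
  analyse {U} (plg G D W (f , g) sGD sGW dj md h₁ h₂) H r = by-D (Fin.any? D?)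
    where
    GD? : Decidable (G ∪ D)
    GD? = mem? Fin._≟_ h₁
    W? : Decidable W
    W? = mem? Fin._≟_ h₂
    G? : Decidable G
    G? v with GD? v
    ... | no n = no (n ∘ inj₁)
    ... | yes (inj₁ a) = yes a
    ... | yes (inj₂ b) = no λ a → proj₁ (sGD a b) refl
    D? : Decidable D
    D? v with GD? v
    ... | no n = no (n ∘ inj₂)
    ... | yes (inj₁ a) = no λ b → proj₁ (sGD a b) refl
    ... | yes (inj₂ b) = yes b
    kG = proj₁ (exists-real G?)
    kD = proj₁ (exists-real D?)
    kW = proj₁ (exists-real W?)
    rG : Real G kG
    rG = proj₂ (exists-real G?)
    rD : Real D kD
    rD = proj₂ (exists-real D?)
    rW : Real W kW
    rW = proj₂ (exists-real W?)
    aW : Analysed kW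
    aW = analyse h₂ kW rW
    none : ∀ {n} → Fin n → Bool
    none _ = false
    flip-sep : ∀ {x y} → adj Z x y ≡ false → adj Z y x ≡ false
    flip-sep e = trans (adj-sym Z _ _) e
    by-D : Dec (∃ D) → Analysed H
    -- The premise derives `D` and `G` only jointly, so both enter the hole at `R`, and `G` is
    -- released afterwards. The graphs in between are good by `good-plug`, because W[D] is induced
    -- in `Z`.
    by-D (yes (v₀ , d₀)) = release (juxt kW kD R) kG _ (good-real rWDG)
        (analysed-plug kW R (kD ⊔ kG) (λ K → good-plug {Z} kW R kD K (good-real rWD) some) aW (analyse h₁ _ rDG)
          ▷≅ juxt-assoc kW kD kG R none)
        ▷≅ realises-unique rWDG r
      where
      R : Fin (size kW) → Bool
      -- Every vertex of the module `D` has the same neighbours in `W`, so one of them determines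
      -- `R`.
      R w = adj Z (Realises.at rW w) v₀
      some : 1 ≤ size kD
      some = fin-nonempty (proj₁ (Realises.at-onto rD d₀))
      rDG : Real (G ∪ D) (kD ⊔ kG)
      rDG = realises-resp ([ inj₂ , inj₁ ] , [ inj₂ , inj₁ ])
        (juxt-realises (adj-sym Z) rD rG none (λ d a → proj₁ (sGD a d) refl)
          (λ x y → flip-sep (proj₂ (sGD (Realises.at-in rG y) (Realises.at-in rD x)))))
      rWD : Real (W ∪ D) (juxt kW kD R)
      rWD = juxt-realises (adj-sym Z) rW rD R (λ w d → dj d w refl)
        (λ x y → trans (adj-sym Z _ _) (trans (md (Realises.at-in rD y) d₀ (Realises.at-in rW x)) (adj-sym Z _ _)))
      rWDG : Real U (juxt kW kD R ⊔ kG)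
      rWDG = realises-resp
        ( (λ { (inj₁ (inj₁ w)) → g (inj₂ w) ; (inj₁ (inj₂ d)) → g (inj₁ (inj₂ d)) ; (inj₂ a) → g (inj₁ (inj₁ a)) })
        , (λ u → case f u of λ { (inj₁ (inj₁ a)) → inj₂ a ; (inj₁ (inj₂ d)) → inj₁ (inj₂ d) ; (inj₂ w) → inj₁ (inj₁ w) }) )
        (juxt-realises (adj-sym Z) rWD rG none
          (λ { (inj₁ w) a → proj₁ (sGW a w) refl ; (inj₂ d) a → proj₁ (sGD a d) refl })
          (λ x y → case Realises.at-in rWD x of λ
            { (inj₁ w) → flip-sep (proj₂ (sGW (Realises.at-in rG y) w)) ; (inj₂ d) → flip-sep (proj₂ (sGD (Realises.at-in rG y) d)) }))
    -- With `D` empty the rule is a mix. `good-plug` asks for an inhabited filling, hence the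
    -- further case distinction on `G`.
    by-D (no no-D) = by-G (Fin.any? G?)
      where
      rWG : Real U (kW ⊔ kG)
      rWG = realises-resp
        ( [ g ∘ inj₂ , g ∘ inj₁ ∘ inj₁ ]
        , (λ u → case f u of λ { (inj₁ (inj₁ a)) → inj₂ a ; (inj₁ (inj₂ d)) → ⊥-elim (no-D (_ , d)) ; (inj₂ w) → inj₁ w }) )
        (juxt-realises (adj-sym Z) rW rG none (λ w a → proj₁ (sGW a w) refl)
          (λ x y → flip-sep (proj₂ (sGW (Realises.at-in rG y) (Realises.at-in rW x)))))
      aG : Analysed kG
      aG = analyse h₁ kG (realises-resp (inj₁ , [ id , (λ d → ⊥-elim (no-D (_ , d))) ]) rG)
      by-G : Dec (∃ G) → Analysed H
      by-G (no no-G) = analyse h₂ H (realises-resp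
        ( (λ u → case f u of λ { (inj₁ (inj₁ a)) → ⊥-elim (no-G (_ , a)) ; (inj₁ (inj₂ d)) → ⊥-elim (no-D (_ , d)) ; (inj₂ w) → w })
        , g ∘ inj₂ ) r)
      by-G (yes (v , a)) = analysed-plug kW none kG
        (λ K → good-plug {Z} kW none kG K (good-real rWG) (fin-nonempty (proj₁ (Realises.at-onto rG a)))) aW aG
        ▷≅ realises-unique rWG r
  analyse {U} (prm Q F pr sz L m n U≐ ps) H r =
    PrimeCase.result Q pr sz F L m n U U≐ (λ i K → analyse (ps i) K) H r

theorem8p3 : (G : Graph) → Proof GSssUp G →
    Σ (Proof GSssUp G) λ D →
    AllOccurring (λ H → ∀ P → Connector P H → Subconnector P G) D
-- The ambient graph of the unfolding is `G` itself, so that goodness bounds every prime by those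
-- induced in `G`.
theorem8p3 G d = let (d′ , good) = Primal.analyse G (sound d (Calculus.ε λ {})) G (realises-self G) in
  d′ , weaken d′ good
  where
  weaken : ∀ {H K} (d : Derivation GSssUp H K) → AllOccurring (Good G) d →
    AllOccurring (λ H → ∀ P → Connector P H → Subconnector P G) d
  weaken (done H) g = good-subconnector {G} {H} g
  weaken (step {G = H} s d) (g , gs) = good-subconnector {G} {H} g , weaken d gs
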